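{- Let $A$ be a fixed finite alphabet and let $\phi(x)$ be a formula of $\mathrm{FO}^2(A^*,\sqsubseteq)$ with at most one free variable $x$ and without regular predicates. Let $L_\phi=\{u\in A^*~|~\phi(u)\text{ holds}\}$. Then $L_\phi$ is a piecewise-testable language with $h(L_\phi)$ in $2^{2^{O(|\phi|)}}$. Furthermore, computing a canonical DFA for $L_\phi$ (hence deciding the truth of $\phi$) can be done in $\mathsf{3\text{ - }EXPTIME}$.
   Context: $\mathrm{FO}(A^*,\sqsubseteq)$ is the first-order logic interpreted over the domain $A^*$ of finite words over $A$, whose only predicate symbol is $\sqsubseteq$, interpreted as the (scattered) subword relation: $u\sqsubseteq v$ iff $u=a_1\cdots a_n$ and $v=v_0a_1v_1\cdots a_nv_n$ for some words $v_i$. Terms are variables and constants, where every word $u\in A^*$ is a constant symbol denoting itself. $\mathrm{FO}^2$ is the fragment of formulae that use at most two distinct variables (free or bound). "Without regular predicates" means the formula uses no monadic predicates of the form $x\in L$ for regular $L$. $|\phi|$ is the size of $\phi$. For $n\in\mathbb{N}$, $u\sim_n v$ iff $u$ and $v$ have the same subwords of length at most $n$. A language $L\subseteq A^*$ is $n$-piecewise-testable ($n$-PT) if it is a union of $\sim_n$-equivalence classes; it is piecewise-testable if it is $n$-PT for some $n$, and its height $h(L)$ is the least such $n$ ($h(L)=\infty$ if $L$ is not PT). -}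

module Defs where

open import Level using (0ℓ)
open import Data.Bool.Base using (Bool; T)
open import Data.Fin.Base using (Fin; toℕ)
open import Data.List.Base using (List; []; _∷_; [_]; _++_; map; length; foldl; replicate; concatMap; allFin)
open import Data.List.Relation.Binary.Sublist.Propositional using (_⊆_)
open import Data.Maybe.Base using (Maybe; just; nothing)
open import Data.Nat.Base using (ℕ; zero; suc; _+_; _*_; _^_; _≤_)
open import Data.Product.Base using (Σ; ∃; _×_; _,_)
open import Data.Sum.Base using (_⊎_; inj₁; inj₂)
open import Data.Vec.Base as Vec using (Vec; lookup; _[_]≔_)
open import Function.Bundles using (_↔_; _⇔_)
open import Relation.Binary.PropositionalEquality.Core using (_≡_; _≢_)
open import Relation.Nullary using (¬_; Reflects)
open import Relation.Unary using (Pred; _≐_)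

private
  variable
    k m : ℕ

-- The finite alphabet is Fin k.
Word : ℕ → Set
Word k = List (Fin k)

Language : ℕ → Set₁
Language k = Pred (Word k) 0ℓ

infix 4 _⊑_ _∼[_]_

_⊑_ : Word k → Word k → Set
u ⊑ v = u ⊆ v

_∼[_]_ : Word k → ℕ → Word k → Set
u ∼[ n ] v = ∀ w → length w ≤ n → w ⊑ u ⇔ w ⊑ v

-- L is a union of ∼[ n ]-classes, namely those of the words in I.
_-PiecewiseTestable_ : ℕ → Language k → Set₁
_-PiecewiseTestable_ {k} n L =
  Σ (Language k) λ I → L ≐ λ v → ∃ λ u → I u × u ∼[ n ] v

PiecewiseTestable : Language k → Set₁
PiecewiseTestable L = ∃ λ n → n -PiecewiseTestable L

IsHeight : Language k → ℕ → Set₁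
IsHeight L h = h -PiecewiseTestable L × (∀ n → n -PiecewiseTestable L → h ≤ n)

-- The variables are the elements of Fin m, so FO k m is the m-variable fragment.
data Term (k m : ℕ) : Set where
  var   : Fin m → Term k m
  const : Word k → Term k m

infix  7 _⊑′_
infixr 6 _∧′_
infixr 5 _∨′_
infixr 4 _⇒′_

data FO (k m : ℕ) : Set where
  _⊑′_           : Term k m → Term k m → FO k m
  ¬′_            : FO k m → FO k m
  _∧′_ _∨′_ _⇒′_ : FO k m → FO k m → FO k m
  ∃′ ∀′          : Fin m → FO k m → FO k m

Env : ℕ → ℕ → Set
Env k m = Vec (Word k) m

⟦_⟧ : Term k m → Env k m → Word k
⟦ var v ⟧   ρ = lookup ρ v
⟦ const u ⟧ ρ = u

infix 3 _⊨_

_⊨_ : Env k m → FO k m → Set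
ρ ⊨ s ⊑′ t = ⟦ s ⟧ ρ ⊑ ⟦ t ⟧ ρ
ρ ⊨ ¬′ φ   = ¬ (ρ ⊨ φ)
ρ ⊨ φ ∧′ ψ = (ρ ⊨ φ) × (ρ ⊨ ψ)
ρ ⊨ φ ∨′ ψ = (ρ ⊨ φ) ⊎ (ρ ⊨ ψ)
ρ ⊨ φ ⇒′ ψ = (ρ ⊨ φ) → (ρ ⊨ ψ)
ρ ⊨ ∃′ v φ = ∃ λ u → ρ [ v ]≔ u ⊨ φ
ρ ⊨ ∀′ v φ = ∀ u → ρ [ v ]≔ u ⊨ φ

Free : Fin m → FO k m → Set
Free v (s ⊑′ t) = s ≡ var v ⊎ t ≡ var v
Free v (¬′ φ)   = Free v φ
Free v (φ ∧′ ψ) = Free v φ ⊎ Free v ψ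
Free v (φ ∨′ ψ) = Free v φ ⊎ Free v ψ
Free v (φ ⇒′ ψ) = Free v φ ⊎ Free v ψ
Free v (∃′ w φ) = v ≢ w × Free v φ
Free v (∀′ w φ) = v ≢ w × Free v φ

-- Formulae are written in Polish notation; a constant is the list of its
-- letters between the symbols ⟨ and ⟩.
data Symbol (k m : ℕ) : Set where
  var                              : Fin m → Symbol k m
  letter                           : Fin k → Symbol k m
  `⟨ `⟩ `⊑ `¬ `∧ `∨ `⇒ `∃ `∀ : Symbol k m

encodeTerm : Term k m → List (Symbol k m)
encodeTerm (var v)   = [ var v ]
encodeTerm (const u) = `⟨ ∷ map letter u ++ [ `⟩ ]

encode : FO k m → List (Symbol k m)
encode (s ⊑′ t) = `⊑ ∷ encodeTerm s ++ encodeTerm t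
encode (¬′ φ)   = `¬ ∷ encode φ
encode (φ ∧′ ψ) = `∧ ∷ encode φ ++ encode ψ
encode (φ ∨′ ψ) = `∨ ∷ encode φ ++ encode ψ
encode (φ ⇒′ ψ) = `⇒ ∷ encode φ ++ encode ψ
encode (∃′ v φ) = `∃ ∷ var v ∷ encode φ
encode (∀′ v φ) = `∀ ∷ var v ∷ encode φ

∣_∣ : FO k m → ℕ
∣ φ ∣ = length (encode φ)

AtMostOneFree : FO k m → Set
AtMostOneFree φ = ∃ λ x → ∀ v → Free v φ → v ≡ x

Closed : FO k m → Set
Closed φ = ∀ v → ¬ Free v φ

-- Every variable is set to u; when φ has at most one free variable x, only
-- the value of x matters.
L⟨_⟩ : FO k m → Language k
L⟨ φ ⟩ u = Vec.replicate _ u ⊨ φ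

True : FO k m → Set
True φ = ∀ ρ → ρ ⊨ φ

record DFA (k : ℕ) : Set where
  field
    size   : ℕ
    start  : Fin size
    δ      : Fin size → Fin k → Fin size
    final  : Fin size → Bool

Recognizes : DFA k → Language k → Set
Recognizes D L = L ≐ λ w → T (final (foldl δ start w))
  where open DFA D

-- Canonical: the (complete) minimal automaton, unique up to isomorphism.
IsCanonicalDFA : DFA k → Language k → Set
IsCanonicalDFA D L =
  Recognizes D L × (∀ D′ → Recognizes D′ L → DFA.size D ≤ DFA.size D′)

-- An automaton is written as its start state followed, for each state in
-- turn, by its acceptance status and its successor under each letter.
-- State i is written as i ticks and an end marker.
data DFASymbol : Set where
  tick end : DFASymbol
  status   : Bool → DFASymbol

encodeState : ∀ {n} → Fin n → List DFASymbol
encodeState q = replicate (toℕ q) tick ++ [ end ]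

encodeDFA : DFA k → List DFASymbol
encodeDFA {k} D =
  encodeState start ++
  concatMap (λ q → status (final q) ∷
                   concatMap (λ a → encodeState (δ q a)) (allFin k))
            (allFin size)
  where open DFA D

Finite : Set → Set
Finite X = ∃ λ n → X ↔ Fin n

data Cell (I O W : Set) : Set where
  blank  : Cell I O W
  input  : I → Cell I O W
  output : O → Cell I O W
  work   : W → Cell I O W

data Move : Set where
  left stay right : Move

-- I and O are the input and output alphabets; there are suc extraTapes tapes.
record TM (I O : Set) : Set₁ where
  field
    State      : Set
    Work       : Set
    extraTapes : ℕ

  Γ : Set
  Γ = Cell I O Work

  tapes : ℕ
  tapes = suc extraTapes

  -- The machine halts when the transition function returns nothing.
  field
    finiteState : Finite State
    finiteΓ     : Finite Γ
    start       : State
    transition  : State → Vec Γ tapes → Maybe (State × Vec (Γ × Move) tapes)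

-- A two-way infinite tape, blank beyond the two lists; the list of cells to
-- the left of the head has the cell nearest to the head first.
record Tape (Γ : Set) : Set where
  constructor tape
  field
    before : List Γ
    head   : Γ
    after  : List Γ

module _ {I O W : Set} where

  move : Move → Tape (Cell I O W) → Tape (Cell I O W)
  move left  (tape []       x rs)       = tape [] blank (x ∷ rs)
  move left  (tape (l ∷ ls) x rs)       = tape ls l (x ∷ rs)
  move stay  t                          = t
  move right (tape ls       x [])       = tape (x ∷ ls) blank []
  move right (tape ls       x (r ∷ rs)) = tape (x ∷ ls) r rs

  act : Cell I O W × Move → Tape (Cell I O W) → Tape (Cell I O W)
  act (y , d) t = move d record t { head = y }

  inputTape : List I → Tape (Cell I O W)
  inputTape []      = tape [] blank []
  inputTape (i ∷ w) = tape [] (input i) (map input w)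

  outputPrefix : List (Cell I O W) → List O
  outputPrefix (output o ∷ xs) = o ∷ outputPrefix xs
  outputPrefix _               = []

  -- The longest block of output symbols starting at the head.
  readOutput : Tape (Cell I O W) → List O
  readOutput (tape _ x rs) = outputPrefix (x ∷ rs)

module _ {I O : Set} (M : TM I O) where
  open TM M

  Config : Set
  Config = State × Vec (Tape Γ) tapes

  step : Config → Maybe Config
  step (q , ts) with transition q (Vec.map Tape.head ts)
  ... | nothing         = nothing
  ... | just (q′ , acts) = just (q′ , Vec.zipWith act acts ts)

  data HaltsIn : ℕ → Config → Config → Set where
    halt : ∀ {c} → step c ≡ nothing → HaltsIn zero c c
    next : ∀ {n c c′ d} → step c ≡ just c′ → HaltsIn n c′ d → HaltsIn (suc n) c d

  initial : List I → Config
  initial w = start , inputTape w Vec.∷ Vec.replicate _ (tape [] blank [])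

  result : Config → List O
  result (_ , ts) = readOutput (Vec.head ts)

  Computes_↦_Within_ : List I → List O → ℕ → Set
  Computes w ↦ v Within t =
    ∃ λ n → ∃ λ d → n ≤ t × HaltsIn n (initial w) d × result d ≡ v

-- A problem has a set of instances, written as words over I, and a relation
-- telling which words over O are correct answers to an instance.
Solvable3EXPTIME : {Instance I O : Set} →
                   (Instance → List I) → (Instance → List O → Set) → Set₁
Solvable3EXPTIME {_} {I} {O} code Answer =
  Σ (TM I O) λ M → ∃ λ c → ∀ i → ∃ λ v →
    Answer i v ×
    Computes_↦_Within_ M (code i) v (2 ^ (2 ^ (2 ^ (length (code i) ^ c + c))))

CanonicalDFA-3EXPTIME : ℕ → Set₁
CanonicalDFA-3EXPTIME k =
  Solvable3EXPTIME {Instance = Σ (FO k 2) AtMostOneFree}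
    (λ (φ , _) → encode φ)
    (λ (φ , _) v → ∃ λ D → IsCanonicalDFA D L⟨ φ ⟩ × v ≡ encodeDFA D)

Truth-3EXPTIME : ℕ → Set₁
Truth-3EXPTIME k =
  Solvable3EXPTIME {Instance = Σ (FO k 2) Closed}
    (λ (φ , _) → encode φ)
    (λ (φ , _) v → ∃ λ b → Reflects (True φ) b × v ≡ [ b ])

{-# OPTIONS --safe #-}
-- Reading a word from right to left, fewer than (n + 1) ^ k of its letters
-- change the ∼[ n ]-class of the part read so far. Hence a class has short
-- members, a word below y can be enlarged within the class of y by inserting
-- absorbed letters, and a back-and-forth argument shows that the truth of a
-- formula at (x , y) depends only on the order of x and y and on their
-- ∼[ n ]-classes, where n grows from n to (n + 2) ^ (k + 1) at a quantifier.
-- The replies in that argument are hardly longer than the other word, so a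
-- quantifier may be restricted to words of doubly exponential length. A Turing
-- machine therefore evaluates the formula in a table of all pairs of such
-- words; Moore's refinement on the same table yields the Nerode classes. The
-- machine is a program over stacks each of whose loops is executed a triply
-- exponential number of times, since no stack ever gets longer than that.

module Submission where

open import Data.Bool.Base using (Bool; true; false; T; if_then_else_; _∧_; _∨_; _xor_; not)
open import Data.Bool.Properties using (∨-identityʳ; ∨-zeroʳ; ∧-zeroʳ; ¬-not; not-¬)
open import Data.Empty using (⊥; ⊥-elim)
open import Data.Fin using (#_)
open import Data.Fin.Base using (Fin; zero; suc; toℕ; fromℕ<)
open import Data.Fin.Patterns using (0F; 1F; 2F; 3F; 4F; 5F; 6F; 7F; 8F; 9F)
open import Data.Fin.Properties as Fin using (toℕ-fromℕ<; injective⇒≤)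
open import Data.List.Base as List using
  (List; []; _∷_; [_]; _++_; _ʳ++_; map; concat; concatMap; length; reverse; replicate; allFin;
   filter; take; drop; foldl; head; initLast; _∷ʳ′_)
open import Data.List.Membership.Propositional using (_∈_; _∉_; find; lose)
open import Data.List.Membership.Propositional.Properties using
  (∈-++⁺ˡ; ∈-concatMap⁺; ∈-concatMap⁻; ∈-map⁺; ∈-map⁻; ∈-allFin; ∈-filter⁺; ∈-lookup)
open import Data.List.Properties using
  (≡-dec; ∷-injective; ∷-injectiveˡ; ∷-injectiveʳ; ++-assoc; ++-identityʳ; ++-cancelˡ; ++-ʳ++;
   ʳ++-ʳ++; ʳ++-defn; concatMap-cong; filter-notAll; foldl-++; length-++; length-map;
   length-replicate; length-reverse; length-tabulate; length-take; map-∘; map-++; map-ʳ++;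
   map-tabulate; reverse-++; reverse-involutive; tabulate-lookup)
open import Data.List.Relation.Binary.Sublist.Propositional using
  ([]; _∷_; _∷ʳ_; ⊆-refl; ⊆-trans; ⊆-antisym; minimum; from∈; to∈)
open import Data.List.Relation.Binary.Sublist.Propositional.Properties using
  (++⁺; ++⁺ˡ; ++⁺ʳ; length-mono-≤; reverse⁺; reverse⁻; take-⊆)
open import Data.List.Relation.Unary.All as All using (All; []; _∷_)
open import Data.List.Relation.Unary.AllPairs using (AllPairs; []; _∷_)
open import Data.List.Relation.Unary.Any as Any using (Any; here; there)
open import Data.Maybe.Base as Maybe using (Maybe; just; nothing; maybe; fromMaybe)
open import Data.Nat.Base using
  (ℕ; zero; suc; _+_; _*_; _^_; _∸_; _⊔_; _≤_; _<_; z≤n; s≤s; NonZero; >-nonZero)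
open import Data.Nat.Properties
open import Data.Nat.Solver using (module +-*-Solver)
open import Data.Product.Base using (∃; _×_; _,_; proj₁; proj₂; map₁)
open import Data.Sum.Base as Sum using (_⊎_; inj₁; inj₂; [_,_]′)
open import Data.Sum.Function.Propositional using (_⊎-↔_)
open import Data.Unit.Base using (⊤; tt)
open import Data.Vec.Base as Vec using (Vec; []; _∷_; lookup; _[_]≔_; zipWith)
open import Data.Vec.Properties using
  (lookup-map; lookup∘update; lookup∘update′; []≔-idempotent; []≔-commutes; []≔-lookup)
open import Defs
open import Function.Base using (_∘_; id)
open import Function.Bundles using (_↔_; _⇔_; mk↔ₛ′; mk⇔; Equivalence)
open import Function.Properties.Inverse using (↔-refl; ↔-sym; ↔-trans)
open import Relation.Binary.PropositionalEquality hiding ([_])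
open import Relation.Nullary using (¬_; Dec; yes; no; contradiction; ¬?; Reflects; ofʸ; ofⁿ)
open import Relation.Nullary.Decidable using (⌊_⌋; map′; _→-dec_; _×-dec_; _⊎-dec_; decidable-stable)
import Data.List.Relation.Binary.Sublist.DecPropositional as DecSublist
import Data.List.Relation.Unary.All.Properties as All
import Data.List.Relation.Unary.Any.Properties as Any

open Equivalence using (to; from)
open +-*-Solver using (solve; _:=_; _:+_; _:*_; con)

-- With two variables a quantifier forgets the old value of its variable, so a reply has to imitate
-- only one other word. The delicate replies are the incomparable ones. Two different words of equal
-- length are incomparable, so it is enough that the class of y offers two words of the length of
-- x′; classes of the shape p b* r do not, and there x and y would have been comparable. A
-- quantifier raises the level to a fixed power that depends on the alphabet only. Nesting
-- multiplies these powers, whence a double exponential in the size of the formula and no higher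
-- tower. A finite table is wrong near its edge, where a witness may be too long to be listed. Each
-- quantifier therefore gives up a margin g of word lengths, and the table is made large enough that
-- lengths up to 3 * g stay reliable at the end. Refinement may stop after g rounds, since every
-- possible separating suffix is equivalent to one of length at most g.

private
  variable
    A S : Set
    k m n : ℕ

-- Subwords and the equivalences `∼[ n ]`

_⊑?_ : (u v : Word k) → Dec (u ⊑ v)
_⊑?_ = DecSublist._⊆?_ Fin._≟_

_≟ʷ_ : (u v : Word k) → Dec (u ≡ v)
_≟ʷ_ = ≡-dec Fin._≟_

⇔-dec : {A B : Set} → Dec A → Dec B → Dec (A ⇔ B)
⇔-dec a b = map′ (λ (f , g) → mk⇔ f g) (λ e → to e , from e) ((a →-dec b) ×-dec (b →-dec a))

-- The empty word comes first. The truth machine relies on this: the first row of its table is the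
-- pair of empty words.
words : (k n : ℕ) → List (Word k)
words k zero    = [] ∷ []
words k (suc n) = [] ∷ concatMap (λ w → map (_∷ w) (allFin k)) (words k n)

∈-words⁺ : ∀ n {w : Word k} → length w ≤ n → w ∈ words k n
∈-words⁺ zero    {[]}    _       = here refl
∈-words⁺ (suc n) {[]}    _       = here refl
∈-words⁺ (suc n) {c ∷ w} (s≤s l) =
  there (∈-concatMap⁺ (λ w → map (_∷ w) (allFin _)) (lose (∈-words⁺ n l) (∈-map⁺ (_∷ w) (∈-allFin c))))

∈-words⁻ : ∀ n {w : Word k} → w ∈ words k n → length w ≤ n
∈-words⁻ zero    (here refl) = z≤n
∈-words⁻ (suc n) (here refl) = z≤n
∈-words⁻ {k} (suc n) (there p)
  with v , v∈ , w∈ ← find (∈-concatMap⁻ (λ w → map (_∷ w) (allFin k)) {xs = words k n} p)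
  with c , _ , refl ← ∈-map⁻ (_∷ v) w∈ = s≤s (∈-words⁻ n v∈)

∼-refl : ∀ {n} {u : Word k} → u ∼[ n ] u
∼-refl _ _ = mk⇔ id id

∼-sym : ∀ {n} {u v : Word k} → u ∼[ n ] v → v ∼[ n ] u
∼-sym h w l = mk⇔ (from (h w l)) (to (h w l))

∼-trans : ∀ {n} {u v w : Word k} → u ∼[ n ] v → v ∼[ n ] w → u ∼[ n ] w
∼-trans h g w l = mk⇔ (to (g w l) ∘ to (h w l)) (from (h w l) ∘ from (g w l))

∼-reflexive : ∀ {n} {u v : Word k} → u ≡ v → u ∼[ n ] v
∼-reflexive refl = ∼-refl

∼-mono : ∀ {m n} {u v : Word k} → m ≤ n → u ∼[ n ] v → u ∼[ m ] v
∼-mono m≤n h w l = h w (≤-trans l m≤n)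

∼? : ∀ n (u v : Word k) → Dec (u ∼[ n ] v)
∼? {k} n u v =
  map′ (λ a w l → All.lookup a (∈-words⁺ n l)) (λ h → All.tabulate (λ {w} i → h w (∈-words⁻ n i)))
       (All.all? (λ w → ⇔-dec (w ⊑? u) (w ⊑? v)) (words k n))

∼-cons : ∀ {n} c {u v : Word k} → u ∼[ n ] v → c ∷ u ∼[ n ] c ∷ v
∼-cons {k} {n} c h w l = mk⇔ (go h l) (go (∼-sym h) l)
  where
  go : ∀ {u v w : Word k} → u ∼[ n ] v → length w ≤ n → w ⊑ c ∷ u → w ⊑ c ∷ v
  go h l (_ ∷ʳ p)   = c ∷ʳ to (h _ l) p
  go h l (refl ∷ p) = refl ∷ to (h _ (<⇒≤ l)) p

∼-ʳ++ : ∀ {n} (w : Word k) {u v} → u ∼[ n ] v → w ʳ++ u ∼[ n ] w ʳ++ v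
∼-ʳ++ []      h = h
∼-ʳ++ (c ∷ w) h = ∼-ʳ++ w (∼-cons c h)

⊑-split : ∀ (a : Word k) {b s} → s ⊑ a ++ b →
          ∃ λ s₁ → ∃ λ s₂ → s ≡ s₁ ++ s₂ × s₁ ⊑ a × s₂ ⊑ b
⊑-split []      p = [] , _ , refl , [] , p
⊑-split (c ∷ a) (_ ∷ʳ p) with s₁ , s₂ , e , q , r ← ⊑-split a p = s₁ , s₂ , e , _ ∷ʳ q , r
⊑-split (c ∷ a) (refl ∷ p) with s₁ , s₂ , e , q , r ← ⊑-split a p =
  c ∷ s₁ , s₂ , cong (c ∷_) e , refl ∷ q , r

∼-++ : ∀ {n} {a b : Word k} u → a ∼[ n ] b → a ++ u ∼[ n ] b ++ u
∼-++ {k} {n} u h w l = mk⇔ (go h) (go (∼-sym h))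
  where
  go : ∀ {a b : Word k} → a ∼[ n ] b → w ⊑ a ++ u → w ⊑ b ++ u
  go {a} h p with s₁ , s₂ , refl , q , r ← ⊑-split a p =
    ++⁺ (to (h s₁ (≤-trans (≤-trans (m≤m+n _ _) (≤-reflexive (sym (length-++ s₁)))) l)) q) r

∼-reverse : ∀ {n} {u v : Word k} → u ∼[ n ] v → reverse u ∼[ n ] reverse v
∼-reverse {k} {n} h w l = mk⇔ (go h) (go (∼-sym h))
  where
  go : ∀ {u v : Word k} → u ∼[ n ] v → w ⊑ reverse u → w ⊑ reverse v
  go {u} {v} h p = subst (_⊑ reverse v) (reverse-involutive w)
    (reverse⁺ (to (h (reverse w) (≤-trans (≤-reflexive (length-reverse w)) l))
      (reverse⁻ (subst (_⊑ reverse u) (sym (reverse-involutive w)) p))))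

∼-between : ∀ {n} {u v w : Word k} → u ⊑ v → v ⊑ w → u ∼[ n ] w → v ∼[ n ] w
∼-between p q h s l = mk⇔ (λ r → ⊆-trans r q) (λ r → ⊆-trans (from (h s l) r) p)

-- Absorbed letters and the number of letters that matter

Absorbed : ℕ → Word k → Fin k → Set
Absorbed n u c = c ∷ u ∼[ n ] u

absorbed? : ∀ n (u : Word k) c → Dec (Absorbed n u c)
absorbed? n u c = ∼? n (c ∷ u) u

-- Words are read from right to left: in the context u, the letters of w
-- extend u to w ʳ++ u.
kept : ℕ → Word k → Word k → ℕ
kept n u []      = 0
kept n u (c ∷ w) with absorbed? n u c
... | yes _ = kept n (c ∷ u) w
... | no  _ = suc (kept n (c ∷ u) w)

keep : ℕ → Word k → Word k → Word k
keep n u []      = []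
keep n u (c ∷ w) with absorbed? n u c
... | yes _ = keep n (c ∷ u) w
... | no  _ = c ∷ keep n (c ∷ u) w

length-keep : ∀ n u (w : Word k) → length (keep n u w) ≡ kept n u w
length-keep n u []      = refl
length-keep n u (c ∷ w) with absorbed? n u c
... | yes _ = length-keep n (c ∷ u) w
... | no  _ = cong suc (length-keep n (c ∷ u) w)

keep-⊑ : ∀ n u (w : Word k) → keep n u w ⊑ w
keep-⊑ n u []      = []
keep-⊑ n u (c ∷ w) with absorbed? n u c
... | yes _ = c ∷ʳ keep-⊑ n (c ∷ u) w
... | no  _ = refl ∷ keep-⊑ n (c ∷ u) w

-- The thinned context `v` is carried along separately from the full context `u`, against which
-- absorption is tested; an absorbed letter changes `u` only within its class.
keep-∼ : ∀ n {u v} (w : Word k) → v ∼[ n ] u → keep n u w ʳ++ v ∼[ n ] w ʳ++ u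
keep-∼ n []      h = h
keep-∼ n {u} (c ∷ w) h with absorbed? n u c
... | yes a = keep-∼ n w (∼-trans h (∼-sym a))
... | no  _ = keep-∼ n w (∼-cons c h)

kept-++ : ∀ n u (v w : Word k) → kept n u (v ++ w) ≡ kept n u v + kept n (v ʳ++ u) w
kept-++ n u []      w = refl
kept-++ n u (c ∷ v) w with absorbed? n u c
... | yes _ = kept-++ n (c ∷ u) v w
... | no  _ = cong suc (kept-++ n (c ∷ u) v w)

kept-mono : ∀ {n n′} {u u′} {S : List (Fin k)} w → All (_∈ S) w →
            (∀ v d → All (_∈ S) v → d ∈ S → Absorbed n′ (v ʳ++ u′) d → Absorbed n (v ʳ++ u) d) →
            kept n u w ≤ kept n′ u′ w
kept-mono []      _        H = z≤n
kept-mono {n = n} {n′} {u} {u′} (c ∷ w) (i ∷ is) H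
  with absorbed? n u c | absorbed? n′ u′ c | kept-mono {u = c ∷ u} {c ∷ u′} w is (λ v d js j → H (c ∷ v) d (i ∷ js) j)
... | yes _ | yes _ | r = r
... | yes _ | no _  | r = m≤n⇒m≤1+n r
... | no ¬a | yes a | r = contradiction (H [] c [] i a) ¬a
... | no _  | no _  | r = s≤s r

kept-zero : ∀ u (w : Word k) → kept 0 u w ≡ 0
kept-zero u []      = refl
kept-zero u (c ∷ w) with absorbed? 0 u c
... | yes _ = kept-zero (c ∷ u) w
... | no ¬a = contradiction (λ { [] _ → mk⇔ (λ _ → minimum _) (λ _ → minimum _) }) ¬a

-- Scans for the shortest prefix of `w` that, together with the letters `acc` already passed,
-- exhausts `S`. Its last letter `c` is then new, so the part before `c` lives over a smaller
-- alphabet.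
arch : ∀ (S acc : List (Fin k)) w → Any (_∉ acc) S →
       Any (λ c → c ∉ w × c ∉ acc) S ⊎
       ∃ λ w₁ → ∃ λ c → ∃ λ w₂ →
         w ≡ w₁ ++ c ∷ w₂ × c ∈ S × c ∉ acc × c ∉ w₁ × (∀ {e} → e ∈ S → e ∈ c ∷ w₁ ʳ++ acc)
arch S acc []      miss = inj₁ (Any.map (λ m → (λ ()) , m) miss)
arch S acc (d ∷ w) miss with Any.any? (λ c → ¬? (Any.any? (c Fin.≟_) (d ∷ acc))) S
... | yes miss′ with arch S (d ∷ acc) w miss′
...   | inj₂ (w₁ , c , w₂ , refl , c∈ , c∉acc , c∉ , full) =
  inj₂ (d ∷ w₁ , c , w₂ , refl , c∈ , c∉acc ∘ there ,
        (λ { (here refl) → c∉acc (here refl) ; (there i) → c∉ i }) , full)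
...   | inj₁ m =
  inj₁ (Any.map (λ (p , q) → (λ { (here e) → q (here e) ; (there i) → p i }) , q ∘ there) m)
arch S acc (d ∷ w) miss | no ¬m with c , c∈ , c∉ ← find miss
  with Any.any? (c Fin.≟_) (d ∷ acc)
... | no c∉′ = contradiction (lose c∈ c∉′) ¬m
... | yes (there i) = contradiction i c∉
... | yes (here refl) =
  inj₂ ([] , c , w , refl , c∈ , c∉ , (λ ()) , λ {e} e∈ → member e∈ (Any.any? (e Fin.≟_) (d ∷ acc)))
  where
  member : ∀ {e} → e ∈ S → Dec (e ∈ d ∷ acc) → e ∈ d ∷ acc
  member e∈ (yes i) = i
  member e∈ (no ¬i) = contradiction (lose e∈ ¬i) ¬m

-- A factor f with all the letters of S raises by one the level at which they
-- are absorbed; this is what makes kept polynomial in n.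
absorbed-arch : ∀ n {S : List (Fin k)} {f} v d → All (_∈ S) v → d ∈ S → (∀ {e} → e ∈ S → e ∈ f) →
                Absorbed n (v ʳ++ []) d → Absorbed (suc n) (v ʳ++ f) d
absorbed-arch {k} n {S} {f} v d v⊆S d∈S full h s l =
  mk⇔ (subst (λ x → s ⊑ d ∷ x → s ⊑ x) (sym (ʳ++-defn v)) (go l)) (d ∷ʳ_)
  where
  r = reverse v
  h′ : ∀ {t} → length t < n → t ⊑ r → d ∷ t ⊑ r
  h′ {t} l q = to (h (d ∷ t) l) (refl ∷ q)
  single : ∀ {e} → (e ∷ []) ⊑ r → (e ∷ []) ⊑ f
  single p = from∈ (full (All.lookup v⊆S (Any.reverse⁻ (to∈ p))))
  go : ∀ {s} → length s ≤ suc n → s ⊑ d ∷ (r ++ f) → s ⊑ r ++ f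
  go l (_ ∷ʳ p) = p
  go (s≤s l) (refl ∷ p) with ⊑-split r p
  -- Some letter falls into `f`, so the part inside `r` has fewer than n letters and the hypothesis
  -- puts `d` in front of it.
  ... | t₁ , e ∷ t₂ , refl , q , q′ = ++⁺ (h′ (≤-trans (m<m+n (length t₁) {suc (length t₂)} (s≤s z≤n))
      (≤-trans (≤-reflexive (sym (length-++ t₁))) l)) q) q′
  ... | t₁ , [] , refl , q , _ with initLast t₁
  ...   | []       = ++⁺ˡ r (from∈ (full d∈S))
  -- Everything fits into `r`: moving the last letter `e` over to `f` frees one letter of the bound,
  -- again making room for `d`.
  ...   | t ∷ʳ′ e = subst (_⊑ r ++ f) (cong (d ∷_) (sym (++-identityʳ _)))
                      (++⁺ (h′ l′ (⊆-trans (++⁺ʳ _ ⊆-refl) q)) (single (⊆-trans (++⁺ˡ t ⊆-refl) q)))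
    where
    l′ : length t < n
    l′ = ≤-trans (≤-reflexive (trans (+-comm 1 _) (sym (length-++ t))))
        (≤-trans (≤-reflexive (cong length (sym (++-identityʳ (t ++ _))))) l)

kept-∷ : ∀ n u c (w : Word k) → kept n u (c ∷ w) ≤ suc (kept n (c ∷ u) w)
kept-∷ n u c w with absorbed? n u c
... | yes _ = n≤1+n _
... | no  _ = ≤-refl

∈-ʳ++ : ∀ {e c} (w : Word k) u → e ∈ c ∷ w ʳ++ [] → e ∈ c ∷ w ʳ++ u
∈-ʳ++ w u (here p)      = here p
∈-ʳ++ {e = e} w u (there i) =
  there (subst (e ∈_) (sym (ʳ++-defn w)) (∈-++⁺ˡ (subst (e ∈_) (trans (ʳ++-defn w) (++-identityʳ _)) i)))

arch-sum : ∀ {t a b b′ p q r} → t ≡ a + b → b ≤ suc b′ → a < p → b′ < q → p + q ≤ r → t < r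
arch-sum {a = a} refl b≤ a<p b′<q p+q≤r =
  <-≤-trans (≤-<-trans (+-monoʳ-≤ a b≤) (+-mono-<-≤ a<p b′<q)) p+q≤r

-- Cut `w` where the letters of `S` have all occurred. Before the cut a letter is missing, so m
-- drops; after it n drops by `absorbed-arch`; the strict inequalities pay for the letter at the
-- cut. Thus any F with F(n+1, m+1) ≥ F(n+1, m) + F(n, m+1) serves in the step, and `suc n ^ m` is
-- one.
kept-bound : ∀ n m (S : List (Fin k)) → length S ≤ m → ∀ u w → All (_∈ S) w → kept n u w < suc n ^ m
kept-bound zero m S l u w a = subst (_< 1 ^ m) (sym (kept-zero u w)) (m^n>0 1 m)
kept-bound (suc n) m [] l u [] a = m^n>0 (2 + n) m
kept-bound (suc n) m [] l u (c ∷ w) (() ∷ _)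
kept-bound (suc n) (suc m) S@(_ ∷ _) l u w a with arch S [] w (here λ ())
... | inj₁ miss with c , c∈ , c∉ , _ ← find miss =
  <-≤-trans (kept-bound (suc n) m (filter (λ d → ¬? (d Fin.≟ c)) S)
              (≤-pred (<-≤-trans (filter-notAll (λ d → ¬? (d Fin.≟ c)) S (lose c∈ (λ f → f refl))) l)) u w
              (All.tabulate (λ {d} i → ∈-filter⁺ (λ d → ¬? (d Fin.≟ c)) (All.lookup a i) λ { refl → c∉ i })))
            (m≤m+n _ _)
... | inj₂ (w₁ , c , w₂ , refl , c∈ , _ , c∉ , full) =
  arch-sum (kept-++ (suc n) u w₁ (c ∷ w₂))
           (≤-trans (kept-∷ (suc n) (w₁ ʳ++ u) c w₂) (s≤s (kept-mono w₂ w₂⊆S descend)))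
           (kept-bound (suc n) m (filter (λ d → ¬? (d Fin.≟ c)) S)
              (≤-pred (<-≤-trans (filter-notAll (λ d → ¬? (d Fin.≟ c)) S (lose c∈ (λ f → f refl))) l)) u w₁
              (All.tabulate (λ {d} i → ∈-filter⁺ (λ d → ¬? (d Fin.≟ c)) (All.lookup (All.++⁻ˡ w₁ a) i) λ
                  { refl → c∉ i })))
           (kept-bound n (suc m) S l [] w₂ w₂⊆S)
           (+-monoʳ-≤ (suc (suc n) ^ m) (*-monoʳ-≤ (suc n) (^-monoˡ-≤ m (n≤1+n (suc n)))))
  where
  w₂⊆S : All (_∈ S) w₂
  w₂⊆S = All.++⁻ʳ (c ∷ []) (All.++⁻ʳ w₁ a)
  descend : ∀ x d → All (_∈ S) x → d ∈ S → Absorbed n (x ʳ++ []) d → Absorbed (suc n) (x ʳ++ (c ∷ w₁ ʳ++ u)) d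
  descend x d x⊆ d∈ = absorbed-arch n x d x⊆ d∈ (λ i → ∈-ʳ++ w₁ u (full i))

weight : ℕ → ℕ → ℕ
weight k n = suc n ^ k

kept< : ∀ n u (w : Word k) → kept n u w < weight k n
kept< {k} n u w = kept-bound n k (allFin k) (≤-reflexive (length-tabulate id)) u w (All.tabulate λ {c} _ → ∈-allFin c)

unreverse : ∀ {n} {u v : Word k} → reverse u ∼[ n ] reverse v → u ∼[ n ] v
unreverse {n = n} {u} {v} h = subst₂ (λ a b → a ∼[ n ] b) (reverse-involutive u) (reverse-involutive v) (∼-reverse h)

-- Enlarging and lengthening words within a class

∷ˡ⁻ : ∀ {c} {u v : Word k} → c ∷ u ⊑ v → u ⊑ v
∷ˡ⁻ p = ⊆-trans (_ ∷ʳ ⊆-refl) p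

∷⁻ : ∀ {c} {u v : Word k} → c ∷ u ⊑ c ∷ v → u ⊑ v
∷⁻ (_ ∷ʳ p)   = ∷ˡ⁻ p
∷⁻ (refl ∷ p) = p

∷≢⁻ : ∀ {c d} {u v : Word k} → d ≢ c → d ∷ u ⊑ c ∷ v → d ∷ u ⊑ v
∷≢⁻ d≢c (_ ∷ʳ p)   = p
∷≢⁻ d≢c (refl ∷ p) = contradiction refl d≢c

-- A letter d of x that is not absorbed has to be matched in y, so y is scanned
-- for it. Each kept letter of y that is passed lowers by one the length of the
-- words s for which the hypothesis is needed.
extend  : ∀ n u (y x : Word k) → (∀ s → s ⊑ x → length s ≤ suc (kept n u y) → s ⊑ y) →
          ∃ λ y′ → x ⊑ y′ × y′ ʳ++ u ∼[ n ] y ʳ++ u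
extend∷ : ∀ n u (y : Word k) d x → ¬ Absorbed n u d →
          (∀ s → s ⊑ x → length s ≤ kept n u y → d ∷ s ⊑ y) →
          ∃ λ y′ → d ∷ x ⊑ y′ × y′ ʳ++ u ∼[ n ] y ʳ++ u
extend n u y [] h = y , minimum y , ∼-refl
extend n u y (d ∷ x) h with absorbed? n u d
... | yes a with y′ , p , e ← extend n u y x (λ s q → h s (d ∷ʳ q)) =
  d ∷ y′ , refl ∷ p , ∼-trans (∼-ʳ++ y′ a) e
... | no ¬a = extend∷ n u y d x ¬a (λ s q l → h (d ∷ s) (refl ∷ q) (s≤s l))
extend∷ n u [] d x ¬a h with () ← h [] (minimum x) z≤n
extend∷ n u (c ∷ y) d x ¬a h with absorbed? n u c
... | yes a with y′ , p , e ← extend∷ n (c ∷ u) y d x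
                                (λ a′ → ¬a (∼-trans (∼-cons d (∼-sym a)) (∼-trans a′ a)))
                                (λ s q l → ∷≢⁻ (λ { refl → ¬a a }) (h s q l)) =
  c ∷ y′ , c ∷ʳ p , e
... | no ¬c with d Fin.≟ c
...   | yes refl with y′ , p , e ← extend n (c ∷ u) y x (λ s q l → ∷⁻ (h s q l)) =
  c ∷ y′ , refl ∷ p , e
...   | no d≢c with y′ , p , e ← extend n (c ∷ u) y (d ∷ x)
                                   (λ { s (_ ∷ʳ q) l → ∷ˡ⁻ (∷≢⁻ d≢c (h s q l))
                                      ; (_ ∷ s) (refl ∷ q) (s≤s l) → ∷≢⁻ d≢c (h s q (m≤n⇒m≤1+n l)) }) =
  c ∷ y′ , c ∷ʳ p , e

-- Provides the reply above x′ when y lies above x: the short subwords of x′ are subwords of x,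
-- hence of y.
superword : ∀ n (y x : Word k) → (∀ s → s ⊑ x → length s ≤ weight k n → s ⊑ y) →
            ∃ λ y′ → x ⊑ y′ × y′ ∼[ n ] y
superword n y x h with y′ , p , e ← extend n [] y x (λ s q l → h s q (≤-trans l (kept< n [] y))) =
  y′ , p , unreverse e

data AllKept {k} (n : ℕ) (u : Word k) : Word k → Set where
  []  : AllKept n u []
  _∷_ : ∀ {c w} → ¬ Absorbed n u c → AllKept n (c ∷ u) w → AllKept n u (c ∷ w)

kept-all : ∀ {n u} {w : Word k} → AllKept n u w → kept n u w ≡ length w
kept-all []       = refl
kept-all {n = n} {u} {c ∷ w} (¬a ∷ as) with absorbed? n u c
... | yes a = contradiction a ¬a
... | no  _ = cong suc (kept-all as)

allKept< : ∀ {n u} {w : Word k} → AllKept n u w → length w < weight k n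
allKept< {n = n} {u} {w} as = subst (_< _) (kept-all as) (kept< n u w)

-- A word without absorbed letters is short by `allKept<`. Otherwise the first absorbed letter marks
-- a place where any number of copies may be inserted without leaving the class.
split : ∀ n u (w : Word k) → AllKept n u w ⊎
        ∃ λ p → ∃ λ b → ∃ λ r → w ≡ p ++ b ∷ r × AllKept n u p × Absorbed n (p ʳ++ u) b
split n u [] = inj₁ []
split n u (c ∷ w) with absorbed? n u c
... | yes a = inj₂ ([] , c , w , refl , [] , a)
... | no ¬a with split n (c ∷ u) w
...   | inj₁ as = inj₁ (¬a ∷ as)
...   | inj₂ (p , b , r , refl , as , a) = inj₂ (c ∷ p , b , r , refl , ¬a ∷ as , a)

absorb-replicate : ∀ {n u} {b : Fin k} i → Absorbed n u b → replicate i b ʳ++ u ∼[ n ] u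
absorb-replicate zero    a = ∼-refl
absorb-replicate {b = b} (suc i) a = ∼-trans (∼-ʳ++ (replicate i b) a) (absorb-replicate i a)

insert-∼ : ∀ {n u} (p : Word k) b i r → Absorbed n (p ʳ++ u) b →
           (p ++ replicate i b ++ r) ʳ++ u ∼[ n ] (p ++ r) ʳ++ u
insert-∼ {n = n} {u} p b i r a =
  subst₂ (λ s t → s ∼[ n ] t) (sym (trans (++-ʳ++ p) (++-ʳ++ (replicate i b)))) (sym (++-ʳ++ p))
         (∼-ʳ++ r (absorb-replicate i a))

NotHead : Fin k → Word k → Set
NotHead b r = ∀ {r′} → r ≢ b ∷ r′

strip : ∀ (b : Fin k) w → ∃ λ i → ∃ λ r → w ≡ replicate i b ++ r × NotHead b r
strip b [] = 0 , [] , refl , λ ()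
strip b (c ∷ w) with b Fin.≟ c
... | no b≢c = 0 , c ∷ w , refl , λ { refl → b≢c refl }
... | yes refl with i , r , refl , h ← strip b w = suc i , r , refl , h

record Chain {k} (n : ℕ) (y p : Word k) (b : Fin k) (r : Word k) : Set where
  constructor chain
  field
    exponent : ℕ
    shape    : y ≡ p ++ replicate (suc exponent) b ++ r
    prefix   : AllKept n [] p
    pumps    : Absorbed n (p ʳ++ []) b
    notHead  : NotHead b r

replicate-unique : ∀ {b : Fin k} i j {r s} → NotHead b r → NotHead b s →
                   replicate i b ++ r ≡ replicate j b ++ s → r ≡ s
replicate-unique zero    zero    h g e = e
replicate-unique zero    (suc j) h g e = contradiction e h
replicate-unique (suc i) zero    h g e = contradiction (sym e) g
replicate-unique (suc i) (suc j) h g e = replicate-unique i j h g (∷-injectiveʳ e)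

-- The prefix ends at the first absorbed letter, which fixes `p` and `b`; the block of copies of `b`
-- is maximal, which fixes `r`.
chain-unique : ∀ {n} u p p′ {b b′ : Fin k} {r r′} i j → AllKept n u p → AllKept n u p′ →
               Absorbed n (p ʳ++ u) b → Absorbed n (p′ ʳ++ u) b′ → NotHead b r → NotHead b′ r′ →
               p ++ replicate (suc i) b ++ r ≡ p′ ++ replicate (suc j) b′ ++ r′ →
               p ≡ p′ × b ≡ b′ × r ≡ r′
chain-unique u [] [] i j _ _ a a′ h h′ e with refl ← ∷-injectiveˡ e =
  refl , refl , replicate-unique i j h h′ (∷-injectiveʳ e)
chain-unique u [] (c ∷ p′) i j _ (¬a ∷ _) a a′ h h′ e with refl ← ∷-injectiveˡ e = contradiction a ¬a
chain-unique u (c ∷ p) [] i j (¬a ∷ _) _ a a′ h h′ e with refl ← ∷-injectiveˡ e = contradiction a′ ¬a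
chain-unique u (c ∷ p) (c′ ∷ p′) i j (_ ∷ as) (_ ∷ as′) a a′ h h′ e with refl ← ∷-injectiveˡ e
  with refl , refl , refl ← chain-unique (c ∷ u) p p′ i j as as′ a a′ h h′ (∷-injectiveʳ e) = refl , refl , refl

-- The class of a long word contains two words of each large length, unless
-- they all have the form p b* r.
data Variants {k} (n : ℕ) (y : Word k) (l : ℕ) : Set where
  short : length y < weight k n → Variants n y l
  two   : ∀ z₁ z₂ → z₁ ≢ z₂ → length z₁ ≡ l → length z₂ ≡ l → z₁ ∼[ n ] y → z₂ ∼[ n ] y → Variants n y l
  sole  : ∀ {z p b r} → Chain n y p b r → Chain n z p b r → length z ≡ l → z ∼[ n ] y → Variants n y l

fill : ∀ {a l} → a < l → ∃ λ i → a + suc i ≡ l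
fill {a} {l} a<l = l ∸ suc a , trans (+-suc a _) (m+[n∸m]≡n a<l)

length₃ : ∀ (p : Word k) i b r → length (p ++ replicate i b ++ r) ≡ length p + length r + i
length₃ p i b r = begin
  length (p ++ replicate i b ++ r)     ≡⟨ length-++ p ⟩
  length p + length (replicate i b ++ r) ≡⟨ cong (length p +_)
      (trans (length-++ (replicate i b)) (cong (_+ length r) (length-replicate i))) ⟩
  length p + (i + length r)            ≡⟨ cong (length p +_) (+-comm i _) ⟩
  length p + (length r + i)            ≡⟨ +-assoc (length p) _ _ ⟨
  length p + length r + i              ∎
  where open ≡-Reasoning

allKept-++< : ∀ {n} (p r : Word k) → AllKept n [] p → AllKept n (p ʳ++ []) r → length p + length r < weight k n
allKept-++< {n = n} p r as as′ =
  subst (_< _) (trans (kept-++ n [] p r) (cong₂ _+_ (kept-all as) (kept-all as′))) (kept< n [] (p ++ r))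

keep-++< : ∀ {n} (p q r : Word k) → AllKept n [] p → AllKept n (p ʳ++ []) q →
           length p + (length q + length (keep n (q ʳ++ p ʳ++ []) r)) < weight k n
keep-++< {n = n} p q r as as′ = subst (_< _)
  (trans (kept-++ n [] p (q ++ r))
    (cong₂ _+_ (kept-all as)
      (trans (kept-++ n (p ʳ++ []) q r) (cong₂ _+_ (kept-all as′) (sym (length-keep n _ r))))))
  (kept< n [] (p ++ q ++ r))

variants : ∀ n (y : Word k) {l} → weight k n ≤ l → Variants n y l
variants {k} n y {l} w≤l with split n [] y
... | inj₁ as = short (allKept< as)
... | inj₂ (p , b , r₀ , refl , as , a) with strip b r₀
...   | i , r , refl , h with split n (p ʳ++ []) r
-- No letter after the block is absorbed, so the exponent of `b` is the only freedom that is left.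
...     | inj₁ as′ with j , e ← fill (<-≤-trans (allKept-++< p r as as′) w≤l)
  = sole (chain i refl as a h) (chain j refl as a h) (trans (length₃ p (suc j) b r) e)
        (unreverse (∼-trans (insert-∼ p b (suc j) r a) (∼-sym (insert-∼ p b (suc i) r a))))
-- A second absorbed letter `d` gives a second place for padding. Thinning `r₂` to `s` brings the
-- total below the weight, so that at least one copy has to be inserted to reach length l.
...     | inj₂ (r₁ , d , r₂ , refl , as₁ , a₁) with j , e ← fill (<-≤-trans (keep-++< p r₁ r₂ as as₁) w≤l)
  = two (p ++ replicate (suc j) b ++ r₁ ++ s) ((p ++ r₁) ++ replicate (suc j) d ++ s) distinct
        (trans (length₃ p (suc j) b (r₁ ++ s)) (trans (cong (λ x → length p + x + suc j) (length-++ r₁)) e))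
        (trans (length₃ (p ++ r₁) (suc j) d s)
          (trans (cong (λ x → x + length s + suc j) (length-++ p)) (trans (cong (_+ suc j) (+-assoc (length p) _ _)) e)))
        (unreverse (∼-trans (insert-∼ p b (suc j) (r₁ ++ s) a) core))
        (unreverse (∼-trans (insert-∼ (p ++ r₁) d (suc j) s a₁′)
            (∼-trans (∼-reflexive (cong (_ʳ++ []) (++-assoc p r₁ _))) core)))
  where
  s = keep n (r₁ ʳ++ p ʳ++ []) r₂
  a₁′ : Absorbed n ((p ++ r₁) ʳ++ []) d
  a₁′ = subst (λ x → Absorbed n x d) (sym (++-ʳ++ p)) a₁
  core : (p ++ r₁ ++ s) ʳ++ [] ∼[ n ] (p ++ b ∷ replicate i b ++ r₁ ++ d ∷ r₂) ʳ++ []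
  core = ∼-trans
    (subst₂ (λ s t → s ∼[ n ] t) (sym (trans (++-ʳ++ p) (++-ʳ++ r₁))) (sym (trans (++-ʳ++ p) (++-ʳ++ r₁)))
      (∼-trans (keep-∼ n r₂ ∼-refl) (∼-ʳ++ r₂ (∼-sym a₁))))
    (∼-sym (insert-∼ p b (suc i) (r₁ ++ d ∷ r₂) a))
  -- Right after `p` one word has `b`, while the other has the first letter of `r₁ ++ d ∷ r₂`, which
  -- is not `b` because the block was maximal.
  distinct : p ++ replicate (suc j) b ++ r₁ ++ s ≢ (p ++ r₁) ++ replicate (suc j) d ++ s
  distinct eq with ++-cancelˡ p _ _ (trans eq (++-assoc p r₁ _))
  ... | eq′ = differ r₁ h eq′
    where
    differ : ∀ q → NotHead b (q ++ d ∷ r₂) → b ∷ replicate j b ++ q ++ s ≢ q ++ d ∷ replicate j d ++ s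
    differ []      h eq with refl ← ∷-injectiveˡ eq = h refl
    differ (c ∷ q) h eq with refl ← ∷-injectiveˡ eq = h refl

⊑-length-≡ : ∀ {u v : Word k} → u ⊑ v → length v ≤ length u → u ≡ v
⊑-length-≡ []         _ = refl
⊑-length-≡ (_ ∷ʳ p)   l = contradiction (length-mono-≤ p) (<⇒≱ l)
⊑-length-≡ (refl ∷ p) (s≤s l) = cong (_ ∷_) (⊑-length-≡ p l)

-- If `x` had more than N letters, its prefix of length N would be a subword of the shorter word
-- `x′`; otherwise each word is small enough to be tested in the other.
short-≡ : ∀ {N} {x x′ : Word k} → x ∼[ N ] x′ → length x′ < N → x ≡ x′
short-≡ {N = N} {x} {x′} e l with length x ≤? N
... | yes l′ = ⊆-antisym (to (e x l′) ⊆-refl) (from (e x′ (<⇒≤ l)) ⊆-refl)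
... | no ¬l′ = contradiction (length-mono-≤ (to (e (take N x) (≤-reflexive lt)) (take-⊆ N x)))
                             (<⇒≱ (subst (length x′ <_) (sym lt) l))
  where
  lt : length (take N x) ≡ N
  lt = trans (length-take N x) (m≤n⇒m⊓n≡m (<⇒≤ (≰⇒> ¬l′)))

SameOrder : Word k → Word k → Word k → Word k → Set
SameOrder x y x′ y′ = (x ⊑ y ⇔ x′ ⊑ y′) × (y ⊑ x ⇔ y′ ⊑ x′)

same : ∀ {A B : Set} → A → B → A ⇔ B
same a b = mk⇔ (λ _ → b) (λ _ → a)

neither : ∀ {A B : Set} → ¬ A → ¬ B → A ⇔ B
neither a b = mk⇔ (λ x → contradiction x a) (λ x → contradiction x b)

⇔-refl : {A : Set} → A ⇔ A
⇔-refl = mk⇔ id id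

different : ∀ {A : Set} (_≟_ : (a b : A) → Dec (a ≡ b)) {z₁ z₂ : A} (x : A) → z₁ ≢ z₂ → z₁ ≢ x ⊎ z₂ ≢ x
different _≟_ {z₁} x z≢ with z₁ ≟ x
... | no ¬e = inj₁ ¬e
... | yes refl = inj₂ (z≢ ∘ sym)

power-⊑ : ∀ {b : Fin k} {i j} p r → i ≤ j → p ++ replicate i b ++ r ⊑ p ++ replicate j b ++ r
power-⊑ p r i≤j = ++⁺ (⊆-refl {x = p}) (++⁺ (replicate-⊑ i≤j) (⊆-refl {x = r}))
  where
  replicate-⊑ : ∀ {b : Fin k} {i j} → i ≤ j → replicate i b ⊑ replicate j b
  replicate-⊑ {j = j} z≤n = minimum _
  replicate-⊑ (s≤s l)     = refl ∷ replicate-⊑ l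

-- A word of the class of y that differs from x′ but has its length is
-- incomparable to x′. If there is none, then x and y both have the form p b* r
-- with the same p, b and r, so they are comparable.
incomparable : ∀ {n N} {x x′ y : Word k} → n ≤ N → weight k n ≤ N → x ∼[ N ] x′ → ¬ x ⊑ y → ¬ y ⊑ x →
               ∃ λ y′ → y ∼[ n ] y′ × ¬ x′ ⊑ y′ × ¬ y′ ⊑ x′
incomparable {k} {n} {N} {x} {x′} {y} n≤N w≤N e x⋢y y⋢x with length x′ <? weight k n
... | yes l with refl ← short-≡ e (<-≤-trans l w≤N) = y , ∼-refl , x⋢y , y⋢x
... | no ¬l = go (variants n y l≥)
  where
  l≥ = ≮⇒≥ ¬l
  Goal = ∃ λ y′ → y ∼[ n ] y′ × ¬ x′ ⊑ y′ × ¬ y′ ⊑ x′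
  done : ∀ {z} → length z ≡ length x′ → z ∼[ n ] y → z ≢ x′ → Goal
  done len z∼y z≢ = _ , ∼-sym z∼y , (λ p → z≢ (sym (⊑-length-≡ p (≤-reflexive len))))
                              , (λ p → z≢ (⊑-length-≡ p (≤-reflexive (sym len))))
  pick : ∀ {z₁ z₂} → z₁ ≢ z₂ → length z₁ ≡ length x′ → length z₂ ≡ length x′ →
         z₁ ∼[ n ] y → z₂ ∼[ n ] y → Goal
  pick z≢ l₁ l₂ e₁ e₂ with different _≟ʷ_ x′ z≢
  ... | inj₁ ≢x = done l₁ e₁ ≢x
  ... | inj₂ ≢x = done l₂ e₂ ≢x
  comparable : ∀ {p b r} → Chain n x p b r → Chain n y p b r → ⊥
  comparable {p} {r = r} (chain i refl _ _ _) (chain j refl _ _ _) with ≤-total i j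
  ... | inj₁ i≤j = x⋢y (power-⊑ p r (s≤s i≤j))
  ... | inj₂ j≤i = y⋢x (power-⊑ p r (s≤s j≤i))
  go : Variants n y (length x′) → Goal
  -- A word `y` shorter than `x′` cannot lie above it, and is small enough that lying below `x′`
  -- means lying below `x`.
  go (short l) = y , ∼-refl , (λ p → <⇒≱ l (≤-trans l≥ (length-mono-≤ p)))
               , λ p → y⋢x (from (e y (≤-trans (<⇒≤ l) w≤N)) p)
  go (two z₁ z₂ z≢ l₁ l₂ e₁ e₂) = pick z≢ l₁ l₂ e₁ e₂
  go (sole {z} cy cz lz ez) with z ≟ʷ x′
  ... | no z≢ = done lz ez z≢
  -- The candidate is `x′` itself, so `x` and `y` share their class at level n and the candidates
  -- obtained from `x` may be used as well.
  ... | yes refl with ∼-trans (∼-mono n≤N e) ez | variants n x l≥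
  ...   | _   | short l = contradiction (subst (λ u → length u < _) (sym (short-≡ (∼-sym e) (<-≤-trans l w≤N))) l) ¬l
  ...   | x∼y | two z₁ z₂ z≢ l₁ l₂ e₁ e₂ = pick z≢ l₁ l₂ (∼-trans e₁ x∼y) (∼-trans e₂ x∼y)
  ...   | x∼y | sole {z′} cx cz′ lz′ ez′ with z′ ≟ʷ z
  ...     | no z≢ = done lz′ (∼-trans ez′ x∼y) z≢
  ...     | yes refl with chain i s a ab nh ← cz | chain j s′ a′ ab′ nh′ ← cz′
    with refl , refl , refl ← chain-unique [] _ _ i j a a′ ab ab′ nh nh′ (trans (sym s) s′) =
    ⊥-elim (comparable cx cy)

pump : ∀ n (x : Word k) → weight k n ≤ length x → ∃ λ y → y ∼[ n ] x × x ⊑ y × ¬ y ⊑ x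
pump n x l with split n [] x
... | inj₁ as = contradiction (allKept< as) (≤⇒≯ l)
... | inj₂ (p , b , r , refl , as , a) =
  p ++ b ∷ b ∷ r , unreverse (∼-trans (insert-∼ p b 2 r a) (∼-sym (insert-∼ p b 1 r a))) , p⊑ ,
  λ q → <⇒≱ (≤-reflexive (sym (trans (length₃ p 2 b r) (trans (+-suc _ 1) (cong suc (sym (length₃ p 1 b r)))))))
            (length-mono-≤ q)
  where
  p⊑ : p ++ b ∷ r ⊑ p ++ b ∷ b ∷ r
  p⊑ = ++⁺ (⊆-refl {x = p}) (b ∷ʳ ⊆-refl)

shrink : ∀ n (y : Word k) → ∃ λ y₀ → y₀ ⊑ y × y₀ ∼[ n ] y × length y₀ < weight k n
shrink n y = keep n [] y , keep-⊑ n [] y , unreverse (keep-∼ n y ∼-refl) ,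
             subst (_< _) (sym (length-keep n [] y)) (kept< n [] y)

-- The level N has to exceed the level n of the reply because subwords of length up to `weight k n`
-- are carried over from `x` to `x′`.
reply : ∀ {n N} {x x′ : Word k} → n ≤ N → weight k n ≤ N → x ∼[ N ] x′ → ∀ y →
        ∃ λ y′ → y ∼[ n ] y′ × SameOrder x y x′ y′
reply {k} {n} {N} {x} {x′} n≤N w≤N e y with y ⊑? x | x ⊑? y
... | yes p | yes q with refl ← ⊆-antisym p q =
  x′ , ∼-mono n≤N e , same q ⊆-refl , same p ⊆-refl
-- Strictness survives the shrinking: if `x′` were below `y₀`, it would equal `y₀`, hence be short
-- and equal to `x`, which would put `x` below `y`.
... | yes p | no ¬q with y₀ , y₀⊑y , y₀∼y , l ← shrink n y =
  y₀ , ∼-sym y₀∼y , neither ¬q larger , same p y₀⊑x′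
  where
  y₀⊑x′ : y₀ ⊑ x′
  y₀⊑x′ = to (e y₀ (≤-trans (<⇒≤ l) w≤N)) (⊆-trans y₀⊑y p)
  larger : ¬ x′ ⊑ y₀
  larger q with refl ← ⊆-antisym q y₀⊑x′ =
    ¬q (subst (_⊑ y) (sym (short-≡ e (<-≤-trans l w≤N))) y₀⊑y)
... | no ¬p | no ¬q with y′ , s , a , b ← incomparable n≤N w≤N e ¬q ¬p = y′ , s , neither ¬q a , neither ¬p b
... | no ¬p | yes q with superword n y x′ (λ s p l → ⊆-trans (from (e s (≤-trans l w≤N)) p) q)
...   | y′ , x′⊑y′ , y′∼y with y′ ⊑? x′
...     | no ¬r = y′ , ∼-sym y′∼y , same q x′⊑y′ , neither ¬p ¬r
-- The superword may be `x′` itself, which is not strictly above. Pumping repairs this; if `x′` is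
-- too short to be pumped, then `x` equals `x′` and `y` is its own reply.
...     | yes r with refl ← ⊆-antisym r x′⊑y′ with length x′ <? weight k n
...       | yes l with refl ← short-≡ e (<-≤-trans l w≤N) = y , ∼-refl , ⇔-refl , ⇔-refl
...       | no ¬l with z , z∼ , x′⊑z , z⋢ ← pump n x′ (≮⇒≥ ¬l) =
  z , ∼-sym (∼-trans z∼ y′∼y) , same q x′⊑z , neither ¬p z⋢

-- Back-and-forth similarity and the truth of formulas

rank : ℕ → ℕ → ℕ
rank k n = suc (suc n) ^ suc k

n≤rank : ∀ k n → suc n ≤ rank k n
n≤rank k n = ≤-trans (n≤1+n _) (≤-trans (≤-reflexive (sym (^-identityʳ (suc (suc n)))))
    (^-monoʳ-≤ (suc (suc n)) (s≤s (z≤n {k}))))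

weight≤rank : ∀ k n → weight k n ≤ rank k n
weight≤rank k n = ≤-trans (^-monoˡ-≤ k (n≤1+n (suc n))) (m≤m+n _ _)

termSize : ∀ {m} → Term k m → ℕ
termSize (var v)   = 0
termSize (const u) = length u

-- At an atom the level is strictly above the lengths of the constants, because a word below a
-- constant has to be recovered exactly through `short-≡`.
degree : ∀ {m} → FO k m → ℕ
degree (s ⊑′ t) = suc (termSize s + termSize t)
degree (¬′ φ)   = degree φ
degree (φ ∧′ ψ) = degree φ ⊔ degree ψ
degree (φ ∨′ ψ) = degree φ ⊔ degree ψ
degree (φ ⇒′ ψ) = degree φ ⊔ degree ψ
degree {k} (∃′ v φ) = rank k (degree φ)
degree {k} (∀′ v φ) = rank k (degree φ)

record Similar (n : ℕ) (ρ ρ′ : Env k 2) : Set where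
  constructor similar
  field
    class₀ : lookup ρ 0F ∼[ n ] lookup ρ′ 0F
    class₁ : lookup ρ 1F ∼[ n ] lookup ρ′ 1F
    order  : SameOrder (lookup ρ 0F) (lookup ρ 1F) (lookup ρ′ 0F) (lookup ρ′ 1F)

open Similar

similar-sym : ∀ {n} {ρ ρ′ : Env k 2} → Similar n ρ ρ′ → Similar n ρ′ ρ
similar-sym (similar a b (c , d)) = similar (∼-sym a) (∼-sym b) (mk⇔ (from c) (to c) , mk⇔ (from d) (to d))

similar-mono : ∀ {m n} {ρ ρ′ : Env k 2} → m ≤ n → Similar n ρ ρ′ → Similar m ρ ρ′
similar-mono l (similar a b o) = similar (∼-mono l a) (∼-mono l b) o

similar-diagonal : ∀ {n} {u v : Word k} → u ∼[ n ] v → Similar n (u ∷ u ∷ []) (v ∷ v ∷ [])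
similar-diagonal e = similar e e (same ⊆-refl ⊆-refl , same ⊆-refl ⊆-refl)

similar-reply : ∀ {n} {ρ ρ′ : Env k 2} v → Similar (rank k n) ρ ρ′ → ∀ u →
                ∃ λ u′ → Similar n (ρ [ v ]≔ u) (ρ′ [ v ]≔ u′)
similar-reply {k} {n} {x ∷ y ∷ []} {x′ ∷ y′ ∷ []} 0F (similar a b o) u
  with u′ , e , p , q ← reply (<⇒≤ (n≤rank k n)) (weight≤rank k n) b u =
  u′ , similar e (∼-mono (<⇒≤ (n≤rank k n)) b) (q , p)
similar-reply {k} {n} {x ∷ y ∷ []} {x′ ∷ y′ ∷ []} 1F (similar a b o) u
  with u′ , e , p , q ← reply (<⇒≤ (n≤rank k n)) (weight≤rank k n) a u =
  u′ , similar (∼-mono (<⇒≤ (n≤rank k n)) a) e (p , q)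

const-⊑ : ∀ {n} {x x′ : Word k} w → length w < n → x ∼[ n ] x′ → x ⊑ w → x′ ⊑ w
const-⊑ {n = n} {x} {x′} w l e p = subst (_⊑ w) (sym (short-≡ (∼-sym e) (≤-<-trans (length-mono-≤ p) l))) p

value-⊑ : ∀ {n} {ρ ρ′ : Env k 2} s t → termSize s + termSize t < n → Similar n ρ ρ′ →
          ⟦ s ⟧ ρ ⊑ ⟦ t ⟧ ρ → ⟦ s ⟧ ρ′ ⊑ ⟦ t ⟧ ρ′
value-⊑ {ρ = _ ∷ _ ∷ []} {_ ∷ _ ∷ []} (var 0F) (var 0F) l h p = ⊆-refl
value-⊑ {ρ = _ ∷ _ ∷ []} {_ ∷ _ ∷ []} (var 0F) (var 1F) l h p = to (proj₁ (order h)) p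
value-⊑ {ρ = _ ∷ _ ∷ []} {_ ∷ _ ∷ []} (var 1F) (var 0F) l h p = to (proj₂ (order h)) p
value-⊑ {ρ = _ ∷ _ ∷ []} {_ ∷ _ ∷ []} (var 1F) (var 1F) l h p = ⊆-refl
value-⊑ (var 0F) (const w) l h p = const-⊑ w l (class₀ h) p
value-⊑ (var 1F) (const w) l h p = const-⊑ w l (class₁ h) p
value-⊑ (const w) (var 0F) l h p = to (class₀ h w (≤-trans (m≤m+n _ _) (<⇒≤ l))) p
value-⊑ (const w) (var 1F) l h p = to (class₁ h w (≤-trans (m≤m+n _ _) (<⇒≤ l))) p
value-⊑ (const w) (const w′) l h p = p

similar-⊨ : ∀ {n} {ρ ρ′ : Env k 2} φ → degree φ ≤ n → Similar n ρ ρ′ → (ρ ⊨ φ) ⇔ (ρ′ ⊨ φ)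
similar-⊨ (s ⊑′ t) l h = mk⇔ (value-⊑ s t l h) (value-⊑ s t l (similar-sym h))
similar-⊨ (¬′ φ) l h with e ← similar-⊨ φ l h = mk⇔ (_∘ from e) (_∘ to e)
similar-⊨ (φ ∧′ ψ) l h
  with e ← similar-⊨ φ (≤-trans (m≤m⊔n _ _) l) h | f ← similar-⊨ ψ (≤-trans (m≤n⊔m (degree φ) _) l) h =
  mk⇔ (λ (a , b) → to e a , to f b) (λ (a , b) → from e a , from f b)
similar-⊨ (φ ∨′ ψ) l h
  with e ← similar-⊨ φ (≤-trans (m≤m⊔n _ _) l) h | f ← similar-⊨ ψ (≤-trans (m≤n⊔m (degree φ) _) l) h =
  mk⇔ (Sum.map (to e) (to f)) (Sum.map (from e) (from f))
similar-⊨ (φ ⇒′ ψ) l h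
  with e ← similar-⊨ φ (≤-trans (m≤m⊔n _ _) l) h | f ← similar-⊨ ψ (≤-trans (m≤n⊔m (degree φ) _) l) h =
  mk⇔ (λ g → to f ∘ g ∘ from e) (λ g → from f ∘ g ∘ to e)
similar-⊨ {k} (∃′ v φ) l h = mk⇔ (go (similar-mono l h)) (go (similar-sym (similar-mono l h)))
  where
  go : ∀ {ρ ρ′} → Similar (rank k (degree φ)) ρ ρ′ → ρ ⊨ ∃′ v φ → ρ′ ⊨ ∃′ v φ
  go h (u , p) with u′ , h′ ← similar-reply v h u = u′ , to (similar-⊨ φ ≤-refl h′) p
similar-⊨ {k} (∀′ v φ) l h = mk⇔ (go (similar-mono l h)) (go (similar-sym (similar-mono l h)))
  where
  go : ∀ {ρ ρ′} → Similar (rank k (degree φ)) ρ ρ′ → ρ ⊨ ∀′ v φ → ρ′ ⊨ ∀′ v φ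
  -- A universal quantifier is challenged on the other side, so the reply is taken in the opposite
  -- direction.
  go h p u with u′ , h′ ← similar-reply v (similar-sym h) u = from (similar-⊨ φ ≤-refl h′) (p u′)

-- Short replies and decidability of satisfaction

union : ∀ {u v w : Word k} → u ⊑ w → v ⊑ w →
        ∃ λ t → u ⊑ t × v ⊑ t × t ⊑ w × length t ≤ length u + length v
union [] [] = [] , [] , [] , [] , z≤n
union (c ∷ʳ p) (_ ∷ʳ q) with t , a , b , s , l ← union p q = t , a , b , c ∷ʳ s , l
union {v = v} (refl ∷ p) (c ∷ʳ q) with t , a , b , s , l ← union p q = c ∷ t , refl ∷ a , c ∷ʳ b , refl ∷ s , s≤s l
union {u = u} (c ∷ʳ p) (refl ∷ q) with t , a , b , s , l ← union p q =
  c ∷ t , c ∷ʳ a , refl ∷ b , refl ∷ s , ≤-trans (s≤s l) (≤-reflexive (sym (+-suc (length u) _)))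
union {u = _ ∷ u} (refl ∷ p) (refl ∷ q) with t , a , b , s , l ← union p q =
  _ ∷ t , refl ∷ a , refl ∷ b , refl ∷ s , s≤s (≤-trans l (+-monoʳ-≤ (length u) (n≤1+n _)))

enlarge : ∀ {x y : Word k} → x ⊑ y → ¬ y ⊑ x → ∃ λ z → x ⊑ z × z ⊑ y × ¬ z ⊑ x × length z ≤ suc (length x)
enlarge [] ¬q = contradiction [] ¬q
enlarge {x = x} (c ∷ʳ p) ¬q = c ∷ x , c ∷ʳ ⊆-refl , refl ∷ p , (λ r → <⇒≱ ≤-refl (length-mono-≤ r)) , ≤-refl
enlarge (refl ∷ p) ¬q with z , a , b , c , l ← enlarge p (λ q → ¬q (refl ∷ q)) =
  _ ∷ z , refl ∷ a , refl ∷ b , c ∘ ∷⁻ , s≤s l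

-- `z` is a small certificate that `y` is not below `x`. It is taken above `x` where possible, so
-- that it also preserves the other half of the order.
witness : ∀ (x y : Word k) → ¬ y ⊑ x → ∃ λ z → z ⊑ y × ¬ z ⊑ x × (x ⊑ y → x ⊑ z) × length z ≤ suc (length x)
witness x y ¬q with x ⊑? y
... | yes p with z , a , b , c , l ← enlarge p ¬q = z , b , c , (λ _ → a) , l
... | no ¬p with length y ≤? suc (length x)
...   | yes l = y , ⊆-refl , ¬q , (λ p → contradiction p ¬p) , l
...   | no ¬l = take (suc (length x)) y , take-⊆ _ y , (λ r → <⇒≱ (≤-reflexive (sym lt)) (length-mono-≤ r))
              , (λ p → contradiction p ¬p) , ≤-reflexive lt
  where
  lt : length (take (suc (length x)) y) ≡ suc (length x)
  lt = trans (length-take _ y) (m≤n⇒m⊓n≡m (<⇒≤ (≰⇒> ¬l)))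

-- A word below `x` is short already. Otherwise the reply is a common superword, inside `y`, of the
-- certificate `z` and of the shrunk word `y₀`: it lies between `y₀` and `y`, hence in the class.
-- The extra letter in the length of `z` is paid for by the strict bound on `y₀`.
short-reply : ∀ n (x y : Word k) →
              ∃ λ y′ → length y′ ≤ length x + weight k n × y ∼[ n ] y′ × SameOrder x y x y′
short-reply {k} n x y with y ⊑? x
... | yes p = y , ≤-trans (length-mono-≤ p) (m≤m+n _ _) , ∼-refl , ⇔-refl , ⇔-refl
... | no ¬p with z , z⊑y , z⋢x , x⊑z , lz ← witness x y ¬p | y₀ , y₀⊑y , e , l ← shrink n y
  with t , z⊑t , y₀⊑t , t⊑y , lt ← union z⊑y y₀⊑y =
  t , ≤-trans lt (≤-trans (+-monoˡ-≤ _ lz) (≤-trans (≤-reflexive (sym (+-suc _ _))) (+-monoʳ-≤ (length x) l)))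
  , ∼-sym (∼-trans (∼-between y₀⊑t t⊑y e) ∼-refl)
  , mk⇔ (λ p → ⊆-trans (x⊑z p) z⊑t) (λ p → ⊆-trans p t⊑y) , neither ¬p (λ q → z⋢x (⊆-trans z⊑t q))

other : Fin 2 → Fin 2
other 0F = 1F
other 1F = 0F

similar-short : ∀ n (ρ : Env k 2) v u →
                ∃ λ u′ → length u′ ≤ length (lookup ρ (other v)) + weight k n ×
                Similar n (ρ [ v ]≔ u) (ρ [ v ]≔ u′)
similar-short n (x ∷ y ∷ []) 0F u with u′ , l , e , p , q ← short-reply n y u = u′ , l , similar e ∼-refl (q , p)
similar-short n (x ∷ y ∷ []) 1F u with u′ , l , e , p , q ← short-reply n x u = u′ , l , similar ∼-refl e (p , q)

-- The search space of a quantifier depends on the other variable, since a short reply is measured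
-- against the word it must be compared with.
sat? : (φ : FO k 2) (ρ : Env k 2) → Dec (ρ ⊨ φ)
sat? (s ⊑′ t) ρ = ⟦ s ⟧ ρ ⊑? ⟦ t ⟧ ρ
sat? (¬′ φ)   ρ = ¬? (sat? φ ρ)
sat? (φ ∧′ ψ) ρ = sat? φ ρ ×-dec sat? ψ ρ
sat? (φ ∨′ ψ) ρ = sat? φ ρ ⊎-dec sat? ψ ρ
sat? (φ ⇒′ ψ) ρ = sat? φ ρ →-dec sat? ψ ρ
sat? {k} (∃′ v φ) ρ = map′ (λ a → let u , _ , p = find a in u , p) bounded
  (Any.any? (λ u → sat? φ (ρ [ v ]≔ u)) (words k (length (lookup ρ (other v)) + weight k (degree φ))))
  where
  bounded : (∃ λ u → ρ [ v ]≔ u ⊨ φ) → _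
  bounded (u , p) with u′ , l , h ← similar-short (degree φ) ρ v u =
    lose (∈-words⁺ _ l) (to (similar-⊨ φ ≤-refl h) p)
sat? {k} (∀′ v φ) ρ = map′ long (λ h → All.tabulate (λ {u} _ → h u))
  (All.all? (λ u → sat? φ (ρ [ v ]≔ u)) (words k (length (lookup ρ (other v)) + weight k (degree φ))))
  where
  long : _ → ∀ u → ρ [ v ]≔ u ⊨ φ
  long a u with u′ , l , h ← similar-short (degree φ) ρ v u =
    from (similar-⊨ φ ≤-refl h) (All.lookup a (∈-words⁺ _ l))

-- Piecewise testability and the height

Invariant : ℕ → Language k → Set
Invariant n L = ∀ {u v} → u ∼[ n ] v → L u → L v

PT⇒invariant : ∀ {n} {L : Language k} → n -PiecewiseTestable L → Invariant n L
PT⇒invariant (I , L⊆ , ⊆L) e Lu with w , Iw , e′ ← L⊆ Lu = ⊆L (w , Iw , ∼-trans e′ e)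

invariant⇒PT : ∀ {n} {L : Language k} → Invariant n L → n -PiecewiseTestable L
invariant⇒PT {L = L} inv = L , (λ {u} Lu → u , Lu , ∼-refl) , λ (u , Lu , e) → inv e Lu

L⟨⟩-invariant : ∀ (φ : FO k 2) {n} → degree φ ≤ n → Invariant n L⟨ φ ⟩
L⟨⟩-invariant φ l e p = to (similar-⊨ φ l (similar-diagonal e)) p

-- Invariance at the larger level N makes this a finite check: every word has an `∼[ N ]`-equivalent
-- one of length below `weight k N`, and replacing it affects neither membership nor the class at
-- level n.
invariant? : ∀ {L : Language k} → (∀ u → Dec (L u)) → ∀ n {N} → Invariant N L → n ≤ N → Dec (Invariant n L)
invariant? {k} {L} L? n {N} inv n≤N = map′ extend-inv restrict
  (All.all? (λ u → All.all? (λ v → ∼? n u v →-dec (L? u →-dec L? v)) ws) ws)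
  where
  ws = words k (weight k N)
  extend-inv : All (λ u → All (λ v → u ∼[ n ] v → L u → L v) ws) ws → Invariant n L
  extend-inv a {u} {v} e Lu with u₀ , _ , eu , lu ← shrink N u | v₀ , _ , ev , lv ← shrink N v =
    inv ev (All.lookup (All.lookup a (∈-words⁺ _ (<⇒≤ lu))) (∈-words⁺ _ (<⇒≤ lv))
             (∼-trans (∼-mono n≤N eu) (∼-trans e (∼-sym (∼-mono n≤N ev)))) (inv (∼-sym eu) Lu))
  restrict : Invariant n L → All (λ u → All (λ v → u ∼[ n ] v → L u → L v) ws) ws
  restrict h = All.tabulate (λ _ → All.tabulate (λ _ e → h e))

-- An upward search with `d` levels left to try; it must succeed at N at the latest. `low` records
-- that every smaller level has failed.
least : ∀ {L : Language k} → (∀ u → Dec (L u)) → ∀ {N} → Invariant N L → ∀ d n → d + n ≡ N →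
        (∀ m → Invariant m L → n ≤ m) → ∃ λ h → IsHeight L h × h ≤ N
least L? inv zero n refl low = n , (invariant⇒PT inv , λ m p → low m (PT⇒invariant p)) , ≤-refl
least L? {N} inv (suc d) n e low with invariant? L? n inv (≤-trans (m≤n+m n (suc d)) (≤-reflexive e))
... | yes i = n , (invariant⇒PT i , λ m p → low m (PT⇒invariant p)) , ≤-trans (m≤n+m n (suc d)) (≤-reflexive e)
... | no ¬i = least L? inv d (suc n) (trans (+-suc d n) e)
                λ m j → ≤∧≢⇒< (low m j) λ { refl → ¬i j }

height : ∀ (φ : FO k 2) → PiecewiseTestable L⟨ φ ⟩ × ∃ λ h → IsHeight L⟨ φ ⟩ h × h ≤ degree φ
height φ = (degree φ , invariant⇒PT inv) , least (λ u → sat? φ _) inv (degree φ) 0 (+-identityʳ _) (λ _ _ → z≤n)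
  where
  inv = L⟨⟩-invariant φ ≤-refl

-- Doubly exponential bounds

n<2^n : ∀ n → n < 2 ^ n
n<2^n zero    = s≤s z≤n
n<2^n (suc n) = ≤-trans (+-mono-≤ (m^n>0 2 n) (n<2^n n)) (≤-reflexive (cong (2 ^ n +_) (sym (+-identityʳ _))))

exp₂ : ℕ → ℕ
exp₂ n = 2 ^ (2 ^ n)

exp₂-mono : ∀ {m n} → m ≤ n → exp₂ m ≤ exp₂ n
exp₂-mono l = ^-monoʳ-≤ 2 (^-monoʳ-≤ 2 l)

n≤exp₂ : ∀ n → n ≤ exp₂ n
n≤exp₂ n = ≤-trans (<⇒≤ (n<2^n n)) (<⇒≤ (n<2^n (2 ^ n)))

exp₂-^ : ∀ m n → exp₂ m ^ n ≤ exp₂ (m + n)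
exp₂-^ m n = begin
  (2 ^ (2 ^ m)) ^ n   ≡⟨ ^-*-assoc 2 (2 ^ m) n ⟩
  2 ^ (2 ^ m * n)     ≤⟨ ^-monoʳ-≤ 2 (*-monoʳ-≤ (2 ^ m) (<⇒≤ (n<2^n n))) ⟩
  2 ^ (2 ^ m * 2 ^ n) ≡⟨ cong (2 ^_) (^-distribˡ-+-* 2 m n) ⟨
  2 ^ (2 ^ (m + n))   ∎
  where open ≤-Reasoning

termSize< : ∀ {m} (s : Term k m) → termSize s < length (encodeTerm s)
termSize< (var v)   = s≤s z≤n
termSize< (const u) = s≤s (≤-trans (≤-reflexive (sym (length-map letter u)))
    (≤-trans (m≤m+n _ _) (≤-reflexive (sym (length-++ (map letter u))))))

size>0 : ∀ {m} (φ : FO k m) → 0 < ∣ φ ∣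
size>0 (s ⊑′ t) = s≤s z≤n
size>0 (¬′ φ)   = s≤s z≤n
size>0 (φ ∧′ ψ) = s≤s z≤n
size>0 (φ ∨′ ψ) = s≤s z≤n
size>0 (φ ⇒′ ψ) = s≤s z≤n
size>0 (∃′ v φ) = s≤s z≤n
size>0 (∀′ v φ) = s≤s z≤n

size-++ : ∀ {m} (φ ψ : FO k m) → ∣ φ ∣ ≤ suc (length (encode φ ++ encode ψ)) × ∣ ψ ∣ ≤ suc (length (encode φ ++ encode ψ))
size-++ φ ψ = m≤n⇒m≤1+n (≤-trans (m≤m+n _ _) (≤-reflexive (sym (length-++ (encode φ)))))
            , m≤n⇒m≤1+n (≤-trans (m≤n+m _ _) (≤-reflexive (sym (length-++ (encode φ)))))

-- The base of `rank` is `2 + d` for the sake of this step: since x is at least 2, both the summand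
-- 2 and `x ^ suc k` fit into `x ^ (2 + k)`. A quantifier thus raises `2 + degree` at most to the
-- power `2 + k`, which adds at most `2 + k` to the argument of `exp₂`.
rank+2 : ∀ k d m → 2 + d ≤ exp₂ m → 2 + rank k d ≤ exp₂ (m + (2 + k))
rank+2 k d m l = begin
  2 + y              ≡⟨ +-comm 2 y ⟩
  y + 2              ≤⟨ +-monoʳ-≤ y (≤-trans (m≤m*n 2 (x ^ k) {{m^n≢0 x k}}) (*-monoˡ-≤ (x ^ k) (s≤s (s≤s (z≤n {d}))))) ⟩
  y + y              ≤⟨ +-monoʳ-≤ y (m≤m+n y _) ⟩
  x ^ (2 + k)        ≤⟨ ^-monoˡ-≤ (2 + k) l ⟩
  exp₂ m ^ (2 + k)   ≤⟨ exp₂-^ m (2 + k) ⟩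
  exp₂ (m + (2 + k)) ∎
  where
  open ≤-Reasoning
  x = 2 + d
  y = x ^ suc k

scale : ∀ c m n {x} → m ≤ n → x ≤ exp₂ (c * m) → x ≤ exp₂ (c * n)
scale c m n l h = ≤-trans h (exp₂-mono (*-monoʳ-≤ c l))

-- The summand 2 closes the induction under `rank+2`, and it commutes with the maximum at the binary
-- connectives.
degree≤ : ∀ (φ : FO k 2) → 2 + degree φ ≤ exp₂ ((2 + k) * ∣ φ ∣)
degree≤ {k} (s ⊑′ t) = ≤-trans len (≤-trans (m≤n*m _ (2 + k)) (n≤exp₂ _))
  where
  len : 3 + (termSize s + termSize t) ≤ suc (length (encodeTerm s ++ encodeTerm t))
  len = s≤s (≤-trans (≤-reflexive (cong suc (sym (+-suc _ _))))
      (≤-trans (+-mono-≤ (termSize< s) (termSize< t)) (≤-reflexive (sym (length-++ (encodeTerm s))))))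
degree≤ {k} (¬′ φ) = scale (2 + k) ∣ φ ∣ ∣ ¬′ φ ∣ (n≤1+n _) (degree≤ φ)
degree≤ {k} (φ ∧′ ψ) with a , b ← size-++ φ ψ =
  ≤-trans (≤-reflexive (+-distribˡ-⊔ 2 (degree φ) (degree ψ)))
    (⊔-lub (scale (2 + k) ∣ φ ∣ ∣ φ ∧′ ψ ∣ a (degree≤ φ)) (scale (2 + k) ∣ ψ ∣ ∣ φ ∧′ ψ ∣ b (degree≤ ψ)))
degree≤ {k} (φ ∨′ ψ) with a , b ← size-++ φ ψ =
  ≤-trans (≤-reflexive (+-distribˡ-⊔ 2 (degree φ) (degree ψ)))
    (⊔-lub (scale (2 + k) ∣ φ ∣ ∣ φ ∨′ ψ ∣ a (degree≤ φ)) (scale (2 + k) ∣ ψ ∣ ∣ φ ∨′ ψ ∣ b (degree≤ ψ)))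
degree≤ {k} (φ ⇒′ ψ) with a , b ← size-++ φ ψ =
  ≤-trans (≤-reflexive (+-distribˡ-⊔ 2 (degree φ) (degree ψ)))
    (⊔-lub (scale (2 + k) ∣ φ ∣ ∣ φ ⇒′ ψ ∣ a (degree≤ φ)) (scale (2 + k) ∣ ψ ∣ ∣ φ ⇒′ ψ ∣ b (degree≤ ψ)))
degree≤ {k} (∃′ v φ) = scale (2 + k) (suc ∣ φ ∣) (2 + ∣ φ ∣) (n≤1+n _)
    (subst (2 + rank k (degree φ) ≤_) (cong exp₂ (trans (+-comm _ (2 + k)) (sym (*-suc (2 + k) ∣ φ ∣))))
    (rank+2 k (degree φ) ((2 + k) * ∣ φ ∣) (degree≤ φ)))
degree≤ {k} (∀′ v φ) = scale (2 + k) (suc ∣ φ ∣) (2 + ∣ φ ∣) (n≤1+n _)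
    (subst (2 + rank k (degree φ) ≤_) (cong exp₂ (trans (+-comm _ (2 + k)) (sym (*-suc (2 + k) ∣ φ ∣))))
    (rank+2 k (degree φ) ((2 + k) * ∣ φ ∣) (degree≤ φ)))

-- A bound on `weight k (degree φ)` that depends on the length of the input only, so that a machine
-- can produce it by repeated doubling without analysing the formula.
reach : ℕ → ℕ → ℕ
reach k n = exp₂ ((3 * (2 + k)) * n)

weight<reach : ∀ (φ : FO k 2) {n} → ∣ φ ∣ ≤ n → weight k (degree φ) < reach k n
weight<reach {k} φ {n} l = begin-strict
  suc (degree φ) ^ k                 <⟨ m<m+n _ (m^n>0 (suc (degree φ)) k) ⟩
  w + w                              ≤⟨ +-monoʳ-≤ w (m≤m+n w 0) ⟩
  2 * w                              ≤⟨ *-monoˡ-≤ w (s≤s (s≤s (z≤n {degree φ}))) ⟩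
  (2 + degree φ) * w                 ≤⟨ *-monoʳ-≤ (2 + degree φ) (^-monoˡ-≤ k (n≤1+n (suc (degree φ)))) ⟩
  (2 + degree φ) ^ suc k             ≤⟨ ^-monoˡ-≤ (suc k) (degree≤ φ) ⟩
  exp₂ ((2 + k) * ∣ φ ∣) ^ suc k     ≤⟨ exp₂-^ ((2 + k) * ∣ φ ∣) (suc k) ⟩
  exp₂ ((2 + k) * ∣ φ ∣ + suc k)     ≤⟨ exp₂-mono (+-mono-≤ (*-monoʳ-≤ (2 + k) l)
      (≤-trans (n≤1+n _) (m≤m*n (2 + k) n {{>-nonZero (<-≤-trans (size>0 φ) l)}}))) ⟩
  exp₂ ((2 + k) * n + (2 + k) * n)   ≤⟨ exp₂-mono (≤-trans (≤-reflexive (sym (*-distribʳ-+ n (2 + k) (2 + k))))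
      (*-monoˡ-≤ n (+-monoʳ-≤ (2 + k) (m≤m+n (2 + k) _)))) ⟩
  exp₂ (3 * (2 + k) * n)             ∎
  where
  open ≤-Reasoning
  w = suc (degree φ) ^ k

-- Stack programs and Turing machines

infixr 5 _⨾_

data Prog (S : Set) (n : ℕ) : Set where
  skip   : Prog S n
  push   : Fin n → (Vec (Maybe S) n → S) → Prog S n
  pop    : Fin n → Prog S n
  _⨾_    : Prog S n → Prog S n → Prog S n
  branch : (Vec (Maybe S) n → Bool) → Prog S n → Prog S n → Prog S n
  loop   : (Vec (Maybe S) n → Bool) → Prog S n → Prog S n

Store : Set → ℕ → Set
Store S n = Vec (List S) n

tops : Store S n → Vec (Maybe S) n
tops = Vec.map List.head

-- Every loop is executed at most Z times each time it is entered.
mutual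
  data Run (Z : ℕ) {S n} : Prog S n → Store S n → Store S n → Set where
    skip  : ∀ {σ} → Run Z skip σ σ
    push  : ∀ {r g σ} → Run Z (push r g) σ (σ [ r ]≔ (g (tops σ) ∷ lookup σ r))
    pop   : ∀ {r σ} → Run Z (pop r) σ (σ [ r ]≔ drop 1 (lookup σ r))
    _⨾_   : ∀ {p q σ σ₁ σ₂} → Run Z p σ σ₁ → Run Z q σ₁ σ₂ → Run Z (p ⨾ q) σ σ₂
    on-true  : ∀ {c p q σ σ₁} → c (tops σ) ≡ true → Run Z p σ σ₁ → Run Z (branch c p q) σ σ₁
    on-false : ∀ {c p q σ σ₁} → c (tops σ) ≡ false → Run Z q σ σ₁ → Run Z (branch c p q) σ σ₁
    loop  : ∀ {c p t σ σ₁} → Loop Z c p t σ σ₁ → t ≤ Z → Run Z (loop c p) σ σ₁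

  data Loop (Z : ℕ) {S n} (c : Vec (Maybe S) n → Bool) (p : Prog S n) : ℕ → Store S n → Store S n → Set where
    stop : ∀ {σ} → c (tops σ) ≡ false → Loop Z c p 0 σ σ
    once : ∀ {t σ σ₁ σ₂} → c (tops σ) ≡ true → Run Z p σ σ₁ → Loop Z c p t σ₁ σ₂ → Loop Z c p (suc t) σ σ₂

-- Giving the intermediate store keeps the elaborated derivations small.
seq-via : ∀ {Z} {p q : Prog S n} {σ σ₂} σ₁ → Run Z p σ σ₁ → Run Z q σ₁ σ₂ → Run Z (p ⨾ q) σ σ₂
seq-via _ x y = x ⨾ y

infixr 5 seq-via
syntax seq-via σ₁ x y = x ⨾⟨ σ₁ ⟩ y

cost : ℕ → Prog S n → ℕ
cost Z skip           = 1
cost Z (push _ _)     = 2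
cost Z (pop _)        = 1
cost Z (p ⨾ q)        = cost Z p + cost Z q
cost Z (branch _ p q) = suc (cost Z p + cost Z q)
cost Z (loop _ p)     = suc (Z * suc (cost Z p))

-- Fixed by the program text alone. Running time is thus a fixed power of the loop bound Z, and a
-- fixed power of a triply exponential number is triply exponential.
costExponent : Prog S n → ℕ
costExponent skip           = 1
costExponent (push _ _)     = 1
costExponent (pop _)        = 1
costExponent (p ⨾ q)        = 2 + (costExponent p + costExponent q)
costExponent (branch _ p q) = 2 + (costExponent p + costExponent q)
costExponent (loop _ p)     = 3 + costExponent p

module _ {Z : ℕ} (2≤Z : 2 ≤ Z) where

  private
    instance
      Z≢0 : NonZero Z
      Z≢0 = >-nonZero (≤-trans (s≤s z≤n) 2≤Z)

    double-≤ : ∀ a → Z ^ a + Z ^ a ≤ Z ^ suc a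
    double-≤ a = ≤-trans (+-monoʳ-≤ (Z ^ a) (≤-reflexive (sym (+-identityʳ _)))) (*-monoˡ-≤ (Z ^ a) 2≤Z)

    suc-≤ : ∀ a → suc (Z ^ a) ≤ Z ^ suc a
    suc-≤ a = ≤-trans (+-monoˡ-≤ (Z ^ a) (m^n>0 Z a)) (double-≤ a)

    sum-≤ : ∀ a b {x y} → x ≤ Z ^ a → y ≤ Z ^ b → x + y ≤ Z ^ suc (a + b)
    sum-≤ a b h g = ≤-trans (+-mono-≤ (≤-trans h (^-monoʳ-≤ Z (m≤m+n a b))) (≤-trans g (^-monoʳ-≤ Z (m≤n+m b a))))
        (double-≤ (a + b))

  cost≤ : (p : Prog S n) → cost Z p ≤ Z ^ costExponent p
  cost≤ skip           = ≤-trans (≤-trans (n≤1+n 1) 2≤Z) (≤-reflexive (sym (^-identityʳ Z)))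
  cost≤ (push _ _)     = ≤-trans 2≤Z (≤-reflexive (sym (^-identityʳ Z)))
  cost≤ (pop _)        = ≤-trans (≤-trans (n≤1+n 1) 2≤Z) (≤-reflexive (sym (^-identityʳ Z)))
  cost≤ (p ⨾ q)        = ≤-trans (sum-≤ (costExponent p) (costExponent q) (cost≤ p) (cost≤ q))
      (^-monoʳ-≤ Z (n≤1+n (suc (costExponent p + costExponent q))))
  cost≤ (branch _ p q) = ≤-trans (s≤s (sum-≤ (costExponent p) (costExponent q) (cost≤ p) (cost≤ q)))
      (suc-≤ (suc (costExponent p + costExponent q)))
  cost≤ (loop _ p)     = ≤-trans (s≤s (*-monoʳ-≤ Z (≤-trans (s≤s (cost≤ p)) (suc-≤ (costExponent p)))))
      (suc-≤ (2 + costExponent p))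

module _ {I O W : Set} where

  Sym : Set
  Sym = I ⊎ O ⊎ W

  cell : Sym → Cell I O W
  cell (inj₁ i)        = input i
  cell (inj₂ (inj₁ o)) = output o
  cell (inj₂ (inj₂ w)) = work w

  read : Cell I O W → Maybe Sym
  read blank      = nothing
  read (input i)  = just (inj₁ i)
  read (output o) = just (inj₂ (inj₁ o))
  read (work w)   = just (inj₂ (inj₂ w))

  read-cell : ∀ a → read (cell a) ≡ just a
  read-cell (inj₁ i)        = refl
  read-cell (inj₂ (inj₁ o)) = refl
  read-cell (inj₂ (inj₂ w)) = refl

  -- The top of the stack is under the head; what lies to the left is garbage.
  Holds : Tape (Cell I O W) → List Sym → Set
  Holds t xs = ∃ λ j → Tape.head t ∷ Tape.after t ≡ map cell xs ++ replicate j blank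

  holds-head : ∀ {t xs} → Holds t xs → read (Tape.head t) ≡ List.head xs
  holds-head {xs = []}     (suc j , refl) = refl
  holds-head {xs = x ∷ xs} (j , refl)     = read-cell x

  holds-push : ∀ {t xs} a → Holds t xs → Holds (act (cell a , stay) (act (Tape.head t , left) t)) (a ∷ xs)
  holds-push {tape [] _ _}      a (j , e) = j , cong (cell a ∷_) e
  holds-push {tape (_ ∷ _) _ _} a (j , e) = j , cong (cell a ∷_) e

  holds-pop : ∀ {t xs} → Holds t xs → Holds (act (Tape.head t , right) t) (drop 1 xs)
  holds-pop {tape _ _ []}      {[]}     (suc j , e)     = 1 , refl
  holds-pop {tape _ _ (_ ∷ _)} {[]}     (suc j , e)     = j , ∷-injectiveʳ e
  holds-pop {tape _ _ []}      {_ ∷ []} (j , e)         = 1 , refl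
  holds-pop {tape _ _ (_ ∷ _)} {_ ∷ xs} (j , e)         = j , ∷-injectiveʳ e

  Tapes : ℕ → Set
  Tapes n = Vec (Tape (Cell I O W)) n

  heads : Tapes n → Vec (Cell I O W) n
  heads = Vec.map Tape.head

  data Represents : ∀ {n} → Tapes n → Store Sym n → Set where
    []  : Represents [] []
    _∷_ : ∀ {t xs n} {ts : Tapes n} {σ} → Holds t xs → Represents ts σ → Represents (t ∷ ts) (xs ∷ σ)

  reads : ∀ {ts : Tapes n} {σ} → Represents ts σ → Vec.map read (heads ts) ≡ tops σ
  reads []       = refl
  reads {ts = t ∷ _} {xs ∷ _} (h ∷ hs) = cong₂ _∷_ (holds-head {t} {xs} h) (reads hs)

  holds-lookup : ∀ {ts : Tapes n} {σ} → Represents ts σ → ∀ r → Holds (lookup ts r) (lookup σ r)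
  holds-lookup (h ∷ hs) zero    = h
  holds-lookup (h ∷ hs) (suc r) = holds-lookup hs r

  holds-update : ∀ {ts : Tapes n} {σ t xs} → Represents ts σ → ∀ r → Holds t xs →
                 Represents (ts [ r ]≔ t) (σ [ r ]≔ xs)
  holds-update (h ∷ hs) zero    g = g ∷ hs
  holds-update (h ∷ hs) (suc r) g = h ∷ holds-update hs r g

  still : Vec (Cell I O W) n → Vec (Cell I O W × Move) n
  still = Vec.map (_, stay)

  apply : Vec (Cell I O W × Move) n → Tapes n → Tapes n
  apply = zipWith act

  apply-still : (ts : Tapes n) → apply (still (heads ts)) ts ≡ ts
  apply-still []       = refl
  apply-still (t ∷ ts) = cong (t ∷_) (apply-still ts)

  apply-at : (ts : Tapes n) (r : Fin n) {x : Cell I O W × Move} →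
             apply (still (heads ts) [ r ]≔ x) ts ≡ ts [ r ]≔ act x (lookup ts r)
  apply-at (t ∷ ts) zero    = cong (_ ∷_) (apply-still ts)
  apply-at (t ∷ ts) (suc r) = cong (t ∷_) (apply-at ts r)

  -- Pushing takes two steps, so the symbol is remembered in the state.
  Pos : Prog Sym n → Set
  Pos skip           = ⊤
  Pos (push _ _)     = ⊤ ⊎ Cell I O W
  Pos (pop _)        = ⊤
  Pos (p ⨾ q)        = Pos p ⊎ Pos q
  Pos (branch _ p q) = ⊤ ⊎ (Pos p ⊎ Pos q)
  Pos (loop _ p)     = ⊤ ⊎ Pos p

  entry : (p : Prog Sym n) → Pos p
  entry skip           = tt
  entry (push _ _)     = inj₁ tt
  entry (pop _)        = tt
  entry (p ⨾ q)        = inj₁ (entry p)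
  entry (branch _ p q) = inj₁ tt
  entry (loop _ p)     = inj₁ tt

  Actions : ℕ → Set
  Actions n = Vec (Cell I O W × Move) n

  -- `nothing` announces that the program ends with this very step. A surrounding program intercepts
  -- it and names its own continuation, so no step is lost between two programs.
  delta : (p : Prog Sym n) → Pos p → Vec (Cell I O W) n → Maybe (Pos p) × Actions n
  delta skip _ h = nothing , still h
  delta (push r g) (inj₁ _) h = just (inj₂ (cell (g (Vec.map read h)))) , still h [ r ]≔ (lookup h r , left)
  delta (push r g) (inj₂ γ) h = nothing , still h [ r ]≔ (γ , stay)
  delta (pop r) _ h = nothing , still h [ r ]≔ (lookup h r , right)
  delta (p ⨾ q) (inj₁ s) h = map₁ (just ∘ maybe inj₁ (inj₂ (entry q))) (delta p s h)
  delta (p ⨾ q) (inj₂ s) h = map₁ (Maybe.map inj₂) (delta q s h)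
  delta (branch c p q) (inj₁ _) h =
    just (inj₂ (if c (Vec.map read h) then inj₁ (entry p) else inj₂ (entry q))) , still h
  delta (branch c p q) (inj₂ (inj₁ s)) h = map₁ (Maybe.map (inj₂ ∘ inj₁)) (delta p s h)
  delta (branch c p q) (inj₂ (inj₂ s)) h = map₁ (Maybe.map (inj₂ ∘ inj₂)) (delta q s h)
  delta (loop c p) (inj₁ _) h = (if c (Vec.map read h) then just (inj₂ (entry p)) else nothing) , still h
  delta (loop c p) (inj₂ s) h = map₁ (just ∘ maybe inj₂ (inj₁ tt)) (delta p s h)

  data Exec (p : Prog Sym n) : ℕ → Pos p → Tapes n → Tapes n → Set where
    done : ∀ {s ts a ts′} → delta p s (heads ts) ≡ (nothing , a) → apply a ts ≡ ts′ → Exec p 1 s ts ts′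
    more : ∀ {t s s′ ts a ts₁ ts′} → delta p s (heads ts) ≡ (just s′ , a) → apply a ts ≡ ts₁ →
           Exec p t s′ ts₁ ts′ → Exec p (suc t) s ts ts′

  exec-⨾ : ∀ {p q : Prog Sym n} {t u s ts ts₁ ts₂} → Exec p t s ts ts₁ → Exec q u (entry q) ts₁ ts₂ →
           Exec (p ⨾ q) (t + u) (inj₁ s) ts ts₂
  exec-⨾ {q = q} (done e f) y   = more (cong (map₁ (just ∘ maybe inj₁ (inj₂ (entry q)))) e) f (exec-⨾ʳ y)
    where
    exec-⨾ʳ : ∀ {p q : Prog Sym n} {t s ts ts₁} → Exec q t s ts ts₁ → Exec (p ⨾ q) t (inj₂ s) ts ts₁
    exec-⨾ʳ (done e f)   = done (cong (map₁ (Maybe.map inj₂)) e) f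
    exec-⨾ʳ (more e f x) = more (cong (map₁ (Maybe.map inj₂)) e) f (exec-⨾ʳ x)
  exec-⨾ {q = q} (more e f x) y = more (cong (map₁ (just ∘ maybe inj₁ (inj₂ (entry q)))) e) f (exec-⨾ x y)

  exec-then : ∀ {c} {p q : Prog Sym n} {t s ts ts₁} → Exec p t s ts ts₁ → Exec (branch c p q) t (inj₂ (inj₁ s)) ts ts₁
  exec-then (done e f)   = done (cong (map₁ (Maybe.map (inj₂ ∘ inj₁))) e) f
  exec-then (more e f x) = more (cong (map₁ (Maybe.map (inj₂ ∘ inj₁))) e) f (exec-then x)

  exec-else : ∀ {c} {p q : Prog Sym n} {t s ts ts₁} → Exec q t s ts ts₁ → Exec (branch c p q) t (inj₂ (inj₂ s)) ts ts₁
  exec-else (done e f)   = done (cong (map₁ (Maybe.map (inj₂ ∘ inj₂))) e) f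
  exec-else (more e f x) = more (cong (map₁ (Maybe.map (inj₂ ∘ inj₂))) e) f (exec-else x)

  exec-body : ∀ {c} {p : Prog Sym n} {t u s ts ts₁ ts₂} → Exec p t s ts ts₁ →
              Exec (loop c p) u (inj₁ tt) ts₁ ts₂ → Exec (loop c p) (t + u) (inj₂ s) ts ts₂
  exec-body (done e f)   y = more (cong (map₁ (just ∘ maybe inj₂ (inj₁ tt))) e) f y
  exec-body (more e f x) y = more (cong (map₁ (just ∘ maybe inj₂ (inj₁ tt))) e) f (exec-body x y)

  Simulated : (p : Prog Sym n) → Pos p → ℕ → Tapes n → Store Sym n → Set
  Simulated p s b ts σ = ∃ λ t → ∃ λ ts′ → t ≤ b × Exec p t s ts ts′ × Represents ts′ σ

  mutual
    simulate : ∀ {Z} {p : Prog Sym n} {ts σ σ′} → Run Z p σ σ′ → Represents ts σ →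
               Simulated p (entry p) (cost Z p) ts σ′
    simulate {ts = ts} skip h = 1 , ts , ≤-refl , done refl (apply-still ts) , h
    simulate {ts = ts} {σ} (push {r} {g}) h =
      2 , ts [ r ]≔ t₂ , ≤-refl ,
      more refl (apply-at ts r) (done refl step₂) ,
      holds-update h r (holds-push {lookup ts r} (g (tops σ)) (holds-lookup h r))
      where
      t₁ = act (lookup (heads ts) r , left) (lookup ts r)
      t₂ = act (cell (g (tops σ)) , stay) (act (Tape.head (lookup ts r) , left) (lookup ts r))
      step₂ : apply (still (heads (ts [ r ]≔ t₁)) [ r ]≔ (cell (g (Vec.map read (heads ts))) , stay)) (ts [ r ]≔ t₁) ≡
          ts [ r ]≔ t₂
      step₂ = trans (apply-at (ts [ r ]≔ t₁) r) (trans ([]≔-idempotent ts r)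
        (cong (ts [ r ]≔_) (cong₂ act (cong (λ v → cell (g v) , stay) (reads h))
          (trans (lookup∘update r ts t₁) (cong (λ x → act (x , left) (lookup ts r)) (lookup-map r Tape.head ts))))))
    simulate {ts = ts} (pop {r}) h =
      1 , ts [ r ]≔ act (Tape.head (lookup ts r) , right) (lookup ts r) , ≤-refl ,
      done refl (trans (apply-at ts r) (cong (λ x → ts [ r ]≔ act (x , right) (lookup ts r))
          (lookup-map r Tape.head ts))) ,
      holds-update h r (holds-pop {lookup ts r} (holds-lookup h r))
    simulate (x ⨾ y) h
      with t , ts₁ , l , e , h₁ ← simulate x h
      with u , ts₂ , l′ , e′ , h₂ ← simulate y h₁ =
      t + u , ts₂ , +-mono-≤ l l′ , exec-⨾ e e′ , h₂
    simulate {p = branch c p q} {ts} (on-true e x) h with t , ts₁ , l , x′ , h₁ ← simulate x h =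
      suc t , ts₁ , s≤s (≤-trans l (m≤m+n _ _)) ,
      more (cong (λ b → just (inj₂ (if b then inj₁ (entry p) else inj₂ (entry q))) , still (heads ts))
          (trans (cong c (reads h)) e))
           (apply-still ts) (exec-then x′) , h₁
    simulate {p = branch c p q} {ts} (on-false e x) h with t , ts₁ , l , x′ , h₁ ← simulate x h =
      suc t , ts₁ , s≤s (≤-trans l (m≤n+m _ _)) ,
      more (cong (λ b → just (inj₂ (if b then inj₁ (entry p) else inj₂ (entry q))) , still (heads ts))
          (trans (cong c (reads h)) e))
           (apply-still ts) (exec-else x′) , h₁
    simulate {Z = Z} {p = loop c p} (loop x l) h with t , ts₁ , l′ , e , h₁ ← simulate-loop x h =
      t , ts₁ , ≤-trans l′ (s≤s (*-monoˡ-≤ (suc (cost Z p)) l)) , e , h₁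

    simulate-loop : ∀ {Z c} {p : Prog Sym n} {i ts σ σ′} → Loop Z c p i σ σ′ → Represents ts σ →
                    Simulated (loop c p) (inj₁ tt) (suc (i * suc (cost Z p))) ts σ′
    simulate-loop {c = c} {p} {ts = ts} (stop e) h = 1 , ts , ≤-refl ,
      done (cong (λ b → (if b then just (inj₂ (entry p)) else nothing) , still (heads ts)) (trans (cong c (reads h)) e))
           (apply-still ts) , h
    simulate-loop {Z = Z} {c} {p} {suc i} {ts} (once e x y) h
      with t , ts₁ , l , x′ , h₁ ← simulate x h
      with u , ts₂ , l′ , y′ , h₂ ← simulate-loop y h₁ =
      suc (t + u) , ts₂ , s≤s (≤-trans (+-mono-≤ l l′) (≤-reflexive (+-suc (cost Z p) _))) ,
      more (cong (λ b → (if b then just (inj₂ (entry p)) else nothing) , still (heads ts)) (trans (cong c (reads h)) e))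
           (apply-still ts) (exec-body x′ y′) , h₂

finite-⊤ : Finite ⊤
finite-⊤ = 1 , mk↔ₛ′ (λ _ → zero) (λ _ → tt) (λ { zero → refl }) (λ _ → refl)

finite-⊎ : {A B : Set} → Finite A → Finite B → Finite (A ⊎ B)
finite-⊎ (a , f) (b , g) = a + b , ↔-trans (f ⊎-↔ g) (↔-sym Fin.+↔⊎)

finite-↔ : {A B : Set} → A ↔ B → Finite B → Finite A
finite-↔ e (n , f) = n , ↔-trans e f

finite-Maybe : {A : Set} → Finite A → Finite (Maybe A)
finite-Maybe f = finite-↔ (mk↔ₛ′ code decode (λ { (inj₁ _) → refl ; (inj₂ _) → refl })
    (λ { nothing → refl ; (just _) → refl })) (finite-⊎ finite-⊤ f)
  where
  code = maybe inj₂ (inj₁ tt)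
  decode = [ (λ _ → nothing) , just ]′

finite-Cell : {I O W : Set} → Finite I → Finite O → Finite W → Finite (Cell I O W)
finite-Cell {I} {O} {W} i o w =
  finite-↔ (mk↔ₛ′ code decode code-decode decode-code) (finite-⊎ finite-⊤ (finite-⊎ i (finite-⊎ o w)))
  where
  code : Cell I O W → ⊤ ⊎ I ⊎ O ⊎ W
  code blank      = inj₁ tt
  code (input x)  = inj₂ (inj₁ x)
  code (output x) = inj₂ (inj₂ (inj₁ x))
  code (work x)   = inj₂ (inj₂ (inj₂ x))
  decode : ⊤ ⊎ I ⊎ O ⊎ W → Cell I O W
  decode (inj₁ _)                 = blank
  decode (inj₂ (inj₁ x))          = input x
  decode (inj₂ (inj₂ (inj₁ x)))   = output x
  decode (inj₂ (inj₂ (inj₂ x)))   = work x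
  code-decode : ∀ x → code (decode x) ≡ x
  code-decode (inj₁ _)               = refl
  code-decode (inj₂ (inj₁ x))        = refl
  code-decode (inj₂ (inj₂ (inj₁ x))) = refl
  code-decode (inj₂ (inj₂ (inj₂ x))) = refl
  decode-code : ∀ x → decode (code x) ≡ x
  decode-code blank      = refl
  decode-code (input x)  = refl
  decode-code (output x) = refl
  decode-code (work x)   = refl

module _ {I O W : Set} (finite : Finite (Cell I O W)) where

  finite-Pos : (p : Prog (Sym {I} {O} {W}) n) → Finite (Pos p)
  finite-Pos skip           = finite-⊤
  finite-Pos (push _ _)     = finite-⊎ finite-⊤ finite
  finite-Pos (pop _)        = finite-⊤
  finite-Pos (p ⨾ q)        = finite-⊎ (finite-Pos p) (finite-Pos q)
  finite-Pos (branch _ p q) = finite-⊎ finite-⊤ (finite-⊎ (finite-Pos p) (finite-Pos q))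
  finite-Pos (loop _ p)     = finite-⊎ finite-⊤ (finite-Pos p)

  -- The additional state `nothing` is entered by the last step of the program and has no
  -- transition.
  machine : Prog (Sym {I} {O} {W}) (suc n) → TM I O
  machine {n} p = record
    { State       = Maybe (Pos p)
    ; Work        = W
    ; extraTapes  = n
    ; finiteState = finite-Maybe (finite-Pos p)
    ; finiteΓ     = finite
    ; start       = just (entry p)
    ; transition  = λ s h → Maybe.map (λ s → delta p s h) s
    }

  halts : ∀ {p : Prog (Sym {I} {O} {W}) (suc n)} {t s ts ts′} → Exec p t s ts ts′ →
          HaltsIn (machine p) t (just s , ts) (nothing , ts′)
  halts (done e refl)   = next (cong (λ (s′ , a) → just (s′ , apply a _)) e) (halt refl)
  halts (more e refl x) = next (cong (λ (s′ , a) → just (s′ , apply a _)) e) (halts x)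

  represents-blank : ∀ n → Represents {I} {O} {W} (Vec.replicate n (tape [] blank [])) (Vec.replicate n [])
  represents-blank zero    = []
  represents-blank (suc n) = (1 , refl) ∷ represents-blank n

  holds-input : ∀ w → Holds {I} {O} {W} (inputTape w) (map inj₁ w)
  holds-input []      = 1 , refl
  holds-input (i ∷ w) = 0 , cong (input i ∷_) (inputs w)
    where
    inputs : ∀ w → map input w ≡ map cell (map inj₁ w) ++ []
    inputs []      = refl
    inputs (i ∷ w) = cong (input i ∷_) (inputs w)

  holds-output : ∀ {t} v → Holds {I} {O} {W} t (map (inj₂ ∘ inj₁) v) → readOutput t ≡ v
  holds-output v (j , e) = trans (cong outputPrefix e) (go v j)
    where
    go : ∀ v j → outputPrefix (map cell (map (inj₂ ∘ inj₁) v) ++ replicate j blank) ≡ v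
    go []      zero    = refl
    go []      (suc j) = refl
    go (o ∷ v) j       = cong (o ∷_) (go v j)

  computes : ∀ {Z} {p : Prog (Sym {I} {O} {W}) (suc n)} {w v σ} →
             Run Z p (map inj₁ w ∷ Vec.replicate n []) (map (inj₂ ∘ inj₁) v ∷ σ) →
             Computes_↦_Within_ (machine p) w v (cost Z p)
  computes {n = n} {w = w} {v} x
    with t , t₀ ∷ _ , l , e , h ∷ _ ← simulate x (holds-input w ∷ represents-blank n) =
    t , _ , l , halts e , holds-output {t₀} v h

-- Tables of pairs of words

sel : Vec (Fin n) m → Vec A n → Vec A m
sel ι v = Vec.map (lookup v) ι

put : Vec (Fin n) m → Vec A m → Vec A n → Vec A n
put []      []      v = v
put (i ∷ ι) (x ∷ w) v = put ι w v [ i ]≔ x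

_≠ᵇ_ : Fin n → Fin n → Bool
zero  ≠ᵇ zero  = false
zero  ≠ᵇ suc _ = true
suc _ ≠ᵇ zero  = true
suc i ≠ᵇ suc j = i ≠ᵇ j

avoids : Fin n → Vec (Fin n) m → Bool
avoids i []      = true
avoids i (j ∷ ι) = i ≠ᵇ j ∧ avoids i ι

distinct : Vec (Fin n) m → Bool
distinct []      = true
distinct (i ∷ ι) = avoids i ι ∧ distinct ι

-- A computed truth value and not an inductive predicate: for a concrete list of registers it
-- reduces to the unit type, so the implicit argument of `call` is filled in by unification.
Distinct : Vec (Fin n) m → Set
Distinct ι = T (distinct ι)

split-∧ : ∀ a {b} → T (a ∧ b) → T a × T b
split-∧ true t = tt , t

≠ᵇ⇒≢ : (i j : Fin n) → T (i ≠ᵇ j) → j ≢ i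
≠ᵇ⇒≢ (suc i) (suc i) t refl = ≠ᵇ⇒≢ i i t refl

avoids-lookup : ∀ {i : Fin n} (ι : Vec (Fin n) m) → T (avoids i ι) → ∀ s → lookup ι s ≢ i
avoids-lookup {i = i} (j ∷ ι) t zero    = ≠ᵇ⇒≢ i j (proj₁ (split-∧ (i ≠ᵇ j) t))
avoids-lookup {i = i} (j ∷ ι) t (suc s) = avoids-lookup ι (proj₂ (split-∧ (i ≠ᵇ j) t)) s

lookup-put : (ι : Vec (Fin n) m) → Distinct ι → (w : Vec A m) (v : Vec A n) → ∀ s →
             lookup (put ι w v) (lookup ι s) ≡ lookup w s
lookup-put (i ∷ ι) d (x ∷ w) v zero    = lookup∘update i (put ι w v) x
lookup-put (i ∷ ι) d (x ∷ w) v (suc s) with a , d′ ← split-∧ (avoids i ι) d =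
  trans (lookup∘update′ (avoids-lookup ι a s) (put ι w v) x) (lookup-put ι d′ w v s)

update-put : (ι : Vec (Fin n) m) → Distinct ι → (w : Vec A m) (v : Vec A n) → ∀ s {x} →
             put ι w v [ lookup ι s ]≔ x ≡ put ι (w [ s ]≔ x) v
update-put (i ∷ ι) d (x ∷ w) v zero    = []≔-idempotent (put ι w v) i
update-put (i ∷ ι) d (x ∷ w) v (suc s) with a , d′ ← split-∧ (avoids i ι) d =
  trans ([]≔-commutes (put ι w v) i (lookup ι s) (≢-sym (avoids-lookup ι a s)))
        (cong (_[ i ]≔ x) (update-put ι d′ w v s))

sel-put : (ι : Vec (Fin n) m) → Distinct ι → (w : Vec A m) (v : Vec A n) → sel ι (put ι w v) ≡ w
sel-put []      _ []      v = refl
sel-put (i ∷ ι) d (x ∷ w) v with a , d′ ← split-∧ (avoids i ι) d =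
  cong₂ _∷_ (lookup∘update i (put ι w v) x) (trans (skip-i ι a) (sel-put ι d′ w v))
  where
  skip-i : ∀ {l} (κ : Vec _ l) → T (avoids i κ) → sel κ (put ι w v [ i ]≔ x) ≡ sel κ (put ι w v)
  skip-i []      _ = refl
  skip-i (j ∷ κ) t with u , b ← split-∧ (i ≠ᵇ j) t =
    cong₂ _∷_ (lookup∘update′ (≠ᵇ⇒≢ i j u) (put ι w v) x) (skip-i κ b)

put-sel : (ι : Vec (Fin n) m) (v : Vec A n) → put ι (sel ι v) v ≡ v
put-sel []      v = refl
put-sel (i ∷ ι) v = trans (cong (_[ i ]≔ lookup v i) (put-sel ι v)) ([]≔-lookup v i)

sel-tops : (ι : Vec (Fin n) m) (σ : Store S n) → sel ι (tops σ) ≡ tops (sel ι σ)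
sel-tops []      σ = refl
sel-tops (i ∷ ι) σ = cong₂ _∷_ (lookup-map i head σ) (sel-tops ι σ)

-- Opaque, so that an embedded program is recovered from its embedding by unification.
opaque
  embed : Vec (Fin n) m → Prog S m → Prog S n
  embed ι skip           = skip
  embed ι (push r g)     = push (lookup ι r) (g ∘ sel ι)
  embed ι (pop r)        = pop (lookup ι r)
  embed ι (p ⨾ q)        = embed ι p ⨾ embed ι q
  embed ι (branch c p q) = branch (c ∘ sel ι) (embed ι p) (embed ι q)
  embed ι (loop c p)     = loop (c ∘ sel ι) (embed ι p)

module _ {Z : ℕ} (ι : Vec (Fin n) m) (d : Distinct ι) where

  tops-put : (τ : Store S m) (σ : Store S n) → sel ι (tops (put ι τ σ)) ≡ tops τ
  tops-put τ σ = trans (sel-tops ι (put ι τ σ)) (cong tops (sel-put ι d τ σ))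

  opaque
    unfolding embed

    mutual
      run-embed : ∀ {p : Prog S m} {τ τ′} σ → Run Z p τ τ′ → Run Z (embed ι p) (put ι τ σ) (put ι τ′ σ)
      run-embed σ skip = skip
      run-embed {τ = τ} σ (push {r} {g}) =
        subst (Run Z _ _) (trans (cong (λ x → put ι τ σ [ lookup ι r ]≔ x)
                                  (cong₂ _∷_ (cong g (tops-put τ σ)) (lookup-put ι d τ σ r)))
                                 (update-put ι d τ σ r)) push
      run-embed {τ = τ} σ (pop {r}) =
        subst (Run Z _ _) (trans (cong (λ x → put ι τ σ [ lookup ι r ]≔ drop 1 x) (lookup-put ι d τ σ r))
                                 (update-put ι d τ σ r)) pop
      run-embed σ (x ⨾ y) = run-embed σ x ⨾ run-embed σ y
      run-embed {τ = τ} σ (on-true {c} e x)  = on-true (trans (cong c (tops-put τ σ)) e) (run-embed σ x)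
      run-embed {τ = τ} σ (on-false {c} e x) = on-false (trans (cong c (tops-put τ σ)) e) (run-embed σ x)
      run-embed σ (loop x l) = loop (loop-embed σ x) l

      loop-embed : ∀ {c} {p : Prog S m} {t τ τ′} σ → Loop Z c p t τ τ′ →
                   Loop Z (c ∘ sel ι) (embed ι p) t (put ι τ σ) (put ι τ′ σ)
      loop-embed {c = c} {τ = τ} σ (stop e)     = stop (trans (cong c (tops-put τ σ)) e)
      loop-embed {c = c} {τ = τ} σ (once e x y) = once (trans (cong c (tops-put τ σ)) e) (run-embed σ x) (loop-embed σ y)

call : ∀ {Z} (ι : Vec (Fin n) m) {d : Distinct ι} {p : Prog S m} {σ τ} →
       Run Z p (sel ι σ) τ → Run Z (embed ι p) σ (put ι τ σ)
call {Z = Z} ι {d} {p} {σ} {τ} x =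
  subst (λ v → Run Z (embed ι p) v (put ι τ σ)) (put-sel ι σ) (run-embed ι d σ x)

is : (S → Bool) → Fin n → Vec (Maybe S) n → Bool
is p r ts = maybe p false (lookup ts r)

some : Fin n → Vec (Maybe S) n → Bool
some = is (λ _ → true)

clear : Prog S 1
clear = loop (some 0F) (pop 0F)

clear-run : ∀ {Z} (xs : List S) → length xs ≤ Z → Run Z clear (xs ∷ []) ([] ∷ [])
clear-run {Z = Z} xs l = loop (go xs) l
  where
  go : ∀ xs → Loop Z (some 0F) (pop 0F) (length xs) (xs ∷ []) ([] ∷ [])
  go []       = stop refl
  go (x ∷ xs) = once refl pop (go xs)

infix 1 _!
_! : Bool → Set
b ! = b ≡ true

Work : ℕ → Set
Work k = Fin k ⊎ Bool ⊎ Fin 3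

Alphabet : ℕ → Set → Set
Alphabet k O = Sym {Symbol k 2} {O} {Work k}

pattern inp i = inj₁ i
pattern out o = inj₂ (inj₁ o)
pattern ltr a = inj₂ (inj₂ (inj₁ a))
pattern bit b = inj₂ (inj₂ (inj₂ (inj₁ b)))
pattern hash  = inj₂ (inj₂ (inj₂ (inj₂ 0F)))
pattern eor   = inj₂ (inj₂ (inj₂ (inj₂ 1F)))
pattern one   = inj₂ (inj₂ (inj₂ (inj₂ 2F)))

module Programs (k : ℕ) (O : Set) where

  Σ′ : Set
  Σ′ = Alphabet k O

  Stack : Set
  Stack = List Σ′

  P : ℕ → Set
  P = Prog Σ′

  -- The default is a dummy: wherever a run below uses `get`, the stack is nonempty.
  get : Fin n → Vec (Maybe Σ′) n → Σ′
  get r ts = fromMaybe eor (lookup ts r)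

  moveWhile : (Σ′ → Bool) → P 2
  moveWhile p = loop (is p 0F) (push 1F (get 0F) ⨾ pop 0F)

  copyWhile : (Σ′ → Bool) → P 3
  copyWhile p = loop (is p 0F) (push 1F (get 0F) ⨾ push 2F (get 0F) ⨾ pop 0F)

  shift : P 2
  shift = moveWhile (λ _ → true)

  fork : P 3
  fork = copyWhile (λ _ → true)

  -- Each transfer between stacks reverses, so a faithful copy takes two transfers through an empty
  -- auxiliary stack.
  copy : P 3
  copy = embed (0F ∷ 1F ∷ []) shift ⨾ embed (1F ∷ 0F ∷ 2F ∷ []) fork

  isLetter : Σ′ → Bool
  isLetter (ltr _) = true
  isLetter _       = false

  notEor : Σ′ → Bool
  notEor eor = false
  notEor _   = true

  field′ : P 3
  field′ = copyWhile isLetter ⨾ push 1F (λ _ → hash) ⨾ pop 0F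

  -- The body finds the truth values of the current row on top of the table and the two words of the
  -- row, reversed, in registers 2 and 3. Finished rows pile up on register 1, and the last transfer
  -- restores their order.
  forRows : P (4 + m) → P (4 + m)
  forRows body =
    loop (some 0F)
      (embed (0F ∷ 1F ∷ 2F ∷ []) field′ ⨾ embed (0F ∷ 1F ∷ 3F ∷ []) field′ ⨾ body ⨾
       embed (0F ∷ 1F ∷ []) (moveWhile notEor) ⨾ push 1F (λ _ → eor) ⨾ pop 0F ⨾
       embed (2F ∷ []) clear ⨾ embed (3F ∷ []) clear) ⨾
    embed (1F ∷ 0F ∷ []) shift

  eqTops : Maybe Σ′ → Maybe Σ′ → Bool
  eqTops (just (ltr a)) (just (ltr b)) = ⌊ a Fin.≟ b ⌋
  eqTops _              _              = false

  mark : Fin n → P n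
  mark r = push r (λ _ → one)

  -- On (a , b , t , m): marks m unless a = b.
  eqTest : P 4
  eqTest =
    loop (λ ts → eqTops (lookup ts 0F) (lookup ts 1F)) (push 2F (get 0F) ⨾ pop 0F ⨾ pop 1F) ⨾
    branch (λ ts → some 0F ts ∨ some 1F ts) (mark 3F) skip ⨾
    loop (some 2F) (push 0F (get 2F) ⨾ push 1F (get 2F) ⨾ pop 2F)

  -- On (b , M , t , m): marks m unless b is at most as long as M.
  leqTest : P 4
  leqTest =
    loop (λ ts → some 0F ts ∧ some 1F ts) (push 2F (get 0F) ⨾ pop 0F ⨾ pop 1F) ⨾
    branch (some 0F) (mark 3F) skip ⨾
    loop (some 2F) (push 0F (get 2F) ⨾ mark 1F ⨾ pop 2F)

  isTrue : Σ′ → Bool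
  isTrue (bit b) = b
  isTrue _       = false

  topBit : Fin n → Vec (Maybe Σ′) n → Bool
  topBit = is isTrue

  -- On (T , m , F).
  hit : P 3
  hit = branch (λ ts → topBit 0F ts ∧ not (some 1F ts)) (pop 2F ⨾ push 2F (λ _ → bit true)) skip ⨾ embed (1F ∷ []) clear

  -- On (O , O′ , a , b , kx , ky , t , m , F).
  lookBody : P 9
  lookBody = embed (2F ∷ 4F ∷ 6F ∷ 7F ∷ []) eqTest ⨾ embed (3F ∷ 5F ∷ 6F ∷ 7F ∷ []) eqTest ⨾ embed (0F ∷ 7F ∷ 8F ∷ []) hit

  look : P 9
  look = push 8F (λ _ → bit false) ⨾ forRows lookBody

  -- On (O , O′ , a , b , k , M , t , m , F): v is the quantified variable and k the other one.
  someBody : Fin 2 → P 9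
  someBody 0F = embed (3F ∷ 4F ∷ 6F ∷ 7F ∷ []) eqTest ⨾ embed (2F ∷ 5F ∷ 6F ∷ 7F ∷ []) leqTest ⨾ embed
      (0F ∷ 7F ∷ 8F ∷ []) hit
  someBody 1F = embed (2F ∷ 4F ∷ 6F ∷ 7F ∷ []) eqTest ⨾ embed (3F ∷ 5F ∷ 6F ∷ 7F ∷ []) leqTest ⨾ embed
      (0F ∷ 7F ∷ 8F ∷ []) hit

  someRow : Fin 2 → P 9
  someRow v = push 8F (λ _ → bit false) ⨾ forRows (someBody v)

  setTop : P 2
  setTop = pop 0F ⨾ push 0F (get 1F) ⨾ pop 1F

  -- On (T , T′ , rx , ry , F).
  negRow : P 5
  negRow = push 4F (λ ts → bit (not (topBit 0F ts))) ⨾ embed (0F ∷ 4F ∷ []) setTop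

  binRow : (Bool → Bool → Bool) → P 5
  binRow f =
    push 4F (get 0F) ⨾ pop 0F ⨾ push 4F (λ ts → bit (f (topBit 4F ts) (topBit 0F ts))) ⨾
    embed (0F ∷ 4F ∷ []) setTop ⨾ pop 4F

  -- On (T , T′ , rx , ry , O , O′ , a , b , t , m , F , M).
  otherRegister : Fin 2 → Fin 12
  otherRegister 0F = 3F
  otherRegister 1F = 2F

  existsRow : Fin 2 → P 12
  existsRow v =
    embed (4F ∷ 5F ∷ 6F ∷ 7F ∷ otherRegister v ∷ # 11 ∷ 8F ∷ 9F ∷ # 10 ∷ []) (someRow v) ⨾
    embed (0F ∷ # 10 ∷ []) setTop

  -- The copy preserves the old truth values, which every row still has to consult while the table
  -- itself is being overwritten.
  existsTable : Fin 2 → P 12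
  existsTable v = embed (0F ∷ 1F ∷ 4F ∷ []) copy ⨾ forRows (existsRow v) ⨾ embed (4F ∷ []) clear

  isVar : Fin 2 → Σ′ → Bool
  isVar v (inp (var w)) = ⌊ v Fin.≟ w ⌋
  isVar v _             = false

  isLetterSymbol : Σ′ → Bool
  isLetterSymbol (inp (letter _)) = true
  isLetterSymbol _                = false

  toLetter : Σ′ → Σ′
  toLetter (inp (letter a)) = ltr a
  toLetter s                = s

  next′ : P (2 + n)
  next′ = push 1F (get 0F) ⨾ pop 0F

  -- On (P , P′ , rx , ry , t , a): reads a term from P and stores its value in a.
  load : P 6
  load =
    branch (is (isVar 0F) 0F) (next′ ⨾ embed (2F ∷ 4F ∷ 5F ∷ []) copy)
    (branch (is (isVar 1F) 0F) (next′ ⨾ embed (3F ∷ 4F ∷ 5F ∷ []) copy)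
    (next′ ⨾ loop (is isLetterSymbol 0F) (push 5F (λ ts → toLetter (get 0F ts)) ⨾ next′) ⨾ next′))

  -- On (a , b , F).
  subTest : P 3
  subTest =
    loop (λ ts → some 0F ts ∧ some 1F ts) (branch (λ ts → eqTops (lookup ts 0F) (lookup ts 1F)) (pop 0F) skip ⨾ pop 1F) ⨾
    push 2F (λ ts → bit (not (some 0F ts))) ⨾ embed (0F ∷ []) clear ⨾ embed (1F ∷ []) clear

  -- On (T , T′ , rx , ry , P , P′ , a , b , t , F).
  atomRow : P 10
  atomRow =
    embed (4F ∷ 5F ∷ 2F ∷ 3F ∷ 8F ∷ 6F ∷ []) load ⨾ embed (4F ∷ 5F ∷ 2F ∷ 3F ∷ 8F ∷ 7F ∷ []) load ⨾
    embed (6F ∷ 7F ∷ 9F ∷ []) subTest ⨾ push 0F (get 9F) ⨾ pop 9F ⨾ embed (5F ∷ 4F ∷ []) shift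

  -- On (G , t , M): removes as many symbols from M as there are in G.
  subtract : P 3
  subtract = loop (some 0F) (push 1F (get 0F) ⨾ pop 0F ⨾ pop 2F) ⨾ embed (1F ∷ 0F ∷ []) shift

  isOperand isAtom isNot isAnd isOr isImplies isExists : Σ′ → Bool
  isOperand (inp (var _))    = true
  isOperand (inp (letter _)) = true
  isOperand (inp `⟨)         = true
  isOperand (inp `⟩)         = true
  isOperand _                = false
  isAtom (inp `⊑)            = true
  isAtom _                   = false
  isNot (inp `¬)             = true
  isNot _                    = false
  isAnd (inp `∧)             = true
  isAnd _                    = false
  isOr (inp `∨)              = true
  isOr _                     = false
  isImplies (inp `⇒)         = true
  isImplies _                = false
  isExists (inp `∃)          = true
  isExists _                 = false

  implies : Bool → Bool → Bool
  implies a b = not a ∨ b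

  -- On (T , T′ , rx , ry , O , O′ , a , b , t , m , F , M , P , P′ , R , G).
  negTable : P 16
  negTable = embed (0F ∷ 1F ∷ 2F ∷ 3F ∷ # 10 ∷ []) (forRows negRow)

  binTable : (Bool → Bool → Bool) → P 16
  binTable f = embed (0F ∷ 1F ∷ 2F ∷ 3F ∷ # 10 ∷ []) (forRows (binRow f))

  quantTable : P 16
  quantTable =
    branch (is (isVar 0F) (# 12)) (embed existsRegisters (existsTable 0F)) (embed existsRegisters (existsTable 1F)) ⨾
    embed (# 15 ∷ 8F ∷ # 11 ∷ []) subtract ⨾ embed (# 12 ∷ []) clear
    where
    existsRegisters = 0F ∷ 1F ∷ 2F ∷ 3F ∷ 4F ∷ 5F ∷ 6F ∷ 7F ∷ 8F ∷ 9F ∷ # 10 ∷ # 11 ∷ []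

  atomTable : P 16
  atomTable = embed (0F ∷ 1F ∷ 2F ∷ 3F ∷ # 12 ∷ # 13 ∷ 6F ∷ 7F ∷ 8F ∷ # 10 ∷ []) (forRows atomRow) ⨾ embed (# 12 ∷ [])
      clear

  evalStep : P 16
  evalStep =
    branch (is isOperand (# 14)) (push (# 12) (get (# 14)))
    (branch (is isAtom (# 14)) atomTable
    (branch (is isNot (# 14)) negTable
    (branch (is isAnd (# 14)) (binTable _∧_)
    (branch (is isOr (# 14)) (binTable _∨_)
    (branch (is isImplies (# 14)) (binTable implies)
    (branch (is isExists (# 14)) quantTable
    (negTable ⨾ quantTable ⨾ negTable)))))))

  -- The formula is read from right to left, so that the operands of a
  -- connective are on the stacks of truth values when it is reached.
  evaluate : P 16
  evaluate = loop (some (# 14)) (evalStep ⨾ pop (# 14))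

  -- On (U , t).
  double : P 2
  double = loop (some 0F) (mark 1F ⨾ mark 1F ⨾ pop 0F) ⨾ embed (1F ∷ 0F ∷ []) shift

  times : ℕ → P n → P n
  times zero    p = skip
  times (suc i) p = p ⨾ times i p

  -- On (I , R , U , G , t): reverses the input I into R and sets G to 2 ^ (2 ^ (c * length I)) marks.
  bound : ℕ → P 5
  bound c =
    mark 2F ⨾ loop (some 0F) (times c (embed (2F ∷ 4F ∷ []) double) ⨾ push 1F (get 0F) ⨾ pop 0F) ⨾
    mark 3F ⨾ loop (some 2F) (embed (3F ∷ 4F ∷ []) double ⨾ pop 2F)

  -- On (G , U , t , M).
  square : P 4
  square = embed (0F ∷ 2F ∷ 1F ∷ []) copy ⨾ loop (some 1F) (embed (0F ∷ 2F ∷ 3F ∷ []) copy ⨾ pop 1F)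

  -- On (r , t , N).
  emit : P 3
  emit = embed (0F ∷ 1F ∷ []) shift ⨾ embed (1F ∷ 0F ∷ 2F ∷ []) fork

  each : (Fin k → P n) → List (Fin k) → P n
  each p []       = skip
  each p (a ∷ as) = p a ⨾ each p as

  endRow : Fin n → P n
  endRow r = push r (λ _ → hash) ⨾ push r (λ _ → hash) ⨾ push r (λ _ → eor)

  -- On (W , W′ , rx , ry , N , t).
  longer : Fin k → P 6
  longer a = push 4F (λ _ → ltr a) ⨾ embed (2F ∷ 5F ∷ 4F ∷ []) emit ⨾ endRow 4F

  grow : P 6
  grow = endRow 4F ⨾ forRows (each longer (List.allFin k)) ⨾ embed (0F ∷ []) clear ⨾ embed (4F ∷ 0F ∷ []) shift

  -- On (W , W′ , rx , ry , N , t , x): as many rounds as there are marks in x.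
  growAll : P 7
  growAll = loop (some 6F) (embed (0F ∷ 1F ∷ 2F ∷ 3F ∷ 4F ∷ 5F ∷ []) grow ⨾ pop 6F)

  -- On (X , X′ , a , b , rx , N , t).
  pairRow : P 7
  pairRow =
    embed (4F ∷ 6F ∷ 5F ∷ []) emit ⨾ push 5F (λ _ → hash) ⨾
    embed (2F ∷ 6F ∷ 5F ∷ []) emit ⨾ push 5F (λ _ → hash) ⨾ push 5F (λ _ → eor)

  -- On (W , W′ , rx , ry , X , X′ , a , b , N , t).
  pairTable : P 10
  pairTable =
    embed (0F ∷ 1F ∷ 4F ∷ []) copy ⨾
    forRows (embed (4F ∷ 5F ∷ 6F ∷ 7F ∷ 2F ∷ 8F ∷ 9F ∷ []) (forRows pairRow))

-- Correctness of the elementary stack programs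

module Basics (k : ℕ) (O : Set) (Z : ℕ) where

  open Programs k O

  Stops : (Σ′ → Bool) → Stack → Set
  Stops p zs = maybe p false (head zs) ≡ false

  moveWhile-run : ∀ {p} xs {ys zs} → All (λ x → p x !) xs → Stops p zs → length xs ≤ Z →
                  Run Z (moveWhile p) ((xs ++ zs) ∷ ys ∷ []) (zs ∷ (xs ʳ++ ys) ∷ [])
  moveWhile-run {p} xs {zs = zs} a s l = loop (go xs a) l
    where
    go : ∀ xs {ys} → All (λ x → p x !) xs →
         Loop Z (is p 0F) (push 1F (get 0F) ⨾ pop 0F) (length xs) ((xs ++ zs) ∷ ys ∷ []) (zs ∷ (xs ʳ++ ys) ∷ [])
    go []       []      = stop s
    go (x ∷ xs) (h ∷ a) = once h (push ⨾ pop) (go xs a)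

  copyWhile-run : ∀ {p} xs {ys ys′ zs} → All (λ x → p x !) xs → Stops p zs → length xs ≤ Z →
                  Run Z (copyWhile p) ((xs ++ zs) ∷ ys ∷ ys′ ∷ []) (zs ∷ (xs ʳ++ ys) ∷ (xs ʳ++ ys′) ∷ [])
  copyWhile-run {p} xs {zs = zs} a s l = loop (go xs a) l
    where
    go : ∀ xs {ys ys′} → All (λ x → p x !) xs →
         Loop Z (is p 0F) (push 1F (get 0F) ⨾ push 2F (get 0F) ⨾ pop 0F) (length xs)
              ((xs ++ zs) ∷ ys ∷ ys′ ∷ []) (zs ∷ (xs ʳ++ ys) ∷ (xs ʳ++ ys′) ∷ [])
    go []       []      = stop s
    go (x ∷ xs) (h ∷ a) = once h (push ⨾ push ⨾ pop) (go xs a)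

  anything : ∀ xs → All {A = Σ′} (λ _ → true !) xs
  anything []       = []
  anything (x ∷ xs) = refl ∷ anything xs

  shift-run : ∀ xs {ys} → length xs ≤ Z → Run Z shift (xs ∷ ys ∷ []) ([] ∷ (xs ʳ++ ys) ∷ [])
  shift-run xs {ys} l =
    subst (λ zs → Run Z shift (zs ∷ ys ∷ []) ([] ∷ (xs ʳ++ ys) ∷ [])) (++-identityʳ xs)
        (moveWhile-run xs (anything xs) refl l)

  fork-run : ∀ xs {ys ys′} → length xs ≤ Z → Run Z fork (xs ∷ ys ∷ ys′ ∷ []) ([] ∷ (xs ʳ++ ys) ∷ (xs ʳ++ ys′) ∷ [])
  fork-run xs {ys} {ys′} l =
    subst (λ zs → Run Z fork (zs ∷ ys ∷ ys′ ∷ []) ([] ∷ (xs ʳ++ ys) ∷ (xs ʳ++ ys′) ∷ [])) (++-identityʳ xs)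
          (copyWhile-run xs (anything xs) refl l)

  length-ʳ : ∀ (xs : Stack) → length (xs ʳ++ []) ≡ length xs
  length-ʳ xs = length-reverse xs

  copy-run : ∀ xs {ys} → length xs ≤ Z → Run Z copy (xs ∷ [] ∷ ys ∷ []) (xs ∷ [] ∷ (xs ++ ys) ∷ [])
  copy-run xs {ys} l = subst₂ (λ u v → Run Z copy (xs ∷ [] ∷ ys ∷ []) (u ∷ [] ∷ v ∷ []))
    (trans (ʳ++-ʳ++ xs) (++-identityʳ xs)) (ʳ++-ʳ++ xs)
    (call (0F ∷ 1F ∷ []) (shift-run xs l) ⨾
     call (1F ∷ 0F ∷ 2F ∷ []) (fork-run (xs ʳ++ []) (≤-trans (≤-reflexive (length-ʳ xs)) l)))

  copy-fresh : ∀ xs → length xs ≤ Z → Run Z copy (xs ∷ [] ∷ [] ∷ []) (xs ∷ [] ∷ xs ∷ [])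
  copy-fresh xs l = subst (λ u → Run Z copy (xs ∷ [] ∷ [] ∷ []) (xs ∷ [] ∷ u ∷ [])) (++-identityʳ xs) (copy-run xs l)

  spell : Word k → Stack
  spell = map ltr

  -- Popping a word off the table letter by letter reverses it. Equality and the subword order are
  -- insensitive to reversing both words, and appending a letter at the end of a word becomes a
  -- single push.
  spellʳ : Word k → Stack
  spellʳ w = spell (reverse w)

  bits : List Bool → Stack
  bits = map (λ b → bit b)

  letters : ∀ w → All (λ x → isLetter x !) (spell w)
  letters []      = []
  letters (a ∷ w) = refl ∷ letters w

  no-eor : ∀ bs → All (λ x → notEor x !) (bits bs)
  no-eor []       = []
  no-eor (b ∷ bs) = refl ∷ no-eor bs

  spell-ʳ : ∀ w → spell w ʳ++ [] ≡ spellʳ w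
  spell-ʳ w = sym (map-ʳ++ ltr w)

  spellʳ-ʳ : ∀ w {ys} → spellʳ w ʳ++ ys ≡ spell w ++ ys
  spellʳ-ʳ w {ys} = trans (cong (_ʳ++ ys) (sym (spell-ʳ w))) (ʳ++-ʳ++ (spell w))

  length-spellʳ : ∀ w → length (spellʳ w) ≡ length w
  length-spellʳ w = trans (length-map ltr (reverse w)) (length-reverse w)

  Value : Set
  Value = Word k → Word k → List Bool

  Pairs : Set
  Pairs = List (Word k × Word k)

  -- A table has a row for every pair of words; bs is the stack of the truth
  -- values of the subformulae that have been read but not yet used.
  row : Word k → Word k → List Bool → Stack → Stack
  row x y bs rest = spell x ++ hash ∷ spell y ++ hash ∷ bits bs ++ eor ∷ rest

  tab : Value → Pairs → Stack
  tab v []             = []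
  tab v ((x , y) ∷ ps) = row x y (v x y) (tab v ps)

  rowʳ : Word k → Word k → List Bool → Stack → Stack
  rowʳ x y bs t = eor ∷ (bits bs ʳ++ (hash ∷ (spell y ʳ++ (hash ∷ (spell x ʳ++ t)))))

  tabʳ : Value → Pairs → Stack → Stack
  tabʳ v []             t = t
  tabʳ v ((x , y) ∷ ps) t = tabʳ v ps (rowʳ x y (v x y) t)

  tabʳ-ʳ : ∀ v ps t → tabʳ v ps t ʳ++ [] ≡ t ʳ++ tab v ps
  tabʳ-ʳ v []             t = refl
  tabʳ-ʳ v ((x , y) ∷ ps) t = trans (tabʳ-ʳ v ps (rowʳ x y (v x y) t))
    (trans (ʳ++-ʳ++ (bits (v x y))) (trans (ʳ++-ʳ++ (spell y)) (ʳ++-ʳ++ (spell x))))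

  field-run : ∀ x {t zs} → length x ≤ Z →
              Run Z field′ ((spell x ++ hash ∷ zs) ∷ t ∷ [] ∷ []) (zs ∷ (hash ∷ (spell x ʳ++ t)) ∷ spellʳ x ∷ [])
  field-run x {t} {zs} l =
    subst (λ u → Run Z field′ ((spell x ++ hash ∷ zs) ∷ t ∷ [] ∷ []) (zs ∷ (hash ∷ (spell x ʳ++ t)) ∷ u ∷ []))
      (spell-ʳ x)
      (copyWhile-run (spell x) (letters x) refl (≤-trans (≤-reflexive (length-map ltr x)) l) ⨾ push ⨾ pop)

  length-row : ∀ x y bs rest → length (row x y bs rest) ≡ length x + suc (length y + suc (length bs + suc (length rest)))
  length-row x y bs rest =
    trans (length-++ (spell x)) (cong₂ _+_ (length-map ltr x) (cong suc
      (trans (length-++ (spell y)) (cong₂ _+_ (length-map ltr y) (cong suc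
        (trans (length-++ (bits bs)) (cong (_+ suc (length rest)) (length-map (λ b → bit b) bs))))))))

  private
    row-x : ∀ x {y bs rest} → length (row x y bs rest) ≤ Z → length x ≤ Z
    row-x x {y} {bs} {rest} l = ≤-trans (m≤m+n _ _) (≤-trans (≤-reflexive (sym (length-row x y bs rest))) l)
    row-y : ∀ x {y bs rest} → length (row x y bs rest) ≤ Z → length y ≤ Z
    row-y x {y} {bs} {rest} l = ≤-trans (≤-trans (m≤m+n _ _) (≤-trans (n≤1+n _) (m≤n+m _ (length x))))
        (≤-trans (≤-reflexive (sym (length-row x y bs rest))) l)
    row-b : ∀ x {y bs rest} → length (row x y bs rest) ≤ Z → length bs + suc (length rest) ≤ Z
    row-b x {y} {bs} {rest} l = ≤-trans (≤-trans (≤-trans (n≤1+n _) (≤-trans (m≤n+m _ (length y)) (n≤1+n _)))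
        (m≤n+m _ (length x))) (≤-trans (≤-reflexive (sym (length-row x y bs rest))) l)
    row-rest : ∀ x {y bs rest} → length (row x y bs rest) ≤ Z → length rest < Z
    row-rest x {y} {bs} {rest} l = ≤-trans (m≤n+m _ (length bs)) (row-b x {y} {bs} {rest} l)

  module _ {A : Set} {m} (τ : A → Vec Stack m) (f : A → Word k × Word k → A)
           {v v′ : Value} (J : Pairs → A → Set) {body : P (4 + m)}
           (body-run : ∀ {x y ps a rest t} → J ((x , y) ∷ ps) a →
              Run Z body ((bits (v x y) ++ eor ∷ rest) ∷ t ∷ spellʳ x ∷ spellʳ y ∷ τ a)
                         ((bits (v′ x y) ++ eor ∷ rest) ∷ t ∷ spellʳ x ∷ spellʳ y ∷ τ (f a (x , y))))
           (step : ∀ {p ps a} → J (p ∷ ps) a → J ps (f a p)) where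

    -- The state `a`, displayed on the remaining registers by `τ`, is folded over the rows by `f`.
    -- The invariant `J` sees the rows still to be read, so it can provide length bounds for them
    -- and count them down.
    rows-loop : ∀ ps {a t} → J ps a → length (tab v ps) ≤ Z → length (tab v′ ps) ≤ Z →
      ∃ λ i → i ≤ length (tab v ps) ×
      Loop Z (some 0F)
        (embed (0F ∷ 1F ∷ 2F ∷ []) field′ ⨾ embed (0F ∷ 1F ∷ 3F ∷ []) field′ ⨾ body ⨾
         embed (0F ∷ 1F ∷ []) (moveWhile notEor) ⨾ push 1F (λ _ → eor) ⨾ pop 0F ⨾
         embed (2F ∷ []) clear ⨾ embed (3F ∷ []) clear) i
        (tab v ps ∷ t ∷ [] ∷ [] ∷ τ a) ([] ∷ tabʳ v′ ps t ∷ [] ∷ [] ∷ τ (foldl f a ps))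
    rows-loop [] j l l′ = 0 , z≤n , stop refl
    rows-loop ((x , y) ∷ ps) {a} {t} j l l′
      with i , i≤ , rest ← rows-loop ps {t = rowʳ x y (v′ x y) t} (step j) (<⇒≤ (row-rest x {y} {v x y} {tab v ps} l))
          (<⇒≤ (row-rest x {y} {v′ x y} {tab v′ ps} l′)) =
      suc i , ≤-trans (s≤s i≤) more-rows , once (nonempty x)
        (call (0F ∷ 1F ∷ 2F ∷ []) (field-run x lx) ⨾
         call (0F ∷ 1F ∷ 3F ∷ []) (field-run y ly) ⨾
         body-run j ⨾
         call (0F ∷ 1F ∷ []) (moveWhile-run (bits (v′ x y)) (no-eor (v′ x y)) refl
           (≤-trans (≤-reflexive (length-map _ (v′ x y))) (≤-trans (m≤m+n _ _) (row-b x {y} {v′ x y} {tab v′ ps} l′)))) ⨾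
         push ⨾ pop ⨾
         call (2F ∷ []) (clear-run (spellʳ x) (≤-trans (≤-reflexive (length-spellʳ x)) lx)) ⨾
         call (3F ∷ []) (clear-run (spellʳ y) (≤-trans (≤-reflexive (length-spellʳ y)) ly)))
        rest
      where
      lx = row-x x {y} {v x y} {tab v ps} l
      ly = row-y x {y} {v x y} {tab v ps} l
      nonempty : ∀ (x : Word k) {ys} → maybe (λ _ → true) false (head (spell x ++ hash ∷ ys)) ≡ true
      nonempty []      = refl
      nonempty (_ ∷ _) = refl
      more-rows : length (tab v ps) < length (row x y (v x y) (tab v ps))
      more-rows = ≤-trans (≤-trans (m≤n+m _ (length (v x y)))
          (≤-trans (≤-trans (n≤1+n _) (≤-trans (m≤n+m _ (length y)) (n≤1+n _))) (m≤n+m _ (length x))))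
                    (≤-reflexive (sym (length-row x y (v x y) (tab v ps))))

    forRows-run : ∀ ps {a} → J ps a → length (tab v ps) ≤ Z → length (tab v′ ps) ≤ Z →
                  Run Z (forRows body) (tab v ps ∷ [] ∷ [] ∷ [] ∷ τ a)
                        (tab v′ ps ∷ [] ∷ [] ∷ [] ∷ τ (foldl f a ps))
    forRows-run ps j l l′ with i , i≤ , x ← rows-loop ps j l l′ =
      subst (λ u → Run Z (forRows body) _ (u ∷ [] ∷ [] ∷ [] ∷ τ _)) (tabʳ-ʳ v′ ps [])
        (loop x (≤-trans i≤ l) ⨾
         call (1F ∷ 0F ∷ []) (shift-run (tabʳ v′ ps []) (≤-trans
             (≤-reflexive (trans (sym (length-ʳ (tabʳ v′ ps []))) (cong length (tabʳ-ʳ v′ ps [])))) l′)))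

⌊⌋-⇔ : ∀ {A B : Set} (a? : Dec A) (b? : Dec B) → (A → B) → (B → A) → ⌊ a? ⌋ ≡ ⌊ b? ⌋
⌊⌋-⇔ (yes a) (yes b) f g = refl
⌊⌋-⇔ (yes a) (no ¬b) f g = contradiction (f a) ¬b
⌊⌋-⇔ (no ¬a) (yes b) f g = contradiction (g b) ¬a
⌊⌋-⇔ (no ¬a) (no ¬b) f g = refl

⌊⌋-true : ∀ {A : Set} (a? : Dec A) → A → ⌊ a? ⌋ ≡ true
⌊⌋-true (yes _) a = refl
⌊⌋-true (no ¬a) a = contradiction a ¬a

⌊⌋-false : ∀ {A : Set} (a? : Dec A) → ¬ A → ⌊ a? ⌋ ≡ false
⌊⌋-false (yes a) ¬a = contradiction a ¬a
⌊⌋-false (no _)  ¬a = refl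

reverse-injective : ∀ {k} {x y : Word k} → reverse x ≡ reverse y → x ≡ y
reverse-injective {x = x} {y} e = trans (sym (reverse-involutive x)) (trans (cong reverse e) (reverse-involutive y))

-- Comparing words and searching the table

module Tests (k : ℕ) (O : Set) (Z : ℕ) where

  open Programs k O
  open Basics k O Z

  -- Only failure leaves a mark, so two tests can share one stack and their conjunction holds
  -- exactly when no mark is added.
  marks : Bool → Stack → Stack
  marks true  m = m
  marks false m = one ∷ m

  restore : ∀ ts {a b m} →
    Loop Z (some 2F) (push 0F (get 2F) ⨾ push 1F (get 2F) ⨾ pop 2F) (length ts)
         (a ∷ b ∷ ts ∷ m ∷ []) ((ts ʳ++ a) ∷ (ts ʳ++ b) ∷ [] ∷ m ∷ [])
  restore []       = stop refl
  restore (s ∷ ts) = once refl (push ⨾ push ⨾ pop) (restore ts)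

  -- `c` is the common prefix that the first loop removes. It stops at different letters or at the
  -- end of a word, so equality holds exactly when nothing is left on either side.
  EqLoop : Word k → Word k → Set
  EqLoop xs ys = ∃ λ c → ∃ λ xs′ → ∃ λ ys′ → xs ≡ c ++ xs′ × ys ≡ c ++ ys′ ×
    ⌊ xs ≟ʷ ys ⌋ ≡ ⌊ xs′ ≟ʷ ys′ ⌋ ×
    (∀ t m → Run Z (branch (λ ts → some 0F ts ∨ some 1F ts) (mark 3F) skip) (spell xs′ ∷ spell ys′ ∷ t ∷ m ∷ [])
              (spell xs′ ∷ spell ys′ ∷ t ∷ marks ⌊ xs′ ≟ʷ ys′ ⌋ m ∷ [])) ×
    (∀ t m → Loop Z (λ ts → eqTops (lookup ts 0F) (lookup ts 1F)) (push 2F (get 0F) ⨾ pop 0F ⨾ pop 1F) (length c)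
                 (spell xs ∷ spell ys ∷ t ∷ m ∷ []) (spell xs′ ∷ spell ys′ ∷ (spell c ʳ++ t) ∷ m ∷ []))

  eqTest-cons : ∀ {x y xs ys} → Dec (x ≡ y) → EqLoop xs ys → EqLoop (x ∷ xs) (y ∷ ys)
  eqTest-cons {x} {_} {xs} {ys} (yes refl) (c , xs′ , ys′ , e , f , g , r , l) =
    x ∷ c , xs′ , ys′ , cong (x ∷_) e , cong (x ∷_) f ,
    trans (⌊⌋-⇔ ((x ∷ xs) ≟ʷ (x ∷ ys)) (xs ≟ʷ ys) (proj₂ ∘ ∷-injective) (cong (x ∷_))) g , r ,
    λ t m → once (⌊⌋-true (x Fin.≟ x) refl) (push ⨾ pop ⨾ pop) (l (ltr x ∷ t) m)
  eqTest-cons {x} {y} {xs} {ys} (no x≢y) _ =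
    [] , x ∷ xs , y ∷ ys , refl , refl , refl ,
    (λ t m → subst (λ b → Run Z (branch (λ ts → some 0F ts ∨ some 1F ts) (mark 3F) skip)
        (spell (x ∷ xs) ∷ spell (y ∷ ys) ∷ t ∷ m ∷ [])
                                      (spell (x ∷ xs) ∷ spell (y ∷ ys) ∷ t ∷ marks b m ∷ []))
                              (sym (⌊⌋-false ((x ∷ xs) ≟ʷ (y ∷ ys)) (x≢y ∘ proj₁ ∘ ∷-injective))) (on-true refl push)) ,
    λ t m → stop (⌊⌋-false (x Fin.≟ y) x≢y)

  eqTest-loop : ∀ xs ys → EqLoop xs ys
  eqTest-loop []       []       = [] , [] , [] , refl , refl , refl , (λ t m → on-false refl skip) , λ t m → stop refl
  eqTest-loop []       (y ∷ ys) = [] , [] , y ∷ ys , refl , refl , refl , (λ t m → on-true refl push) , λ t m → stop refl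
  eqTest-loop (x ∷ xs) []       = [] , x ∷ xs , [] , refl , refl , refl , (λ t m → on-true refl push) , λ t m → stop refl
  eqTest-loop (x ∷ xs) (y ∷ ys) = eqTest-cons (x Fin.≟ y) (eqTest-loop xs ys)

  eqTest-run : ∀ xs ys {m} → length xs ≤ Z →
    Run Z eqTest (spell xs ∷ spell ys ∷ [] ∷ m ∷ []) (spell xs ∷ spell ys ∷ [] ∷ marks ⌊ xs ≟ʷ ys ⌋ m ∷ [])
  eqTest-run xs ys {m} l with c , xs′ , ys′ , refl , refl , g , r , lp ← eqTest-loop xs ys =
    subst (λ σ → Run Z eqTest (spell (c ++ xs′) ∷ spell (c ++ ys′) ∷ [] ∷ m ∷ []) σ)
      (cong₂ (λ a τ → a ∷ τ) (unspell xs′) (cong₂ (λ b τ → b ∷ [] ∷ τ) (unspell ys′)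
          (cong (λ b → marks b m ∷ []) (sym g))))
      (loop (lp [] m) lc ⨾ r _ m ⨾ loop (restore (spell c ʳ++ []))
          (≤-trans (≤-reflexive (trans (length-ʳ (spell c)) (length-map ltr c))) lc))
    where
    lc : length c ≤ Z
    lc = ≤-trans (m≤m+n _ _) (≤-trans (≤-reflexive (sym (length-++ c))) l)
    unspell : ∀ zs → (spell c ʳ++ []) ʳ++ spell zs ≡ spell (c ++ zs)
    unspell zs = trans (ʳ++-ʳ++ (spell c)) (sym (map-++ ltr c zs))

  eqTest-runʳ : ∀ x y {m} → length x ≤ Z →
    Run Z eqTest (spellʳ x ∷ spellʳ y ∷ [] ∷ m ∷ []) (spellʳ x ∷ spellʳ y ∷ [] ∷ marks ⌊ x ≟ʷ y ⌋ m ∷ [])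
  eqTest-runʳ x y {m} l =
    subst (λ b → Run Z eqTest (spellʳ x ∷ spellʳ y ∷ [] ∷ m ∷ []) (spellʳ x ∷ spellʳ y ∷ [] ∷ marks b m ∷ []))
      (⌊⌋-⇔ (reverse x ≟ʷ reverse y) (x ≟ʷ y) reverse-injective (cong reverse))
      (eqTest-run (reverse x) (reverse y) (≤-trans (≤-reflexive (length-reverse x)) l))

  ones : ℕ → Stack
  ones n = replicate n one

  leqTest-run : ∀ xs n {m} → length xs ≤ Z →
    Run Z leqTest (xs ∷ ones n ∷ [] ∷ m ∷ []) (xs ∷ ones n ∷ [] ∷ marks ⌊ length xs ≤? n ⌋ m ∷ [])
  leqTest-run xs n {m} l = go l
    where
    restore′ : ∀ ts {a i m} →
      Loop Z (some 2F) (push 0F (get 2F) ⨾ mark 1F ⨾ pop 2F) (length ts)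
           (a ∷ ones i ∷ ts ∷ m ∷ []) ((ts ʳ++ a) ∷ ones (length ts + i) ∷ [] ∷ m ∷ [])
    restore′ [] = stop refl
    restore′ (s ∷ ts) {a} {i} {m} = once refl (push ⨾ push ⨾ pop)
      (subst (λ j → Loop Z (some 2F) (push 0F (get 2F) ⨾ mark 1F ⨾ pop 2F) (length ts)
          ((s ∷ a) ∷ ones (suc i) ∷ ts ∷ m ∷ [])
                         ((ts ʳ++ (s ∷ a)) ∷ ones j ∷ [] ∷ m ∷ []))
             (+-suc (length ts) i) (restore′ ts {s ∷ a} {suc i}))
    pairs : ∀ xs n t {m} → ∃ λ i → ∃ λ xs′ → ∃ λ n′ → ∃ λ t′ →
      i ≤ length xs × length t′ ≤ length t + length xs × t′ ʳ++ xs′ ≡ t ʳ++ xs × length t′ + n′ ≡ length t + n ×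
      Loop Z (λ ts → some 0F ts ∧ some 1F ts) (push 2F (get 0F) ⨾ pop 0F ⨾ pop 1F) i
           (xs ∷ ones n ∷ t ∷ m ∷ []) (xs′ ∷ ones n′ ∷ t′ ∷ m ∷ []) ×
      Run Z (branch (some 0F) (mark 3F) skip) (xs′ ∷ ones n′ ∷ t′ ∷ m ∷ [])
          (xs′ ∷ ones n′ ∷ t′ ∷ marks ⌊ length xs ≤? n ⌋ m ∷ [])
    pairs []       n       t = 0 , [] , n , t , z≤n , ≤-reflexive (sym (+-identityʳ _)) , refl , refl , stop refl ,
        on-false refl skip
    pairs (x ∷ xs) zero    t = 0 , x ∷ xs , 0 , t , z≤n , m≤m+n _ _ , refl , refl , stop refl , on-true refl push
    pairs (x ∷ xs) (suc n) t {m}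
      with i , xs′ , n′ , t′ , l , l′ , e , f , lp , r ← pairs xs n (x ∷ t) {m} =
      suc i , xs′ , n′ , t′ , s≤s l , ≤-trans l′ (≤-reflexive (sym (+-suc _ _))) , e , trans f (sym (+-suc _ _)) ,
      once refl (push ⨾ pop ⨾ pop) lp ,
      subst (λ b → Run Z (branch (some 0F) (mark 3F) skip) (xs′ ∷ ones n′ ∷ t′ ∷ m ∷ [])
          (xs′ ∷ ones n′ ∷ t′ ∷ marks b m ∷ []))
        (⌊⌋-⇔ (length xs ≤? n) (suc (length xs) ≤? suc n) s≤s (λ { (s≤s h) → h })) r
    go : length xs ≤ Z →
      Run Z leqTest (xs ∷ ones n ∷ [] ∷ m ∷ []) (xs ∷ ones n ∷ [] ∷ marks ⌊ length xs ≤? n ⌋ m ∷ [])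
    go l with i , xs′ , n′ , t′ , li , lt , e , f , lp , r ← pairs xs n [] {m} =
      subst₂ (λ a j → Run Z leqTest (xs ∷ ones n ∷ [] ∷ m ∷ []) (a ∷ ones j ∷ [] ∷ marks ⌊ length xs ≤? n ⌋ m ∷ [])) e f
        (loop lp (≤-trans li l) ⨾ r ⨾ loop (restore′ t′) (≤-trans lt l))

  topOf : List Bool → Bool
  topOf = fromMaybe false ∘ head

  top-bits : ∀ bs {rest} → maybe isTrue false (head (bits bs ++ eor ∷ rest)) ≡ topOf bs
  top-bits []       = refl
  top-bits (b ∷ bs) = refl

  hit-run : ∀ bs {rest} e₁ e₂ {f F} → 2 ≤ Z →
    Run Z hit ((bits bs ++ eor ∷ rest) ∷ marks e₂ (marks e₁ []) ∷ (bit f ∷ F) ∷ [])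
              ((bits bs ++ eor ∷ rest) ∷ [] ∷ (bit (f ∨ ((e₁ ∧ e₂) ∧ topOf bs)) ∷ F) ∷ [])
  hit-run bs {rest} e₁ e₂ {f} {F} 2≤Z with topOf bs | top-bits bs {rest}
  hit-run bs true  true  {true} 2≤Z  | true  | e = on-true (cong (_∧ true) e) (pop ⨾ push) ⨾ call (1F ∷ [])
      (clear-run [] z≤n)
  hit-run bs true  true  {false} 2≤Z | true  | e = on-true (cong (_∧ true) e) (pop ⨾ push) ⨾ call (1F ∷ [])
      (clear-run [] z≤n)
  hit-run bs true  true  {true} 2≤Z  | false | e = on-false (cong (_∧ true) e) skip ⨾ call (1F ∷ []) (clear-run [] z≤n)
  hit-run bs true  true  {false} 2≤Z | false | e = on-false (cong (_∧ true) e) skip ⨾ call (1F ∷ []) (clear-run [] z≤n)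
  hit-run bs true false {f} 2≤Z | t | e rewrite ∨-identityʳ f =
    on-false (∧-zeroʳ _) skip ⨾ call (1F ∷ []) (clear-run (one ∷ []) (≤-trans (s≤s z≤n) 2≤Z))
  hit-run bs false true {f} 2≤Z | t | e rewrite ∨-identityʳ f =
    on-false (∧-zeroʳ _) skip ⨾ call (1F ∷ []) (clear-run (one ∷ []) (≤-trans (s≤s z≤n) 2≤Z))
  hit-run bs false false {f} 2≤Z | t | e rewrite ∨-identityʳ f =
    on-false (∧-zeroʳ _) skip ⨾ call (1F ∷ []) (clear-run (one ∷ one ∷ []) 2≤Z)

  Short : Pairs → Set
  Short = All (λ (x , y) → length x ≤ Z × length y ≤ Z)

  found : (Word k → Word k → Bool) → (Word k → Word k → Bool) → Bool → Pairs → Bool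
  found v c = foldl (λ b (x , y) → b ∨ (c x y ∧ v x y))

  module _ (2≤Z : 2 ≤ Z) where

    look-run : ∀ (v : Value) ps p q {F} → Short ps → length (tab v ps) ≤ Z →
      Run Z look (tab v ps ∷ [] ∷ [] ∷ [] ∷ spellʳ p ∷ spellʳ q ∷ [] ∷ [] ∷ F ∷ [])
                 (tab v ps ∷ [] ∷ [] ∷ [] ∷ spellʳ p ∷ spellʳ q ∷ [] ∷ [] ∷
                  (bit (found (λ x y → topOf (v x y)) (λ x y → ⌊ x ≟ʷ p ⌋ ∧ ⌊ y ≟ʷ q ⌋) false ps) ∷ F) ∷ [])
    look-run v ps p q {F} s l = push ⨾
      forRows-run (λ b → spellʳ p ∷ spellʳ q ∷ [] ∷ [] ∷ (bit b ∷ F) ∷ [])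
        (λ b (x , y) → b ∨ ((⌊ x ≟ʷ p ⌋ ∧ ⌊ y ≟ʷ q ⌋) ∧ topOf (v x y)))
        (λ ps _ → Short ps)
        (λ { {x} {y} ((lx , ly) ∷ _) →
          call (2F ∷ 4F ∷ 6F ∷ 7F ∷ []) (eqTest-runʳ x p lx) ⨾
          call (3F ∷ 5F ∷ 6F ∷ 7F ∷ []) (eqTest-runʳ y q ly) ⨾
          call (0F ∷ 7F ∷ 8F ∷ []) (hit-run (v x y) ⌊ x ≟ʷ p ⌋ ⌊ y ≟ʷ q ⌋ 2≤Z) })
        (λ { (_ ∷ s) → s }) ps s l l

    matches : Fin 2 → Word k → ℕ → Word k → Word k → Bool
    matches 0F w n x y = ⌊ y ≟ʷ w ⌋ ∧ ⌊ length x ≤? n ⌋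
    matches 1F w n x y = ⌊ x ≟ʷ w ⌋ ∧ ⌊ length y ≤? n ⌋

    leqTest-runʳ : ∀ x n {m} → length x ≤ Z →
      Run Z leqTest (spellʳ x ∷ ones n ∷ [] ∷ m ∷ []) (spellʳ x ∷ ones n ∷ [] ∷ marks ⌊ length x ≤? n ⌋ m ∷ [])
    leqTest-runʳ x n {m} l =
      subst (λ i → Run Z leqTest (spellʳ x ∷ ones n ∷ [] ∷ m ∷ []) (spellʳ x ∷ ones n ∷ [] ∷ marks ⌊ i ≤? n ⌋ m ∷ []))
        (length-spellʳ x) (leqTest-run (spellʳ x) n (≤-trans (≤-reflexive (length-spellʳ x)) l))

    someRow-run : ∀ d (v : Value) ps w n {F} → Short ps → length (tab v ps) ≤ Z →
      Run Z (someRow d) (tab v ps ∷ [] ∷ [] ∷ [] ∷ spellʳ w ∷ ones n ∷ [] ∷ [] ∷ F ∷ [])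
                 (tab v ps ∷ [] ∷ [] ∷ [] ∷ spellʳ w ∷ ones n ∷ [] ∷ [] ∷
                  (bit (found (λ x y → topOf (v x y)) (matches d w n) false ps) ∷ F) ∷ [])
    someRow-run 0F v ps w n {F} s l = push ⨾
      forRows-run (λ b → spellʳ w ∷ ones n ∷ [] ∷ [] ∷ (bit b ∷ F) ∷ [])
        (λ b (x , y) → b ∨ (matches 0F w n x y ∧ topOf (v x y)))
        (λ ps _ → Short ps)
        (λ { {x} {y} ((lx , ly) ∷ _) →
          call (3F ∷ 4F ∷ 6F ∷ 7F ∷ []) (eqTest-runʳ y w ly) ⨾
          call (2F ∷ 5F ∷ 6F ∷ 7F ∷ []) (leqTest-runʳ x n lx) ⨾
          call (0F ∷ 7F ∷ 8F ∷ []) (hit-run (v x y) ⌊ y ≟ʷ w ⌋ ⌊ length x ≤? n ⌋ 2≤Z) })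
        (λ { (_ ∷ s) → s }) ps s l l
    someRow-run 1F v ps w n {F} s l = push ⨾
      forRows-run (λ b → spellʳ w ∷ ones n ∷ [] ∷ [] ∷ (bit b ∷ F) ∷ [])
        (λ b (x , y) → b ∨ (matches 1F w n x y ∧ topOf (v x y)))
        (λ ps _ → Short ps)
        (λ { {x} {y} ((lx , ly) ∷ _) →
          call (2F ∷ 4F ∷ 6F ∷ 7F ∷ []) (eqTest-runʳ x w lx) ⨾
          call (3F ∷ 5F ∷ 6F ∷ 7F ∷ []) (leqTest-runʳ y n ly) ⨾
          call (0F ∷ 7F ∷ 8F ∷ []) (hit-run (v x y) ⌊ x ≟ʷ w ⌋ ⌊ length y ≤? n ⌋ 2≤Z) })
        (λ { (_ ∷ s) → s }) ps s l l

-- Terms and the subword test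

module Terms (k : ℕ) (O : Set) (Z : ℕ) where

  open Programs k O
  open Basics k O Z
  open Tests k O Z

  -- Greedy matching: the first letter of `xs` is cancelled against its first occurrence in `ys`,
  -- which never hurts, so `xs` is a subword exactly when all of it is consumed.
  SubLoop : Word k → Word k → Set
  SubLoop xs ys = ∃ λ i → ∃ λ xs′ → ∃ λ ys′ → i ≤ length ys × length xs′ ≤ length xs × length ys′ ≤ length ys ×
    not (maybe (λ _ → true) false (head (spell xs′))) ≡ ⌊ xs ⊑? ys ⌋ ×
    (∀ F → Loop Z (λ ts → some 0F ts ∧ some 1F ts) (branch (λ ts → eqTops (lookup ts 0F) (lookup ts 1F)) (pop 0F) skip
        ⨾ pop 1F)
             i (spell xs ∷ spell ys ∷ F ∷ []) (spell xs′ ∷ spell ys′ ∷ F ∷ []))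

  subLoop-cons : ∀ {x y xs ys} → Dec (x ≡ y) → SubLoop xs ys → SubLoop (x ∷ xs) ys → SubLoop (x ∷ xs) (y ∷ ys)
  subLoop-cons {x} {_} {xs} {ys} (yes refl) (i , xs′ , ys′ , l , lx , ly , e , lp) _ =
    suc i , xs′ , ys′ , s≤s l , m≤n⇒m≤1+n lx , m≤n⇒m≤1+n ly ,
    trans e (⌊⌋-⇔ (xs ⊑? ys) ((x ∷ xs) ⊑? (x ∷ ys)) (refl ∷_) ∷⁻) ,
    λ F → once refl (on-true (⌊⌋-true (x Fin.≟ x) refl) pop ⨾ pop) (lp F)
  subLoop-cons {x} {y} {xs} {ys} (no x≢y) _ (i , xs′ , ys′ , l , lx , ly , e , lp) =
    suc i , xs′ , ys′ , s≤s l , lx , m≤n⇒m≤1+n ly ,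
    trans e (⌊⌋-⇔ ((x ∷ xs) ⊑? ys) ((x ∷ xs) ⊑? (y ∷ ys)) (y ∷ʳ_) (∷≢⁻ x≢y)) ,
    λ F → once refl (on-false (⌊⌋-false (x Fin.≟ y) x≢y) skip ⨾ pop) (lp F)

  subLoop : ∀ xs ys → SubLoop xs ys
  subLoop []       ys       = 0 , [] , ys , z≤n , z≤n , ≤-refl , sym (⌊⌋-true ([] ⊑? ys) (minimum ys)) , λ F → stop refl
  subLoop (x ∷ xs) []       = 0 , x ∷ xs , [] , z≤n , ≤-refl , z≤n , sym (⌊⌋-false ((x ∷ xs) ⊑? []) λ ()) , λ F → stop
      refl
  subLoop (x ∷ xs) (y ∷ ys) = subLoop-cons (x Fin.≟ y) (subLoop xs ys) (subLoop (x ∷ xs) ys)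

  subTest-run : ∀ xs ys {F} → length xs ≤ Z → length ys ≤ Z →
    Run Z subTest (spell xs ∷ spell ys ∷ F ∷ []) ([] ∷ [] ∷ (bit ⌊ xs ⊑? ys ⌋ ∷ F) ∷ [])
  subTest-run xs ys {F} l l′ with i , xs′ , ys′ , li , lx , ly , e , lp ← subLoop xs ys =
    subst (λ b → Run Z subTest (spell xs ∷ spell ys ∷ F ∷ []) ([] ∷ [] ∷ (bit b ∷ F) ∷ [])) e
      (loop (lp F) (≤-trans li l′) ⨾ push ⨾
       call (0F ∷ []) (clear-run (spell xs′) (≤-trans (≤-reflexive (length-map ltr xs′)) (≤-trans lx l))) ⨾
       call (1F ∷ []) (clear-run (spell ys′) (≤-trans (≤-reflexive (length-map ltr ys′)) (≤-trans ly l′))))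

  subTest-runʳ : ∀ x y {F} → length x ≤ Z → length y ≤ Z →
    Run Z subTest (spellʳ x ∷ spellʳ y ∷ F ∷ []) ([] ∷ [] ∷ (bit ⌊ x ⊑? y ⌋ ∷ F) ∷ [])
  subTest-runʳ x y {F} l l′ =
    subst (λ b → Run Z subTest (spellʳ x ∷ spellʳ y ∷ F ∷ []) ([] ∷ [] ∷ (bit b ∷ F) ∷ []))
      (⌊⌋-⇔ (reverse x ⊑? reverse y) (x ⊑? y) reverse⁻ reverse⁺)
      (subTest-run (reverse x) (reverse y) (≤-trans (≤-reflexive (length-reverse x)) l)
          (≤-trans (≤-reflexive (length-reverse y)) l′))

  term : Term k 2 → Stack
  term s = map inp (encodeTerm s)

  letterSymbols : Word k → Stack
  letterSymbols = map (λ a → inp (letter a))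

  letters-loop : ∀ u {p p′ rx ry t a} →
    Loop Z (is isLetterSymbol 0F) (push 5F (λ ts → toLetter (get 0F ts)) ⨾ next′) (length u)
         ((letterSymbols u ++ inp `⟩ ∷ p) ∷ p′ ∷ rx ∷ ry ∷ t ∷ a ∷ [])
         ((inp `⟩ ∷ p) ∷ (letterSymbols u ʳ++ p′) ∷ rx ∷ ry ∷ t ∷ (spell u ʳ++ a) ∷ [])
  letters-loop []      = stop refl
  letters-loop (x ∷ u) = once refl (push ⨾ push ⨾ pop) (letters-loop u)

  term-const : ∀ u {p} → term (const u) ++ p ≡ inp `⟨ ∷ letterSymbols u ++ inp `⟩ ∷ p
  term-const u {p} = cong (inp `⟨ ∷_) (trans (cong (_++ p) (trans (map-++ inp (map letter u) (`⟩ ∷ []))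
      (cong (_++ inp `⟩ ∷ []) (sym (symbols u)))))
                       (++-assoc (letterSymbols u) (inp `⟩ ∷ []) p))
    where
    symbols : ∀ u → letterSymbols u ≡ map inp (map letter u)
    symbols []      = refl
    symbols (a ∷ u) = cong (_ ∷_) (symbols u)

  term-const-ʳ : ∀ u {p} → term (const u) ʳ++ p ≡ inp `⟩ ∷ (letterSymbols u ʳ++ (inp `⟨ ∷ p))
  term-const-ʳ u {p} = trans (cong (_ʳ++ p) (trans (sym (++-identityʳ (term (const u)))) (term-const u)))
                             (++-ʳ++ (letterSymbols u))

  load-run : ∀ s {p p′ x y} → length x ≤ Z → length y ≤ Z → termSize s ≤ Z →
    Run Z load ((term s ++ p) ∷ p′ ∷ spellʳ x ∷ spellʳ y ∷ [] ∷ [] ∷ [])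
               (p ∷ (term s ʳ++ p′) ∷ spellʳ x ∷ spellʳ y ∷ [] ∷ spellʳ (⟦ s ⟧ (x ∷ y ∷ [])) ∷ [])
  load-run (var 0F) {x = x} {y} lx ly _ = on-true refl ((push ⨾ pop) ⨾ call (2F ∷ 4F ∷ 5F ∷ [])
      (copy-fresh (spellʳ x) (≤-trans (≤-reflexive (length-spellʳ x)) lx)))
  load-run (var 1F) {x = x} {y} lx ly _ = on-false refl
      (on-true refl ((push ⨾ pop) ⨾ call (3F ∷ 4F ∷ 5F ∷ [])
      (copy-fresh (spellʳ y) (≤-trans (≤-reflexive (length-spellʳ y)) ly))))
  load-run (const u) {p} {p′} {x} {y} lx ly lu =
    subst₂ (λ a (b , c) → Run Z load (a ∷ p′ ∷ spellʳ x ∷ spellʳ y ∷ [] ∷ [] ∷ [])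
        (p ∷ b ∷ spellʳ x ∷ spellʳ y ∷ [] ∷ c ∷ []))
      (sym (term-const u)) (cong₂ _,_ (sym (term-const-ʳ u)) (spell-ʳ u))
      (on-false refl (on-false refl ((push ⨾ pop) ⨾ loop (letters-loop u) lu ⨾ (push ⨾ pop))))

-- Evaluation of a formula on the table

module Evaluation (k : ℕ) (O : Set) (Z : ℕ) (2≤Z : 2 ≤ Z)
                  (ps : List (Word k × Word k)) (short : All (λ (x , y) → length x ≤ Z × length y ≤ Z) ps)
                  (H : ℕ) (H≤Z : H ≤ Z)
                  (tab≤ : ∀ (w : Word k → Word k → List Bool) → (∀ x y → length (w x y) ≤ H) → length
                      (Basics.tab k O Z w ps) ≤ Z)
                  (g : ℕ) (g≤Z : g ≤ Z) where

  open Programs k O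
  open Basics k O Z
  open Tests k O Z
  open Terms k O Z

  infixr 5 _◂_
  _◂_ : (Word k → Word k → Bool) → Value → Value
  (b ◂ w) x y = b x y ∷ w x y

  -- `h` is the room left for stacking truth values in a row; the size of a subformula is enough
  -- room for evaluating it.
  Fits : ℕ → Value → Set
  Fits h w = ∀ x y → length (w x y) + h ≤ H

  fits : ∀ {h w} → Fits h w → length (tab w ps) ≤ Z
  fits {w = w} f = tab≤ w (λ x y → ≤-trans (m≤m+n _ _) (f x y))

  setTop-run : ∀ {s r T F} → Run Z setTop ((s ∷ T) ∷ (r ∷ F) ∷ []) ((r ∷ T) ∷ F ∷ [])
  setTop-run = pop ⨾ push ⨾ pop

  forRows⊤ : ∀ {m} {σ : Vec Stack m} {v v′ : Value} {body} →
    (∀ {x y rest t} → length x ≤ Z → length y ≤ Z →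
      Run Z body ((bits (v x y) ++ eor ∷ rest) ∷ t ∷ spellʳ x ∷ spellʳ y ∷ σ)
                 ((bits (v′ x y) ++ eor ∷ rest) ∷ t ∷ spellʳ x ∷ spellʳ y ∷ σ)) →
    length (tab v ps) ≤ Z → length (tab v′ ps) ≤ Z →
    Run Z (forRows body) (tab v ps ∷ [] ∷ [] ∷ [] ∷ σ) (tab v′ ps ∷ [] ∷ [] ∷ [] ∷ σ)
  forRows⊤ {σ = σ} h = forRows-run {A = ⊤} (λ _ → σ) (λ _ _ → tt) (λ qs _ → Short qs)
    (λ { ((lx , ly) ∷ _) → h lx ly }) (λ { (_ ∷ s) → s }) ps short

  negRow-run : ∀ {b w h} → Fits h (b ◂ w) →
    Run Z (forRows negRow) (tab (b ◂ w) ps ∷ [] ∷ [] ∷ [] ∷ [] ∷ [])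
                           (tab ((λ x y → not (b x y)) ◂ w) ps ∷ [] ∷ [] ∷ [] ∷ [] ∷ [])
  negRow-run {b} {w} {h} f = forRows⊤ {v = b ◂ w} {v′ = (λ x y → not (b x y)) ◂ w}
    (λ lx ly → push ⨾ call (0F ∷ 4F ∷ []) setTop-run) (fits {h} {b ◂ w} f) (fits {h} {(λ x y → not (b x y)) ◂ w} f)

  binRow-run : ∀ op {b b′ w h} → Fits h (b ◂ b′ ◂ w) →
    Run Z (forRows (binRow op)) (tab (b ◂ b′ ◂ w) ps ∷ [] ∷ [] ∷ [] ∷ [] ∷ [])
                                (tab ((λ x y → op (b x y) (b′ x y)) ◂ w) ps ∷ [] ∷ [] ∷ [] ∷ [] ∷ [])
  binRow-run op {b} {b′} {w} {h} f = forRows⊤ {v = b ◂ b′ ◂ w} {v′ = (λ x y → op (b x y) (b′ x y)) ◂ w}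
    (λ lx ly → push ⨾ pop ⨾ push ⨾ call (0F ∷ 4F ∷ []) setTop-run ⨾ pop)
    (fits {h} {b ◂ b′ ◂ w} f) (fits {h} {(λ x y → op (b x y) (b′ x y)) ◂ w} (λ x y → ≤-trans (n≤1+n _) (f x y)))

  atomRow-run : ∀ s t {w h} → Fits (suc h) w → termSize s ≤ Z → termSize t ≤ Z → length (term s) + length (term t) ≤ Z →
    Run Z (forRows atomRow) (tab w ps ∷ [] ∷ [] ∷ [] ∷ (term s ++ term t) ∷ [] ∷ [] ∷ [] ∷ [] ∷ [] ∷ [])
      (tab ((λ x y → ⌊ ⟦ s ⟧ (x ∷ y ∷ []) ⊑? ⟦ t ⟧ (x ∷ y ∷ []) ⌋) ◂ w) ps ∷ [] ∷ [] ∷ [] ∷ (term s ++ term t) ∷ [] ∷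
          [] ∷ [] ∷ [] ∷ [] ∷ [])
  atomRow-run s t {w} {h} f ls lt l = forRows⊤ {v = w} {v′ = b ◂ w} body (fits {suc h} {w} f)
    (fits {h} {b ◂ w} (λ x y → ≤-trans (≤-reflexive (sym (+-suc _ _))) (f x y)))
    where
    b : Word k → Word k → Bool
    b x y = ⌊ ⟦ s ⟧ (x ∷ y ∷ []) ⊑? ⟦ t ⟧ (x ∷ y ∷ []) ⌋
    value≤ : ∀ s {x y : Word k} → length x ≤ Z → length y ≤ Z → termSize s ≤ Z → length (⟦ s ⟧ (x ∷ y ∷ [])) ≤ Z
    value≤ (var 0F)  lx ly _ = lx
    value≤ (var 1F)  lx ly _ = ly
    value≤ (const u) lx ly l = l
    tt≡ : term t ++ [] ≡ term t
    tt≡ = ++-identityʳ (term t)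
    back : (term t ʳ++ (term s ʳ++ [])) ʳ++ [] ≡ term s ++ term t
    back = trans (ʳ++-ʳ++ (term t)) (trans (ʳ++-ʳ++ (term s)) (cong (term s ++_) tt≡))
    back≤ : length (term t ʳ++ (term s ʳ++ [])) ≤ Z
    back≤ = ≤-trans (≤-reflexive (trans (sym (length-ʳ (term t ʳ++ (term s ʳ++ []))))
        (trans (cong length back) (length-++ (term s))))) l
    body : ∀ {x y rest t′} → length x ≤ Z → length y ≤ Z →
      Run Z atomRow ((bits (w x y) ++ eor ∷ rest) ∷ t′ ∷ spellʳ x ∷ spellʳ y ∷ (term s ++ term t) ∷ [] ∷ [] ∷ [] ∷ []
          ∷ [] ∷ [])
                    ((bits ((b ◂ w) x y) ++ eor ∷ rest) ∷ t′ ∷ spellʳ x ∷ spellʳ y ∷ (term s ++ term t) ∷ [] ∷ [] ∷ []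
                        ∷ [] ∷ [] ∷ [])
    body {x} {y} {rest} {t′} lx ly =
      subst₂ (λ u v → Run Z atomRow ((bits (w x y) ++ eor ∷ rest) ∷ t′ ∷ spellʳ x ∷ spellʳ y ∷ (term s ++ u) ∷ [] ∷ []
          ∷ [] ∷ [] ∷ [] ∷ [])
                    ((bits ((b ◂ w) x y) ++ eor ∷ rest) ∷ t′ ∷ spellʳ x ∷ spellʳ y ∷ v ∷ [] ∷ [] ∷ [] ∷ [] ∷ [] ∷ []))
        tt≡ back
        (call (4F ∷ 5F ∷ 2F ∷ 3F ∷ 8F ∷ 6F ∷ []) (load-run s lx ly ls) ⨾
         call (4F ∷ 5F ∷ 2F ∷ 3F ∷ 8F ∷ 7F ∷ []) (load-run t lx ly lt) ⨾
         call (6F ∷ 7F ∷ 9F ∷ []) (subTest-runʳ (⟦ s ⟧ (x ∷ y ∷ [])) (⟦ t ⟧ (x ∷ y ∷ [])) (value≤ s lx ly ls)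
             (value≤ t lx ly lt)) ⨾
         push ⨾ pop ⨾
         call (5F ∷ 4F ∷ []) (shift-run (term t ʳ++ (term s ʳ++ [])) back≤))

  fixed : Fin 2 → Word k → Word k → Word k
  fixed 0F x y = y
  fixed 1F x y = x

  someBit : Fin 2 → ℕ → (Word k → Word k → Bool) → Word k → Word k → Bool
  someBit d i b x y = found b (matches 2≤Z d (fixed d x y) i) false ps

  existsTable-run : ∀ d i {b w h} → Fits h (b ◂ w) →
    Run Z (existsTable d) (tab (b ◂ w) ps ∷ [] ∷ [] ∷ [] ∷ [] ∷ [] ∷ [] ∷ [] ∷ [] ∷ [] ∷ [] ∷ ones i ∷ [])
                          (tab (someBit d i b ◂ w) ps ∷ [] ∷ [] ∷ [] ∷ [] ∷ [] ∷ [] ∷ [] ∷ [] ∷ [] ∷ [] ∷ ones i ∷ [])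
  existsTable-run d i {b} {w} {h} f =
    call (0F ∷ 1F ∷ 4F ∷ []) (copy-fresh tbl lf)
      ⨾⟨ tbl ∷ [] ∷ [] ∷ [] ∷ tbl ∷ [] ∷ [] ∷ [] ∷ [] ∷ [] ∷ [] ∷ ones i ∷ [] ⟩
    forRows⊤ {v = b ◂ w} {v′ = someBit d i b ◂ w} (λ {x} {y} _ _ → body d {x} {y}) lf (fits {h} {someBit d i b ◂ w} f)
      ⨾⟨ tab (someBit d i b ◂ w) ps ∷ [] ∷ [] ∷ [] ∷ tbl ∷ [] ∷ [] ∷ [] ∷ [] ∷ [] ∷ [] ∷ ones i ∷ [] ⟩
    call (4F ∷ []) (clear-run tbl lf)
    where
    tbl = tab (b ◂ w) ps
    lf = fits {h} {b ◂ w} f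
    rowStore : Stack → Stack → Word k → Word k → Stack → Store Σ′ 12
    rowStore R t x y F = R ∷ t ∷ spellʳ x ∷ spellʳ y ∷ tbl ∷ [] ∷ [] ∷ [] ∷ [] ∷ [] ∷ F ∷ ones i ∷ []
    body : ∀ d {x y rest t} →
      Run Z (existsRow d) (rowStore (bits ((b ◂ w) x y) ++ eor ∷ rest) t x y [])
                          (rowStore (bits ((someBit d i b ◂ w) x y) ++ eor ∷ rest) t x y [])
    body 0F {x} {y} {rest} {t} =
      call (4F ∷ 5F ∷ 6F ∷ 7F ∷ 3F ∷ # 11 ∷ 8F ∷ 9F ∷ # 10 ∷ []) (someRow-run 2≤Z 0F (b ◂ w) ps y i short lf)
        ⨾⟨ rowStore (bits ((b ◂ w) x y) ++ eor ∷ rest) t x y (bit (someBit 0F i b x y) ∷ []) ⟩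
      call (0F ∷ # 10 ∷ []) setTop-run
    body 1F {x} {y} {rest} {t} =
      call (4F ∷ 5F ∷ 6F ∷ 7F ∷ 2F ∷ # 11 ∷ 8F ∷ 9F ∷ # 10 ∷ []) (someRow-run 2≤Z 1F (b ◂ w) ps x i short lf)
        ⨾⟨ rowStore (bits ((b ◂ w) x y) ++ eor ∷ rest) t x y (bit (someBit 1F i b x y) ∷ []) ⟩
      call (0F ∷ # 10 ∷ []) setTop-run

  -- The truth values in the table are reliable for words up to a certain length,
  -- which is kept in the register M; a quantifier lowers it by g.
  after : FO k 2 → ℕ → ℕ
  after (s ⊑′ t) n = n
  after (¬′ φ)   n = after φ n
  after (φ ∧′ ψ) n = after φ (after ψ n)
  after (φ ∨′ ψ) n = after φ (after ψ n)
  after (φ ⇒′ ψ) n = after φ (after ψ n)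
  after (∃′ v φ) n = after φ n ∸ g
  after (∀′ v φ) n = after φ n ∸ g

  -- This is what the machine computes, wrong entries near the edge included; agreement with the
  -- truth is shown separately. The right operand is evaluated first, so the left one starts from
  -- the level that the right one leaves.
  value : FO k 2 → ℕ → Word k → Word k → Bool
  value (s ⊑′ t) n x y = ⌊ ⟦ s ⟧ (x ∷ y ∷ []) ⊑? ⟦ t ⟧ (x ∷ y ∷ []) ⌋
  value (¬′ φ)   n x y = not (value φ n x y)
  value (φ ∧′ ψ) n x y = value φ (after ψ n) x y ∧ value ψ n x y
  value (φ ∨′ ψ) n x y = value φ (after ψ n) x y ∨ value ψ n x y
  value (φ ⇒′ ψ) n x y = implies (value φ (after ψ n) x y) (value ψ n x y)
  value (∃′ v φ) n x y = someBit v (after φ n) (value φ n) x y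
  value (∀′ v φ) n x y = not (someBit v (after φ n) (λ x y → not (value φ n x y)) x y)

  state : Value → ℕ → Stack → Stack → Store Σ′ 16
  state w n p r = tab w ps ∷ [] ∷ [] ∷ [] ∷ [] ∷ [] ∷ [] ∷ [] ∷ [] ∷ [] ∷ [] ∷ ones n ∷ p ∷ [] ∷ r ∷ ones g ∷ []

  subtract-run : ∀ n → Run Z subtract (ones g ∷ [] ∷ ones n ∷ []) (ones g ∷ [] ∷ ones (n ∸ g) ∷ [])
  subtract-run n =
    subst (λ u → Run Z subtract (ones g ∷ [] ∷ ones n ∷ []) (u ∷ [] ∷ ones (n ∸ g) ∷ []))
      (trans (ʳ++-ʳ++ (ones g)) (++-identityʳ (ones g)))
      (loop (go g n) g≤Z ⨾ call (1F ∷ 0F ∷ []) (shift-run (ones g ʳ++ [])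
          (≤-trans (≤-reflexive (trans (length-ʳ (ones g)) (length-replicate g))) g≤Z)))
    where
    go : ∀ i n {t} → Loop Z (some 0F) (push 1F (get 0F) ⨾ pop 0F ⨾ pop 2F) i (ones i ∷ t ∷ ones n ∷ [])
        ([] ∷ (ones i ʳ++ t) ∷ ones (n ∸ i) ∷ [])
    go zero    n       = stop refl
    go (suc i) zero {t} = once refl (push ⨾ pop ⨾ pop)
      (subst (λ j → Loop Z (some 0F) (push 1F (get 0F) ⨾ pop 0F ⨾ pop 2F) i (ones i ∷ (one ∷ t) ∷ [] ∷ [])
          ([] ∷ (ones i ʳ++ (one ∷ t)) ∷ ones j ∷ [])) (0∸n≡0 i) (go i 0))
    go (suc i) (suc n) = once refl (push ⨾ pop ⨾ pop) (go i n)

  quant-run : ∀ d n {b w h r} → Fits h (b ◂ w) →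
    Run Z quantTable (state (b ◂ w) n (inp (var d) ∷ []) r) (state (someBit d n b ◂ w) (n ∸ g) [] r)
  quant-run 0F n {b} {w} {h} {r} f =
    on-true refl (call (0F ∷ 1F ∷ 2F ∷ 3F ∷ 4F ∷ 5F ∷ 6F ∷ 7F ∷ 8F ∷ 9F ∷ # 10 ∷ # 11 ∷ [])
        (existsTable-run 0F n {b} {w} {h} f))
      ⨾⟨ state (someBit 0F n b ◂ w) n (inp (var 0F) ∷ []) r ⟩
    call (# 15 ∷ 8F ∷ # 11 ∷ []) (subtract-run n)
      ⨾⟨ state (someBit 0F n b ◂ w) (n ∸ g) (inp (var 0F) ∷ []) r ⟩
    call (# 12 ∷ []) (clear-run (inp (var 0F) ∷ []) (≤-trans (s≤s z≤n) 2≤Z))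
  quant-run 1F n {b} {w} {h} {r} f =
    on-false refl (call (0F ∷ 1F ∷ 2F ∷ 3F ∷ 4F ∷ 5F ∷ 6F ∷ 7F ∷ 8F ∷ 9F ∷ # 10 ∷ # 11 ∷ [])
        (existsTable-run 1F n {b} {w} {h} f))
      ⨾⟨ state (someBit 1F n b ◂ w) n (inp (var 1F) ∷ []) r ⟩
    call (# 15 ∷ 8F ∷ # 11 ∷ []) (subtract-run n)
      ⨾⟨ state (someBit 1F n b ◂ w) (n ∸ g) (inp (var 1F) ∷ []) r ⟩
    call (# 12 ∷ []) (clear-run (inp (var 1F) ∷ []) (≤-trans (s≤s z≤n) 2≤Z))

  neg-run : ∀ {b w h n p r} → Fits h (b ◂ w) → Run Z negTable (state (b ◂ w) n p r)
      (state ((λ x y → not (b x y)) ◂ w) n p r)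
  neg-run {b} {w} {h} f = call (0F ∷ 1F ∷ 2F ∷ 3F ∷ # 10 ∷ []) (negRow-run {b} {w} {h} f)

  bin-run : ∀ op {b b′ w h n p r} → Fits h (b ◂ b′ ◂ w) →
            Run Z (binTable op) (state (b ◂ b′ ◂ w) n p r) (state ((λ x y → op (b x y) (b′ x y)) ◂ w) n p r)
  bin-run op {b} {b′} {w} {h} f = call (0F ∷ 1F ∷ 2F ∷ 3F ∷ # 10 ∷ []) (binRow-run op {b} {b′} {w} {h} f)

  EvalLoop : ℕ → Store Σ′ 16 → Store Σ′ 16 → Set
  EvalLoop = Loop Z (some (# 14)) (evalStep ⨾ pop (# 14))

  Operands : Stack → Set
  Operands = All (λ s → isOperand s !)

  operands-run : ∀ os {w n p r j σ} → Operands os → EvalLoop j (state w n (os ++ p) r) σ →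
                 EvalLoop (length os + j) (state w n p (os ʳ++ r)) σ
  operands-run [] [] x = x
  operands-run (o ∷ os) {w} {n} {p} {r} {j} {σ} (h ∷ hs) x =
    subst (λ i → EvalLoop i (state w n p (os ʳ++ (o ∷ r))) σ) (+-suc (length os) j)
      (operands-run os hs (once refl (on-true h push ⨾ pop) x))

  operands-term : ∀ s → Operands (term s)
  operands-term (var v)   = refl ∷ []
  operands-term (const u) = refl ∷ go u
    where
    go : ∀ u → Operands (map inp (map letter u ++ `⟩ ∷ []))
    go []      = refl ∷ []
    go (a ∷ u) = refl ∷ go u

  input-of : FO k 2 → Stack
  input-of φ = map inp (encode φ)

  room₁ : ∀ {h w b} → Fits (suc h) w → Fits 0 (b ◂ w)
  room₁ {w = w} f x y = ≤-trans (≤-trans (≤-reflexive (cong suc (+-identityʳ _)))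
      (≤-trans (s≤s (m≤m+n _ _)) (≤-reflexive (sym (+-suc (length (w x y)) _))))) (f x y)

  room : ∀ (φ ψ : FO k 2) {w b b′} → Fits (suc (length (encode φ ++ encode ψ))) w → Fits 0 (b ◂ b′ ◂ w)
  room φ ψ {w} f x y = ≤-trans (≤-trans (≤-reflexive (trans (+-identityʳ _) (+-comm 2 (length (w x y)))))
    (+-monoʳ-≤ (length (w x y)) (s≤s (≤-trans (size>0 φ)
        (≤-trans (m≤m+n ∣ φ ∣ ∣ ψ ∣) (≤-reflexive (sym (length-++ (encode φ)))))))) ) (f x y)

  -- In continuation style: a loop derivation grows at its front, so the rounds spent on `φ` are put
  -- before a given derivation for the symbols that remain in `r`.
  eval-run : ∀ φ {w n r j σ} → Fits ∣ φ ∣ w → EvalLoop j (state (value φ n ◂ w) (after φ n) [] r) σ →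
             EvalLoop (∣ φ ∣ + j) (state w n [] (input-of φ ʳ++ r)) σ
  eval-run-bin : ∀ (φ ψ : FO k 2) (s : Symbol k 2) (op : Bool → Bool → Bool) {w n r j σ} →
    Fits (suc (length (encode φ ++ encode ψ))) w →
    (Run Z evalStep (state (value φ (after ψ n) ◂ value ψ n ◂ w) (after φ (after ψ n)) [] (inp s ∷ r))
                    (state ((λ x y → op (value φ (after ψ n) x y) (value ψ n x y)) ◂ w) (after φ (after ψ n)) []
                        (inp s ∷ r))) →
    EvalLoop j (state ((λ x y → op (value φ (after ψ n) x y) (value ψ n x y)) ◂ w) (after φ (after ψ n)) [] r) σ →
    EvalLoop (suc (length (encode φ ++ encode ψ)) + j) (state w n [] (map inp (encode φ ++ encode ψ) ʳ++ (inp s ∷ r))) σ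
  eval-run-bin φ ψ s op {w} {n} {r} {j} {σ} f step x =
    subst₂ (λ i u → EvalLoop i (state w n [] u) σ) count stack
      (eval-run ψ {w} {n} (λ a b → ≤-trans (+-monoʳ-≤ (length (w a b))
          (m≤n⇒m≤1+n (≤-trans (m≤n+m ∣ ψ ∣ ∣ φ ∣) (≤-reflexive (sym (length-++ (encode φ))))))) (f a b))
        (eval-run φ {value ψ n ◂ w} {after ψ n} (λ a b → ≤-trans
            (≤-trans (≤-reflexive (sym (+-suc (length (w a b)) ∣ φ ∣)))
            (+-monoʳ-≤ (length (w a b)) (s≤s (≤-trans (m≤m+n ∣ φ ∣ ∣ ψ ∣)
            (≤-reflexive (sym (length-++ (encode φ)))))))) (f a b))
          (once refl (step ⨾ pop) x)))
    where
    count : ∣ ψ ∣ + (∣ φ ∣ + suc j) ≡ suc (length (encode φ ++ encode ψ)) + j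
    count = trans (sym (+-assoc ∣ ψ ∣ ∣ φ ∣ (suc j))) (trans (+-suc (∣ ψ ∣ + ∣ φ ∣) j)
              (cong (λ i → suc (i + j)) (trans (+-comm ∣ ψ ∣ ∣ φ ∣) (sym (length-++ (encode φ))))))
    stack : input-of ψ ʳ++ (input-of φ ʳ++ (inp s ∷ r)) ≡ map inp (encode φ ++ encode ψ) ʳ++ (inp s ∷ r)
    stack = trans (sym (++-ʳ++ (input-of φ))) (cong (_ʳ++ (inp s ∷ r)) (sym (map-++ inp (encode φ) (encode ψ))))
  eval-run (s ⊑′ t) {w} {n} {r} {j} {σ} f x =
    subst₂ (λ i u → EvalLoop i (state w n [] u) σ) count stack
      (operands-run (term t) (operands-term t)
        (subst (λ u → EvalLoop (length (term s) + suc j) (state w n u (term s ʳ++ (inp `⊑ ∷ r))) σ)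
            (sym (++-identityʳ (term t)))
        (operands-run (term s) (operands-term s)
          (once refl (on-false refl (on-true refl
            (call (0F ∷ 1F ∷ 2F ∷ 3F ∷ # 12 ∷ # 13 ∷ 6F ∷ 7F ∷ 8F ∷ # 10 ∷ []) atom ⨾
             call (# 12 ∷ []) (clear-run (term s ++ term t) terms≤))) ⨾ pop) x))))
    where
    len : length (term s) + length (term t) ≡ length (encodeTerm s ++ encodeTerm t)
    len = trans (cong₂ _+_ (length-map inp (encodeTerm s)) (length-map inp (encodeTerm t)))
        (sym (length-++ (encodeTerm s)))
    count : length (term t) + (length (term s) + suc j) ≡ suc (length (encodeTerm s ++ encodeTerm t)) + j
    count = trans (sym (+-assoc (length (term t)) (length (term s)) (suc j)))
        (trans (+-suc (length (term t) + length (term s)) j)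
              (cong (λ i → suc (i + j)) (trans (+-comm (length (term t)) (length (term s))) len)))
    stack : term t ʳ++ (term s ʳ++ (inp `⊑ ∷ r)) ≡ map inp (encodeTerm s ++ encodeTerm t) ʳ++ (inp `⊑ ∷ r)
    stack = trans (sym (++-ʳ++ (term s))) (cong (_ʳ++ (inp `⊑ ∷ r)) (sym (map-++ inp (encodeTerm s) (encodeTerm t))))
    sizes : suc (length (encodeTerm s ++ encodeTerm t)) ≤ Z
    sizes = ≤-trans (m≤n+m _ _) (≤-trans (f [] []) H≤Z)
    sum≤ : length (term s) + length (term t) ≤ Z
    sum≤ = ≤-trans (≤-reflexive len) (≤-trans (n≤1+n _) sizes)
    terms≤ : length (term s ++ term t) ≤ Z
    terms≤ = ≤-trans (≤-reflexive (length-++ (term s))) sum≤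
    small : ∀ s → termSize {k} {2} s ≤ length (term s)
    small (var v)   = z≤n
    small (const u) = ≤-trans (≤-reflexive (sym (length-map letter u)))
        (≤-trans (≤-trans (m≤m+n _ 1) (≤-reflexive (sym (length-++ (map letter u)))))
                        (≤-trans (≤-reflexive (sym (length-map inp (map letter u ++ `⟩ ∷ [])))) (n≤1+n _)))
    atom = atomRow-run s t {w} {length (encodeTerm s ++ encodeTerm t)} f
        (≤-trans (small s) (≤-trans (m≤m+n _ _) sum≤)) (≤-trans (small t) (≤-trans (m≤n+m _ _) sum≤)) sum≤
  eval-run (¬′ φ) {w} {n} {r} {j} {σ} f x =
    subst (λ i → EvalLoop i (state w n [] (input-of φ ʳ++ (inp `¬ ∷ r))) σ) (+-suc ∣ φ ∣ j)
      (eval-run φ (λ a b → ≤-trans (+-monoʳ-≤ (length (w a b)) (n≤1+n _)) (f a b))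
        (once refl (on-false refl (on-false refl (on-true refl
          (neg-run {value φ n} {w} {∣ φ ∣} (λ a b → ≤-trans (≤-reflexive (sym (+-suc (length (w a b)) ∣ φ ∣)))
              (f a b))))) ⨾ pop) x))
  eval-run (φ ∧′ ψ) {w} {n} {r} {j} {σ} f x = eval-run-bin φ ψ `∧ _∧_ {w} {n} {r} {j} {σ} f
    (on-false refl (on-false refl (on-false refl (on-true refl
      (bin-run _∧_ {value φ (after ψ n)} {value ψ n} {w} {0} (room φ ψ {w} {value φ (after ψ n)} {value ψ n} f)))))) x
  eval-run (φ ∨′ ψ) {w} {n} {r} {j} {σ} f x = eval-run-bin φ ψ `∨ _∨_ {w} {n} {r} {j} {σ} f
    (on-false refl (on-false refl (on-false refl (on-false refl (on-true refl
      (bin-run _∨_ {value φ (after ψ n)} {value ψ n} {w} {0} (room φ ψ {w} {value φ (after ψ n)} {value ψ n} f))))))) x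
  eval-run (φ ⇒′ ψ) {w} {n} {r} {j} {σ} f x = eval-run-bin φ ψ `⇒ implies {w} {n} {r} {j} {σ} f
    (on-false refl (on-false refl (on-false refl (on-false refl (on-false refl (on-true refl
      (bin-run implies {value φ (after ψ n)} {value ψ n} {w} {0}
          (room φ ψ {w} {value φ (after ψ n)} {value ψ n} f)))))))) x
  eval-run (∃′ v φ) {w} {n} {r} {j} {σ} f x =
    subst (λ i → EvalLoop i (state w n [] (input-of φ ʳ++ (inp (var v) ∷ inp `∃ ∷ r))) σ)
        (trans (+-suc ∣ φ ∣ _) (cong suc (+-suc ∣ φ ∣ j)))
      (eval-run φ (λ a b → ≤-trans (+-monoʳ-≤ (length (w a b)) (≤-trans (n≤1+n _) (n≤1+n _))) (f a b))
        (once refl (on-true refl push ⨾ pop)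
        (once refl (on-false refl (on-false refl (on-false refl (on-false refl (on-false refl (on-false refl (on-true refl
          (quant-run v (after φ n) {value φ n} {w} {0} (room₁ {suc ∣ φ ∣} {w} {value φ n} f)))))))) ⨾ pop) x)))
  eval-run (∀′ v φ) {w} {n} {r} {j} {σ} f x =
    subst (λ i → EvalLoop i (state w n [] (input-of φ ʳ++ (inp (var v) ∷ inp `∀ ∷ r))) σ)
        (trans (+-suc ∣ φ ∣ _) (cong suc (+-suc ∣ φ ∣ j)))
      (eval-run φ (λ a b → ≤-trans (+-monoʳ-≤ (length (w a b)) (≤-trans (n≤1+n _) (n≤1+n _))) (f a b))
        (once refl (on-true refl push ⨾ pop)
        (once refl (on-false refl (on-false refl (on-false refl
            (on-false refl (on-false refl (on-false refl (on-false refl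
          (neg-run {value φ n} {w} {0} (room₁ {suc ∣ φ ∣} {w} {value φ n} f) ⨾
           quant-run v (after φ n) {λ x y → not (value φ n x y)} {w} {0} (room₁ {suc ∣ φ ∣} {w} {value φ n} f) ⨾
           neg-run {someBit v (after φ n) (λ x y → not (value φ n x y))} {w} {0}
               (room₁ {suc ∣ φ ∣} {w} {value φ n} f)))))))) ⨾ pop) x)))

⌊⌋-intro : ∀ {A : Set} (a? : Dec A) {b} → (b ≡ true → A) → (A → b ≡ true) → b ≡ ⌊ a? ⌋
⌊⌋-intro (yes a) {b} f g = g a
⌊⌋-intro (no ¬a) {false} f g = refl
⌊⌋-intro (no ¬a) {true}  f g = contradiction (f refl) ¬a

⌊⌋-elim : ∀ {A : Set} (a? : Dec A) → ⌊ a? ⌋ ≡ true → A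
⌊⌋-elim (yes a) _ = a

∧-true : ∀ {a b} → a ∧ b ≡ true → a ≡ true × b ≡ true
∧-true {true} {true} _ = refl , refl

-- Reliability of the truncated table

module Semantics (k : ℕ) (O : Set) (Z : ℕ) (2≤Z : 2 ≤ Z)
                 (ps : List (Word k × Word k)) (short : All (λ (x , y) → length x ≤ Z × length y ≤ Z) ps)
                 (H : ℕ) (H≤Z : H ≤ Z)
                 (tab≤ : ∀ (w : Word k → Word k → List Bool) → (∀ x y → length (w x y) ≤ H) → length
                     (Basics.tab k O Z w ps) ≤ Z)
                 (g : ℕ) (g≤Z : g ≤ Z)
                 (B : ℕ) (all-pairs : ∀ {x y} → length x ≤ B → length y ≤ B → (x , y) ∈ ps)
                 (s : ℕ) (g-large : ∀ (φ : FO k 2) → ∣ φ ∣ ≤ s → weight k (degree φ) ≤ g) where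

  open Programs k O
  open Basics k O Z
  open Tests k O Z
  open Evaluation k O Z 2≤Z ps short H H≤Z tab≤ g g≤Z

  found-true⁺ : ∀ v c acc qs {x y} → (x , y) ∈ qs → c x y ≡ true → v x y ≡ true → found v c acc qs ≡ true
  found-keep : ∀ v c qs → found v c true qs ≡ true
  found-keep v c []       = refl
  found-keep v c (q ∷ qs) = found-keep v c qs
  found-true⁺ v c acc (q ∷ qs) (here refl) e f rewrite e | f | ∨-zeroʳ acc = found-keep v c qs
  found-true⁺ v c acc (q ∷ qs) (there i)   e f = found-true⁺ v c _ qs i e f

  found-true⁻ : ∀ v c acc qs → found v c acc qs ≡ true →
                acc ≡ true ⊎ ∃ λ x → ∃ λ y → (x , y) ∈ qs × c x y ≡ true × v x y ≡ true
  found-true⁻ v c acc [] e = inj₁ e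
  found-true⁻ v c acc ((x , y) ∷ qs) e with found-true⁻ v c _ qs e
  ... | inj₂ (x′ , y′ , i , e₁ , e₂) = inj₂ (x′ , y′ , there i , e₁ , e₂)
  ... | inj₁ h with acc | h
  ...   | true  | _  = inj₁ refl
  ...   | false | h′ with e₁ , e₂ ← ∧-true h′ = inj₂ (x , y , here refl , e₁ , e₂)

  after≤ : ∀ φ n → after φ n ≤ n
  after≤ (s ⊑′ t) n = ≤-refl
  after≤ (¬′ φ)   n = after≤ φ n
  after≤ (φ ∧′ ψ) n = ≤-trans (after≤ φ (after ψ n)) (after≤ ψ n)
  after≤ (φ ∨′ ψ) n = ≤-trans (after≤ φ (after ψ n)) (after≤ ψ n)
  after≤ (φ ⇒′ ψ) n = ≤-trans (after≤ φ (after ψ n)) (after≤ ψ n)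
  after≤ (∃′ v φ) n = ≤-trans (m∸n≤m (after φ n) g) (after≤ φ n)
  after≤ (∀′ v φ) n = ≤-trans (m∸n≤m (after φ n) g) (after≤ φ n)

  after-bin : ∀ (φ ψ : FO k 2) {n a b} → n ≤ b + ∣ ψ ∣ * g → b ≤ a + ∣ φ ∣ * g →
              n ≤ a + suc (length (encode φ ++ encode ψ)) * g
  after-bin φ ψ {n} {a} {b} l l′ = begin
    n                                     ≤⟨ l ⟩
    b + ∣ ψ ∣ * g                         ≤⟨ +-monoˡ-≤ (∣ ψ ∣ * g) l′ ⟩
    a + ∣ φ ∣ * g + ∣ ψ ∣ * g             ≡⟨ +-assoc a (∣ φ ∣ * g) (∣ ψ ∣ * g) ⟩
    a + (∣ φ ∣ * g + ∣ ψ ∣ * g)           ≡⟨ cong (a +_) (*-distribʳ-+ g ∣ φ ∣ ∣ ψ ∣) ⟨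
    a + (∣ φ ∣ + ∣ ψ ∣) * g               ≡⟨ cong (λ i → a + i * g) (length-++ (encode φ)) ⟨
    a + length (encode φ ++ encode ψ) * g ≤⟨ +-monoʳ-≤ a (m≤n+m _ g) ⟩
    a + suc (length (encode φ ++ encode ψ)) * g ∎
    where open ≤-Reasoning

  after-quant : ∀ i {a n} → n ≤ a + i * g → n ≤ a ∸ g + (2 + i) * g
  after-quant i {a} {n} l = begin
    n                         ≤⟨ l ⟩
    a + i * g                 ≤⟨ +-monoˡ-≤ (i * g) (m≤n+m∸n a g) ⟩
    g + (a ∸ g) + i * g       ≡⟨ cong (_+ i * g) (+-comm g (a ∸ g)) ⟩
    a ∸ g + g + i * g         ≡⟨ +-assoc (a ∸ g) g (i * g) ⟩
    a ∸ g + suc i * g         ≤⟨ +-monoʳ-≤ (a ∸ g) (m≤n+m (suc i * g) g) ⟩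
    a ∸ g + (2 + i) * g       ∎
    where open ≤-Reasoning

  -- A quantifier costs one margin g and is written with two symbols, so the loss is at most g for
  -- each symbol.
  ≤after : ∀ φ n → n ≤ after φ n + ∣ φ ∣ * g
  ≤after (s ⊑′ t) n = m≤m+n n _
  ≤after (¬′ φ)   n = ≤-trans (≤after φ n) (+-monoʳ-≤ (after φ n) (m≤n+m _ g))
  ≤after (φ ∧′ ψ) n = after-bin φ ψ (≤after ψ n) (≤after φ (after ψ n))
  ≤after (φ ∨′ ψ) n = after-bin φ ψ (≤after ψ n) (≤after φ (after ψ n))
  ≤after (φ ⇒′ ψ) n = after-bin φ ψ (≤after ψ n) (≤after φ (after ψ n))
  ≤after (∃′ v φ) n = after-quant ∣ φ ∣ (≤after φ n)
  ≤after (∀′ v φ) n = after-quant ∣ φ ∣ (≤after φ n)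

  -- The witness fits in the table because the level i exceeds the length of the other word by at least g.
  someBit-correct : ∀ d (φ : FO k 2) i {b x y} → ∣ φ ∣ ≤ s → g ≤ i → i ≤ B →
    (∀ x y → length x ≤ i → length y ≤ i → b x y ≡ ⌊ sat? φ (x ∷ y ∷ []) ⌋) →
    length x ≤ i ∸ g → length y ≤ i ∸ g → someBit d i b x y ≡ ⌊ sat? (∃′ d φ) (x ∷ y ∷ []) ⌋
  someBit-correct d φ i {b} {x} {y} l g≤i i≤B h lx ly = ⌊⌋-intro (sat? (∃′ d φ) (x ∷ y ∷ [])) (sound d) (complete d)
    where
    i∸g≤i = m∸n≤m i g
    sound : ∀ d → someBit d i b x y ≡ true → ∃ λ u → (x ∷ y ∷ []) [ d ]≔ u ⊨ φ
    sound d e with found-true⁻ b (matches 2≤Z d (fixed d x y) i) false ps e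
    sound 0F e | inj₂ (x′ , y′ , _ , c , e′) with c₁ , c₂ ← ∧-true c with refl ← ⌊⌋-elim (y′ ≟ʷ y) c₁ =
      x′ , ⌊⌋-elim (sat? φ _) (trans (sym (h x′ y (⌊⌋-elim (length x′ ≤? i) c₂) (≤-trans ly i∸g≤i))) e′)
    sound 1F e | inj₂ (x′ , y′ , _ , c , e′) with c₁ , c₂ ← ∧-true c with refl ← ⌊⌋-elim (x′ ≟ʷ x) c₁ =
      y′ , ⌊⌋-elim (sat? φ _) (trans (sym (h x y′ (≤-trans lx i∸g≤i) (⌊⌋-elim (length y′ ≤? i) c₂))) e′)
    near : ∀ {a c} → a ≤ c + weight k (degree φ) → c ≤ i ∸ g → a ≤ i
    near la lc = ≤-trans la (≤-trans (+-mono-≤ lc (g-large φ l)) (≤-reflexive (m∸n+n≡m g≤i)))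
    complete : ∀ d → (∃ λ u → (x ∷ y ∷ []) [ d ]≔ u ⊨ φ) → someBit d i b x y ≡ true
    complete 0F (u , p) with u′ , lu , e ← similar-short (degree φ) (x ∷ y ∷ []) 0F u =
      found-true⁺ b (matches 2≤Z 0F y i) false ps
        (all-pairs (≤-trans (near lu ly) i≤B) (≤-trans ly (≤-trans i∸g≤i i≤B)))
        (cong₂ _∧_ (⌊⌋-true (y ≟ʷ y) refl) (⌊⌋-true (length u′ ≤? i) (near lu ly)))
        (trans (h u′ y (near lu ly) (≤-trans ly i∸g≤i)) (⌊⌋-true (sat? φ _) (to (similar-⊨ φ ≤-refl e) p)))
    complete 1F (u , p) with u′ , lu , e ← similar-short (degree φ) (x ∷ y ∷ []) 1F u =
      found-true⁺ b (matches 2≤Z 1F x i) false ps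
        (all-pairs (≤-trans lx (≤-trans i∸g≤i i≤B)) (≤-trans (near lu lx) i≤B))
        (cong₂ _∧_ (⌊⌋-true (x ≟ʷ x) refl) (⌊⌋-true (length u′ ≤? i) (near lu lx)))
        (trans (h x u′ (≤-trans lx i∸g≤i) (near lu lx)) (⌊⌋-true (sat? φ _) (to (similar-⊨ φ ≤-refl e) p)))

  ⌊⌋-¬ : ∀ {A : Set} (a? : Dec A) → not ⌊ a? ⌋ ≡ ⌊ ¬? a? ⌋
  ⌊⌋-¬ (yes _) = refl
  ⌊⌋-¬ (no _)  = refl

  ⌊⌋-× : ∀ {A C : Set} (a? : Dec A) (c? : Dec C) → ⌊ a? ⌋ ∧ ⌊ c? ⌋ ≡ ⌊ a? ×-dec c? ⌋
  ⌊⌋-× (yes _) (yes _) = refl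
  ⌊⌋-× (yes _) (no _)  = refl
  ⌊⌋-× (no _)  _       = refl

  ⌊⌋-⊎ : ∀ {A C : Set} (a? : Dec A) (c? : Dec C) → ⌊ a? ⌋ ∨ ⌊ c? ⌋ ≡ ⌊ a? ⊎-dec c? ⌋
  ⌊⌋-⊎ (yes _) _       = refl
  ⌊⌋-⊎ (no _)  (yes _) = refl
  ⌊⌋-⊎ (no _)  (no _)  = refl

  ⌊⌋-→ : ∀ {A C : Set} (a? : Dec A) (c? : Dec C) → implies ⌊ a? ⌋ ⌊ c? ⌋ ≡ ⌊ a? →-dec c? ⌋
  ⌊⌋-→ (yes _) (yes _) = refl
  ⌊⌋-→ (yes _) (no _)  = refl
  ⌊⌋-→ (no _)  _       = refl

  room-left : ∀ φ n c → (∣ φ ∣ + c) * g ≤ n → c * g ≤ after φ n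
  room-left φ n c l = +-cancelʳ-≤ (∣ φ ∣ * g) _ _ (begin
    c * g + ∣ φ ∣ * g     ≡⟨ *-distribʳ-+ g c ∣ φ ∣ ⟨
    (c + ∣ φ ∣) * g       ≡⟨ cong (_* g) (+-comm c ∣ φ ∣) ⟩
    (∣ φ ∣ + c) * g       ≤⟨ l ⟩
    n                     ≤⟨ ≤after φ n ⟩
    after φ n + ∣ φ ∣ * g ∎)
    where open ≤-Reasoning

  -- Starting from a level of at least `∣ φ ∣ * g` ensures that every quantifier inside still finds
  -- a level of at least g from which to subtract.
  value-correct : ∀ φ n {x y} → ∣ φ ∣ ≤ s → ∣ φ ∣ * g ≤ n → n ≤ B → length x ≤ after φ n → length y ≤ after φ n →
                  value φ n x y ≡ ⌊ sat? φ (x ∷ y ∷ []) ⌋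
  value-correct₂ : ∀ φ ψ n {x y} → suc (length (encode φ ++ encode ψ)) ≤ s →
                   suc (length (encode φ ++ encode ψ)) * g ≤ n → n ≤ B →
                   length x ≤ after φ (after ψ n) → length y ≤ after φ (after ψ n) →
                   value φ (after ψ n) x y ≡ ⌊ sat? φ (x ∷ y ∷ []) ⌋ × value ψ n x y ≡ ⌊ sat? ψ (x ∷ y ∷ []) ⌋
  value-correct₁ : ∀ φ n {x y} → suc (suc ∣ φ ∣) ≤ s → suc (suc ∣ φ ∣) * g ≤ n → n ≤ B →
                   length x ≤ after φ n → length y ≤ after φ n →
                   value φ n x y ≡ ⌊ sat? φ (x ∷ y ∷ []) ⌋

  value-correct (t ⊑′ u) n l c b lx ly = ⌊⌋-⇔ (_ ⊑? _) (_ ⊑? _) id id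
  value-correct (¬′ φ) n {x} {y} l c b lx ly =
    trans (cong not (value-correct φ n (<⇒≤ l) (≤-trans (m≤n+m _ g) c) b lx ly)) (⌊⌋-¬ (sat? φ (x ∷ y ∷ [])))
  value-correct (φ ∧′ ψ) n {x} {y} l c b lx ly with e , f ← value-correct₂ φ ψ n l c b lx ly =
    trans (cong₂ _∧_ e f) (⌊⌋-× (sat? φ (x ∷ y ∷ [])) (sat? ψ (x ∷ y ∷ [])))
  value-correct (φ ∨′ ψ) n {x} {y} l c b lx ly with e , f ← value-correct₂ φ ψ n l c b lx ly =
    trans (cong₂ _∨_ e f) (⌊⌋-⊎ (sat? φ (x ∷ y ∷ [])) (sat? ψ (x ∷ y ∷ [])))
  value-correct (φ ⇒′ ψ) n {x} {y} l c b lx ly with e , f ← value-correct₂ φ ψ n l c b lx ly =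
    trans (cong₂ implies e f) (⌊⌋-→ (sat? φ (x ∷ y ∷ [])) (sat? ψ (x ∷ y ∷ [])))
  value-correct (∃′ v φ) n l c b lx ly =
    someBit-correct v φ (after φ n) (<⇒≤ (<⇒≤ l)) (≤-trans (m≤m+n g (1 * g))
        (room-left φ n 2 (≤-trans (≤-reflexive (cong (_* g) (+-comm ∣ φ ∣ 2))) c)))
      (≤-trans (after≤ φ n) b) (λ x y → value-correct₁ φ n l c b) lx ly
  value-correct (∀′ v φ) n {x} {y} l c b lx ly =
    -- The quantifier is treated as not-exists-not. `¬′ φ` is within the size bound because a
    -- quantifier accounts for two symbols, and its degree is that of `φ`.
    trans (cong not (someBit-correct v (¬′ φ) (after φ n) (<⇒≤ l)
        (≤-trans (m≤m+n g (1 * g)) (room-left φ n 2 (≤-trans (≤-reflexive (cong (_* g) (+-comm ∣ φ ∣ 2))) c)))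
      (≤-trans (after≤ φ n) b)
      (λ x y lx ly → trans (cong not (value-correct₁ φ n l c b lx ly)) (⌊⌋-¬ (sat? φ (x ∷ y ∷ [])))) lx ly))
      (trans (⌊⌋-¬ (sat? (∃′ v (¬′ φ)) (x ∷ y ∷ []))) (⌊⌋-⇔ (¬? (sat? (∃′ v (¬′ φ)) (x ∷ y ∷ [])))
          (sat? (∀′ v φ) (x ∷ y ∷ []))
        (λ ¬e u → stable (sat? φ _) (λ ¬p → ¬e (u , ¬p))) (λ { p (u , ¬p) → ¬p (p u) })))
    where
    stable : ∀ {A : Set} → Dec A → ¬ ¬ A → A
    stable (yes a) _  = a
    stable (no ¬a) ¬¬ = contradiction ¬a ¬¬
  value-correct₁ φ n l c b = value-correct φ n (<⇒≤ (<⇒≤ l)) (≤-trans (≤-trans (m≤n+m _ g) (m≤n+m _ g)) c) b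
  value-correct₂ φ ψ n l c b lx ly =
    value-correct φ (after ψ n) (≤-trans (m≤m+n ∣ φ ∣ ∣ ψ ∣) ll)
        (room-left ψ n ∣ φ ∣ (≤-trans (*-monoˡ-≤ g (≤-reflexive (+-comm ∣ ψ ∣ ∣ φ ∣))) cc))
      (≤-trans (after≤ ψ n) b) lx ly ,
    value-correct ψ n (≤-trans (m≤n+m ∣ ψ ∣ ∣ φ ∣) ll) (≤-trans (*-monoˡ-≤ g (m≤n+m ∣ ψ ∣ ∣ φ ∣)) cc) b
      (≤-trans lx (after≤ φ (after ψ n))) (≤-trans ly (after≤ φ (after ψ n)))
    where
    ll : ∣ φ ∣ + ∣ ψ ∣ ≤ s
    ll = ≤-trans (≤-reflexive (sym (length-++ (encode φ)))) (<⇒≤ l)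
    cc : (∣ φ ∣ + ∣ ψ ∣) * g ≤ n
    cc = ≤-trans (*-monoˡ-≤ g (≤-trans (≤-reflexive (sym (length-++ (encode φ)))) (n≤1+n _))) c

-- Construction of the word and pair tables

module Main (k : ℕ) (O : Set) where

  open Programs k O

  -- On (IO , T , T′ , rx , ry , O , O′ , a , b , t , m , F , M , P , P′ , R , G , U , N , W , W₀).
  prepare : ℕ → P 21
  prepare c =
    embed (0F ∷ # 15 ∷ # 17 ∷ # 16 ∷ 9F ∷ []) (bound c) ⨾
    embed (# 16 ∷ # 17 ∷ 9F ∷ # 12 ∷ []) square ⨾
    push (# 19) (λ _ → eor) ⨾ push (# 19) (λ _ → hash) ⨾ push (# 19) (λ _ → hash) ⨾
    embed (# 16 ∷ 9F ∷ # 17 ∷ []) copy ⨾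
    embed (# 19 ∷ 2F ∷ 3F ∷ 4F ∷ # 18 ∷ 9F ∷ # 17 ∷ []) growAll ⨾
    -- The words of length at most g are saved here, as candidates for the states of the automaton,
    -- before `g * g` further rounds extend the list.
    embed (# 19 ∷ 9F ∷ # 20 ∷ []) copy ⨾
    embed (# 12 ∷ 9F ∷ # 17 ∷ []) copy ⨾
    embed (# 19 ∷ 2F ∷ 3F ∷ 4F ∷ # 18 ∷ 9F ∷ # 17 ∷ []) growAll ⨾
    embed (# 19 ∷ 2F ∷ 3F ∷ 4F ∷ 5F ∷ 6F ∷ 7F ∷ 8F ∷ # 18 ∷ 9F ∷ []) pairTable ⨾
    embed (5F ∷ []) clear ⨾
    embed (# 18 ∷ 1F ∷ []) shift ⨾
    embed (1F ∷ 2F ∷ 3F ∷ 4F ∷ 5F ∷ 6F ∷ 7F ∷ 8F ∷ 9F ∷ # 10 ∷ # 11 ∷ # 12 ∷ # 13 ∷ # 14 ∷ # 15 ∷ # 16 ∷ []) evaluate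

module Preparation (k : ℕ) (O : Set) (Z : ℕ) where

  open Programs k O
  open Basics k O Z
  open Tests k O Z

  ones-++ : ∀ a b → ones a ++ ones b ≡ ones (a + b)
  ones-++ zero    b = refl
  ones-++ (suc a) b = cong (one ∷_) (ones-++ a b)

  ones-ʳ++ : ∀ a b → ones a ʳ++ ones b ≡ ones (a + b)
  ones-ʳ++ zero    b = refl
  ones-ʳ++ (suc a) b = trans (ones-ʳ++ a (suc b)) (cong ones (+-suc a b))

  length-ones : ∀ a → length (ones a) ≡ a
  length-ones a = length-replicate a

  double-run : ∀ a → 2 * a ≤ Z → Run Z double (ones a ∷ [] ∷ []) (ones (2 * a) ∷ [] ∷ [])
  double-run a l =
    subst (λ u → Run Z double (ones a ∷ [] ∷ []) (u ∷ [] ∷ []))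
        (trans (ones-ʳ++ (2 * a) 0) (cong ones (+-identityʳ (2 * a))))
      (loop (subst (λ i → Loop Z (some 0F) (mark 1F ⨾ mark 1F ⨾ pop 0F) a (ones a ∷ [] ∷ []) ([] ∷ ones i ∷ []))
          (+-identityʳ (2 * a)) (go a 0))
            (≤-trans (m≤m+n a _) l) ⨾
       call (1F ∷ 0F ∷ []) (shift-run (ones (2 * a)) (≤-trans (≤-reflexive (length-ones (2 * a))) l)))
    where
    go : ∀ a i → Loop Z (some 0F) (mark 1F ⨾ mark 1F ⨾ pop 0F) a (ones a ∷ ones i ∷ []) ([] ∷ ones (2 * a + i) ∷ [])
    go zero    i = stop refl
    go (suc a) i = once refl (push ⨾ push ⨾ pop)
      (subst (λ j → Loop Z (some 0F) (mark 1F ⨾ mark 1F ⨾ pop 0F) a (ones a ∷ ones (2 + i) ∷ []) ([] ∷ ones j ∷ []))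
          (count a i) (go a (2 + i)))
      where
      count : ∀ a i → 2 * a + (2 + i) ≡ 2 * suc a + i
      count a i = trans (+-suc (2 * a) (1 + i)) (trans (cong suc (+-suc (2 * a) i)) (cong (_+ i) (sym (*-suc 2 a))))

  times-double : ∀ c {I R G} a → 2 ^ c * a ≤ Z →
    Run Z (times c (embed (2F ∷ 4F ∷ []) double)) (I ∷ R ∷ ones a ∷ G ∷ [] ∷ []) (I ∷ R ∷ ones (2 ^ c * a) ∷ G ∷ [] ∷ [])
  times-double zero    {I} {R} {G} a l = subst (λ j → Run Z skip (I ∷ R ∷ ones a ∷ G ∷ [] ∷ [])
      (I ∷ R ∷ ones j ∷ G ∷ [] ∷ [])) (sym (+-identityʳ a)) skip
  times-double (suc c) {I} {R} {G} a l =
    call (2F ∷ 4F ∷ []) (double-run a (≤-trans (≤-trans (m≤n*m (2 * a) (2 ^ c) {{m^n≢0 2 c}})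
        (≤-reflexive (shuffle c))) l)) ⨾
    subst (λ j → Run Z (times c (embed (2F ∷ 4F ∷ []) double)) (I ∷ R ∷ ones (2 * a) ∷ G ∷ [] ∷ [])
        (I ∷ R ∷ ones j ∷ G ∷ [] ∷ [])) (shuffle c)
      (times-double c (2 * a) (≤-trans (≤-reflexive (shuffle c)) l))
    where
    shuffle : ∀ c → 2 ^ c * (2 * a) ≡ 2 ^ suc c * a
    shuffle c = trans (sym (*-assoc (2 ^ c) 2 a)) (cong (_* a) (*-comm (2 ^ c) 2))

  read-loop : ∀ c (w : List (Symbol k 2)) {R G} a → 2 ^ (c * length w) * a ≤ Z →
    Loop Z (some 0F) (times c (embed (2F ∷ 4F ∷ []) double) ⨾ push 1F (get 0F) ⨾ pop 0F) (length w)
      (map inp w ∷ R ∷ ones a ∷ G ∷ [] ∷ []) ([] ∷ (map inp w ʳ++ R) ∷ ones (2 ^ (c * length w) * a) ∷ G ∷ [] ∷ [])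
  read-loop c []      {R} {G} a l =
    subst (λ j → Loop Z (some 0F) (times c (embed (2F ∷ 4F ∷ []) double) ⨾ push 1F (get 0F) ⨾ pop 0F) 0
                   ([] ∷ R ∷ ones a ∷ G ∷ [] ∷ []) ([] ∷ R ∷ ones j ∷ G ∷ [] ∷ []))
      (sym (trans (cong (λ i → 2 ^ i * a) (*-zeroʳ c)) (+-identityʳ a))) (stop refl)
  read-loop c (s ∷ w) {R} {G} a l =
    once refl (times-double c a (≤-trans (≤-trans (m≤n*m (2 ^ c * a) (2 ^ (c * length w)) {{m^n≢0 2 (c * length w)}})
        (≤-reflexive shuffle)) l) ⨾ push ⨾ pop)
      (subst (λ j → Loop Z (some 0F) (times c (embed (2F ∷ 4F ∷ []) double) ⨾ push 1F (get 0F) ⨾ pop 0F) (length w)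
                (map inp w ∷ (inp s ∷ R) ∷ ones (2 ^ c * a) ∷ G ∷ [] ∷ [])
                    ([] ∷ (map inp w ʳ++ (inp s ∷ R)) ∷ ones j ∷ G ∷ [] ∷ []))
        shuffle (read-loop c w (2 ^ c * a) (≤-trans (≤-reflexive shuffle) l)))
    where
    shuffle : 2 ^ (c * length w) * (2 ^ c * a) ≡ 2 ^ (c * suc (length w)) * a
    shuffle = trans (sym (*-assoc (2 ^ (c * length w)) (2 ^ c) a))
      (cong (_* a) (trans (sym (^-distribˡ-+-* 2 (c * length w) c))
          (cong (2 ^_) (trans (+-comm (c * length w) c) (sym (*-suc c (length w)))))))

  tower-loop : ∀ u {I R} a → 2 ^ u * a ≤ Z →
    Loop Z (some 2F) (embed (3F ∷ 4F ∷ []) double ⨾ pop 2F) u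
      (I ∷ R ∷ ones u ∷ ones a ∷ [] ∷ []) (I ∷ R ∷ [] ∷ ones (2 ^ u * a) ∷ [] ∷ [])
  tower-loop zero    {I} {R} a l =
    subst (λ j → Loop Z (some 2F) (embed (3F ∷ 4F ∷ []) double ⨾ pop 2F) 0 (I ∷ R ∷ [] ∷ ones a ∷ [] ∷ [])
        (I ∷ R ∷ [] ∷ ones j ∷ [] ∷ []))
      (sym (+-identityʳ a)) (stop refl)
  tower-loop (suc u) {I} {R} a l =
    once refl (call (3F ∷ 4F ∷ []) (double-run a (≤-trans
        (≤-trans (m≤n*m (2 * a) (2 ^ u) {{m^n≢0 2 u}}) (≤-reflexive shuffle)) l)) ⨾ pop)
      (subst (λ j → Loop Z (some 2F) (embed (3F ∷ 4F ∷ []) double ⨾ pop 2F) u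
          (I ∷ R ∷ ones u ∷ ones (2 * a) ∷ [] ∷ []) (I ∷ R ∷ [] ∷ ones j ∷ [] ∷ []))
        shuffle (tower-loop u (2 * a) (≤-trans (≤-reflexive shuffle) l)))
    where
    shuffle : 2 ^ u * (2 * a) ≡ 2 ^ suc u * a
    shuffle = trans (sym (*-assoc (2 ^ u) 2 a)) (cong (_* a) (*-comm (2 ^ u) 2))

  bound-run : ∀ c (w : List (Symbol k 2)) → exp₂ (c * length w) ≤ Z → length w ≤ Z →
    Run Z (bound c) (map inp w ∷ [] ∷ [] ∷ [] ∷ [] ∷ [])
                    ([] ∷ (map inp w ʳ++ []) ∷ [] ∷ ones (exp₂ (c * length w)) ∷ [] ∷ [])
  bound-run c w l lw =
    push ⨾
    loop (subst (λ j → Loop Z (some 0F) (times c (embed (2F ∷ 4F ∷ []) double) ⨾ push 1F (get 0F) ⨾ pop 0F) (length w)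
                         (map inp w ∷ [] ∷ ones 1 ∷ [] ∷ [] ∷ []) ([] ∷ (map inp w ʳ++ []) ∷ ones j ∷ [] ∷ [] ∷ []))
           (*-identityʳ u) (read-loop c w 1 (≤-trans (≤-reflexive (*-identityʳ u)) u≤Z))) lw ⨾
    push ⨾
    loop (subst (λ j → Loop Z (some 2F) (embed (3F ∷ 4F ∷ []) double ⨾ pop 2F) u
                         ([] ∷ (map inp w ʳ++ []) ∷ ones u ∷ ones 1 ∷ [] ∷ [])
                             ([] ∷ (map inp w ʳ++ []) ∷ [] ∷ ones j ∷ [] ∷ []))
           (*-identityʳ (2 ^ u)) (tower-loop u 1 (≤-trans (≤-reflexive (*-identityʳ (2 ^ u))) l))) u≤Z
    where
    u = 2 ^ (c * length w)
    u≤Z : u ≤ Z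
    u≤Z = ≤-trans (<⇒≤ (n<2^n u)) l

  copy-ones : ∀ a {b} → a ≤ Z → Run Z copy (ones a ∷ [] ∷ ones b ∷ []) (ones a ∷ [] ∷ ones (a + b) ∷ [])
  copy-ones a {b} l = subst (λ u → Run Z copy (ones a ∷ [] ∷ ones b ∷ []) (ones a ∷ [] ∷ u ∷ [])) (ones-++ a b)
    (copy-run (ones a) (≤-trans (≤-reflexive (length-ones a)) l))

  square-run : ∀ g → g ≤ Z → Run Z square (ones g ∷ [] ∷ [] ∷ [] ∷ []) (ones g ∷ [] ∷ [] ∷ ones (g * g) ∷ [])
  square-run g l =
    call (0F ∷ 2F ∷ 1F ∷ []) (subst (λ j → Run Z copy (ones g ∷ [] ∷ [] ∷ []) (ones g ∷ [] ∷ ones j ∷ []))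
        (+-identityʳ g) (copy-ones g {0} l)) ⨾
    loop (subst (λ j → Loop Z (some 1F) (embed (0F ∷ 2F ∷ 3F ∷ []) copy ⨾ pop 1F) g (ones g ∷ ones g ∷ [] ∷ [] ∷ [])
        (ones g ∷ [] ∷ [] ∷ ones j ∷ []))
           (+-identityʳ (g * g)) (go g 0)) l
    where
    go : ∀ i b → Loop Z (some 1F) (embed (0F ∷ 2F ∷ 3F ∷ []) copy ⨾ pop 1F) i (ones g ∷ ones i ∷ [] ∷ ones b ∷ [])
        (ones g ∷ [] ∷ [] ∷ ones (i * g + b) ∷ [])
    go zero    b = stop refl
    go (suc i) b = once refl (call (0F ∷ 2F ∷ 3F ∷ []) (copy-ones g l) ⨾ pop)
      (subst (λ j → Loop Z (some 1F) (embed (0F ∷ 2F ∷ 3F ∷ []) copy ⨾ pop 1F) i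
          (ones g ∷ ones i ∷ [] ∷ ones (g + b) ∷ []) (ones g ∷ [] ∷ [] ∷ ones j ∷ []))
        (trans (sym (+-assoc (i * g) g b)) (cong (_+ b) (+-comm (i * g) g))) (go i (g + b)))

  emit-run : ∀ x {N} → length x ≤ Z → Run Z emit (spellʳ x ∷ [] ∷ N ∷ []) (spellʳ x ∷ [] ∷ (spell x ʳ++ N) ∷ [])
  emit-run x {N} l =
    call (0F ∷ 1F ∷ []) (subst (λ u → Run Z shift (spellʳ x ∷ [] ∷ []) ([] ∷ u ∷ []))
        (trans (spellʳ-ʳ x) (++-identityʳ (spell x)))
      (shift-run (spellʳ x) (≤-trans (≤-reflexive (length-spellʳ x)) l))) ⨾
    call (1F ∷ 0F ∷ 2F ∷ []) (subst (λ u → Run Z fork (spell x ∷ [] ∷ N ∷ []) ([] ∷ u ∷ (spell x ʳ++ N) ∷ [])) (spell-ʳ x)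
      (fork-run (spell x) (≤-trans (≤-reflexive (length-map ltr x)) l)))

  none : Value
  none _ _ = []

  -- Lists of words are stored as tables with empty second components, so that `forRows` serves both
  -- kinds of table.
  singles : List (Word k) → Pairs
  singles = map (_, [])

  wordTable : List (Word k) → Stack
  wordTable ws = tab none (singles ws)

  tabʳ-++ : ∀ v ps qs {t} → tabʳ v (ps ++ qs) t ≡ tabʳ v qs (tabʳ v ps t)
  tabʳ-++ v []       qs = refl
  tabʳ-++ v (p ∷ ps) qs = tabʳ-++ v ps qs

  tabʳ-concatMap : ∀ v (h : Word k × Word k → Pairs) ps {t} →
    foldl (λ t p → tabʳ v (h p) t) t ps ≡ tabʳ v (concatMap h ps) t
  tabʳ-concatMap v h []       = refl
  tabʳ-concatMap v h (p ∷ ps) {t} = trans (tabʳ-concatMap v h ps) (sym (tabʳ-++ v (h p) (concatMap h ps)))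

  unread : ∀ v ps {t} → length (tab v ps) ≤ Z → Run Z shift (tabʳ v ps [] ∷ [] ∷ t) ([] ∷ tab v ps ∷ t)
  unread v ps {[]} l = subst (λ u → Run Z shift (tabʳ v ps [] ∷ [] ∷ []) ([] ∷ u ∷ [])) (tabʳ-ʳ v ps [])
    (shift-run (tabʳ v ps []) (≤-trans (≤-reflexive (trans (sym (length-ʳ (tabʳ v ps [])))
        (cong length (tabʳ-ʳ v ps [])))) l))

  extensions : Word k × Word k → Pairs
  extensions (x , _) = map (λ a → a ∷ x , []) (allFin k)

  longer-run : ∀ a x {W W′ ry N} → length x ≤ Z →
    Run Z (longer a) (W ∷ W′ ∷ spellʳ x ∷ ry ∷ N ∷ [] ∷ [])
        (W ∷ W′ ∷ spellʳ x ∷ ry ∷ tabʳ none ((a ∷ x , []) ∷ []) N ∷ [] ∷ [])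
  longer-run a x l = push ⨾ call (2F ∷ 5F ∷ 4F ∷ []) (emit-run x l) ⨾ push ⨾ push ⨾ push

  each-longer : ∀ as x {W W′ ry N} → length x ≤ Z →
    Run Z (each longer as) (W ∷ W′ ∷ spellʳ x ∷ ry ∷ N ∷ [] ∷ [])
      (W ∷ W′ ∷ spellʳ x ∷ ry ∷ tabʳ none (map (λ a → a ∷ x , []) as) N ∷ [] ∷ [])
  each-longer []       x l = skip
  each-longer (a ∷ as) x l = longer-run a x l ⨾ each-longer as x l

  singles-words : ∀ ws → concatMap extensions (singles ws) ≡ singles (concatMap (λ w → map (_∷ w) (allFin k)) ws)
  singles-words []       = refl
  singles-words (w ∷ ws) = trans (cong₂ _++_ (go (allFin k)) (singles-words ws))
      (sym (map-++ (_, []) (map (_∷ w) (allFin k)) _))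
    where
    go : ∀ as → map (λ a → a ∷ w , []) as ≡ singles (map (_∷ w) as)
    go []       = refl
    go (a ∷ as) = cong (_ ∷_) (go as)

  words-short : ∀ i → i ≤ Z → Short (singles (words k i))
  words-short i l = All.map⁺ (All.tabulate (λ {w} w∈ → ≤-trans (∈-words⁻ i w∈) l , z≤n))

  grow-run : ∀ i → i ≤ Z → length (wordTable (words k i)) ≤ Z → length (wordTable (words k (suc i))) ≤ Z →
    Run Z grow (wordTable (words k i) ∷ [] ∷ [] ∷ [] ∷ [] ∷ [] ∷ [])
        (wordTable (words k (suc i)) ∷ [] ∷ [] ∷ [] ∷ [] ∷ [] ∷ [])
  grow-run i i≤Z l l′ =
    (push ⨾ push ⨾ push) ⨾
    forRows-run (λ N → N ∷ [] ∷ []) (λ N p → tabʳ none (extensions p) N) {v = none} {v′ = none} (λ qs _ → Short qs)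
      (λ { {x} ((lx , _) ∷ _) → each-longer (allFin k) x lx }) (λ { (_ ∷ s) → s })
      (singles (words k i)) (words-short i i≤Z) l l ⨾
    call (0F ∷ []) (clear-run (wordTable (words k i)) l) ⨾
    call (4F ∷ 0F ∷ []) (subst (λ u → Run Z shift (u ∷ [] ∷ []) ([] ∷ wordTable (words k (suc i)) ∷ [])) built
      (unread none (singles (words k (suc i))) l′))
    where
    built : tabʳ none (singles (words k (suc i))) [] ≡ foldl (λ N p → tabʳ none (extensions p) N)
        (tabʳ none (([] , []) ∷ []) []) (singles (words k i))
    built = sym (trans (tabʳ-concatMap none extensions (singles (words k i)))
                       (cong (λ qs → tabʳ none qs (tabʳ none (([] , []) ∷ []) [])) (singles-words (words k i))))

  growAll-run : ∀ i j → i + j ≤ Z → (∀ h → h ≤ i + j → length (wordTable (words k h)) ≤ Z) →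
    Run Z growAll (wordTable (words k i) ∷ [] ∷ [] ∷ [] ∷ [] ∷ [] ∷ ones j ∷ [])
        (wordTable (words k (i + j)) ∷ [] ∷ [] ∷ [] ∷ [] ∷ [] ∷ [] ∷ [])
  growAll-run i j l h = loop (go i j l h) (≤-trans (m≤n+m j i) l)
    where
    go : ∀ i j → i + j ≤ Z → (∀ h → h ≤ i + j → length (wordTable (words k h)) ≤ Z) →
      Loop Z (some 6F) (embed (0F ∷ 1F ∷ 2F ∷ 3F ∷ 4F ∷ 5F ∷ []) grow ⨾ pop 6F) j
        (wordTable (words k i) ∷ [] ∷ [] ∷ [] ∷ [] ∷ [] ∷ ones j ∷ [])
            (wordTable (words k (i + j)) ∷ [] ∷ [] ∷ [] ∷ [] ∷ [] ∷ [] ∷ [])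
    go i zero    l h = subst (λ e → Loop Z (some 6F) (embed (0F ∷ 1F ∷ 2F ∷ 3F ∷ 4F ∷ 5F ∷ []) grow ⨾ pop 6F) 0
        (wordTable (words k i) ∷ [] ∷ [] ∷ [] ∷ [] ∷ [] ∷ [] ∷ [])
            (wordTable (words k e) ∷ [] ∷ [] ∷ [] ∷ [] ∷ [] ∷ [] ∷ []))
      (sym (+-identityʳ i)) (stop refl)
    go i (suc j) l h = once refl
      (call (0F ∷ 1F ∷ 2F ∷ 3F ∷ 4F ∷ 5F ∷ []) (grow-run i (≤-trans (m≤m+n i _) l) (h i (m≤m+n i _))
          (h (suc i) (≤-trans (m≤m+n (suc i) j) (≤-reflexive (sym (+-suc i j)))))) ⨾ pop)
      (subst (λ e → Loop Z (some 6F) (embed (0F ∷ 1F ∷ 2F ∷ 3F ∷ 4F ∷ 5F ∷ []) grow ⨾ pop 6F) j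
        (wordTable (words k (suc i)) ∷ [] ∷ [] ∷ [] ∷ [] ∷ [] ∷ ones j ∷ [])
            (wordTable (words k e) ∷ [] ∷ [] ∷ [] ∷ [] ∷ [] ∷ [] ∷ []))
        (sym (+-suc i j)) (go (suc i) j (≤-trans (≤-reflexive (sym (+-suc i j))) l)
            (λ e le → h e (≤-trans le (≤-reflexive (sym (+-suc i j)))))))

  pairsOf : List (Word k) → Pairs
  pairsOf ws = concatMap (λ (x , _) → map (λ (y , _) → x , y) (singles ws)) (singles ws)

  pairTable-run : ∀ ws → Short (singles ws) → length (wordTable ws) ≤ Z →
    Run Z pairTable (wordTable ws ∷ [] ∷ [] ∷ [] ∷ [] ∷ [] ∷ [] ∷ [] ∷ [] ∷ [] ∷ [])
                    (wordTable ws ∷ [] ∷ [] ∷ [] ∷ wordTable ws ∷ [] ∷ [] ∷ [] ∷ tabʳ none (pairsOf ws) [] ∷ [] ∷ [])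
  pairTable-run ws s l =
    subst (λ u → Run Z pairTable (wordTable ws ∷ [] ∷ [] ∷ [] ∷ [] ∷ [] ∷ [] ∷ [] ∷ [] ∷ [] ∷ [])
                    (wordTable ws ∷ [] ∷ [] ∷ [] ∷ wordTable ws ∷ [] ∷ [] ∷ [] ∷ u ∷ [] ∷ []))
      (tabʳ-concatMap none (λ (x , _) → map (λ (y , _) → x , y) (singles ws)) (singles ws))
      (call (0F ∷ 1F ∷ 4F ∷ []) (copy-fresh (wordTable ws) l) ⨾
       forRows-run (λ N → wordTable ws ∷ [] ∷ [] ∷ [] ∷ N ∷ [] ∷ [])
           (λ N (x , _) → tabʳ none (map (λ (y , _) → x , y) (singles ws)) N) {v = none} {v′ = none}
           (λ qs _ → Short qs)
         (λ { {x} {a = N} ((lx , _) ∷ _) → call (4F ∷ 5F ∷ 6F ∷ 7F ∷ 2F ∷ 8F ∷ 9F ∷ [])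
           (subst (λ u → Run Z (forRows pairRow) (wordTable ws ∷ [] ∷ [] ∷ [] ∷ spellʳ x ∷ N ∷ [] ∷ [])
               (wordTable ws ∷ [] ∷ [] ∷ [] ∷ spellʳ x ∷ u ∷ [] ∷ []))
             (inner x (singles ws))
             (forRows-run (λ N → spellʳ x ∷ N ∷ [] ∷ []) (λ N (y , _) → rowʳ x y [] N) {v = none} {v′ = none}
                 (λ qs _ → Short qs)
               (λ { {y} ((ly , _) ∷ _) → call (4F ∷ 6F ∷ 5F ∷ []) (emit-run x lx) ⨾ push ⨾ call (2F ∷ 6F ∷ 5F ∷ [])
                   (emit-run y ly) ⨾ push ⨾ push })
               (λ { (_ ∷ s) → s }) (singles ws) s l l)) })
         (λ { (_ ∷ s) → s }) (singles ws) s l l)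
    where
    inner : ∀ x qs {N} → foldl (λ N (y , _) → rowʳ x y [] N) N qs ≡ tabʳ none (map (λ (y , _) → x , y) qs) N
    inner x []       = refl
    inner x (q ∷ qs) = inner x qs

-- Programs for Moore's refinement and for writing the automaton

module Automata (k : ℕ) where

  open Programs k DFASymbol

  -- On (T , T′ , rx , ry , O , O′ , a , b , t , m , F , K).
  startRow : P 12
  startRow =
    embed (2F ∷ 8F ∷ # 11 ∷ []) copy ⨾
    embed (4F ∷ 5F ∷ 6F ∷ 7F ∷ 2F ∷ # 11 ∷ 8F ∷ 9F ∷ # 10 ∷ []) look ⨾
    embed (# 11 ∷ []) clear ⨾
    embed (3F ∷ 8F ∷ # 11 ∷ []) copy ⨾
    embed (4F ∷ 5F ∷ 6F ∷ 7F ∷ 3F ∷ # 11 ∷ 8F ∷ 9F ∷ # 10 ∷ []) look ⨾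
    embed (# 11 ∷ []) clear ⨾
    embed (0F ∷ # 10 ∷ []) setTop ⨾
    push (# 10) (λ ts → bit (topBit (# 10) ts xor topBit 0F ts)) ⨾
    embed (0F ∷ # 10 ∷ []) setTop ⨾ pop (# 10)

  -- On (T , T′ , rx , ry , O , O′ , a , b , t , m , F).
  refineRow : Fin k → P 11
  refineRow a =
    push 2F (λ _ → ltr a) ⨾ push 3F (λ _ → ltr a) ⨾
    embed (4F ∷ 5F ∷ 6F ∷ 7F ∷ 2F ∷ 3F ∷ 8F ∷ 9F ∷ # 10 ∷ []) look ⨾
    pop 2F ⨾ pop 3F ⨾
    push (# 10) (λ ts → bit (topBit (# 10) ts ∨ topBit 0F ts)) ⨾
    embed (0F ∷ # 10 ∷ []) setTop ⨾ pop (# 10)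

  -- One round must consult only the entries of the previous round, so it looks them up in a copy.
  refine : P 11
  refine = embed (0F ∷ 1F ∷ 4F ∷ []) copy ⨾ forRows (each refineRow (allFin k)) ⨾ embed (4F ∷ []) clear

  refineAll : P 12
  refineAll = loop (some (# 11)) (embed (0F ∷ 1F ∷ 2F ∷ 3F ∷ 4F ∷ 5F ∷ 6F ∷ 7F ∷ 8F ∷ 9F ∷ # 10 ∷ []) refine ⨾ pop (# 11))

  -- On (Q , Q′ , a , b , T , T′ , c , d , rx , t , m , F , mm).
  compareRow : P 13
  compareRow =
    embed (4F ∷ 5F ∷ 6F ∷ 7F ∷ 2F ∷ 8F ∷ 9F ∷ # 10 ∷ # 11 ∷ []) look ⨾
    branch (topBit (# 11)) skip (mark (# 12)) ⨾ pop (# 11)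

  -- On (W , W′ , rx , ry , Q , Q′ , a , b , T , T′ , c , d , t , m , F , mm).
  collectRow : P 16
  collectRow =
    embed (4F ∷ 5F ∷ 6F ∷ 7F ∷ 8F ∷ 9F ∷ # 10 ∷ # 11 ∷ 2F ∷ # 12 ∷ # 13 ∷ # 14 ∷ # 15 ∷ []) (forRows compareRow) ⨾
    branch (some (# 15)) skip
      (push 4F (λ _ → eor) ⨾ push 4F (λ _ → hash) ⨾ push 4F (λ _ → hash) ⨾
       embed (2F ∷ # 12 ∷ 4F ∷ []) fork ⨾ embed (# 12 ∷ 2F ∷ []) shift) ⨾
    embed (# 15 ∷ []) clear

  -- On (Q , Q′ , a , b , T , T′ , c , d , rr , t , m , F , mm , N).
  countRow : P 14
  countRow =
    embed (4F ∷ 5F ∷ 6F ∷ 7F ∷ 2F ∷ 8F ∷ 9F ∷ # 10 ∷ # 11 ∷ []) look ⨾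
    branch (some (# 12)) skip (branch (topBit (# 11)) (push (# 13) (λ _ → out tick)) (mark (# 12))) ⨾ pop (# 11)

  -- One tick is written for each representative before the first one that is not separated from the
  -- word; the mark remembers that it has been passed.
  index : P 14
  index = forRows countRow ⨾ push (# 13) (λ _ → out end) ⨾ embed (# 12 ∷ []) clear

  -- On (Q₂ , Q₂′ , rq , ry , Q , Q′ , a , b , T , T′ , c , d , t , m , F , mm , N , L , K).
  successor : Fin k → P 19
  successor a =
    push 2F (λ _ → ltr a) ⨾
    embed (4F ∷ 5F ∷ 6F ∷ 7F ∷ 8F ∷ 9F ∷ # 10 ∷ # 11 ∷ 2F ∷ # 12 ∷ # 13 ∷ # 14 ∷ # 15 ∷ # 16 ∷ []) index ⨾
    pop 2F

  stateRow : P 19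
  stateRow =
    embed (2F ∷ # 12 ∷ # 18 ∷ []) copy ⨾
    embed (# 17 ∷ 9F ∷ # 10 ∷ # 11 ∷ 2F ∷ # 18 ∷ # 12 ∷ # 13 ∷ # 14 ∷ []) look ⨾
    embed (# 18 ∷ []) clear ⨾
    push (# 16) (λ ts → out (status (topBit (# 14) ts))) ⨾ pop (# 14) ⨾
    each successor (allFin k)

  writeDFA : P 19
  writeDFA =
    embed (4F ∷ 5F ∷ 6F ∷ 7F ∷ 8F ∷ 9F ∷ # 10 ∷ # 11 ∷ 2F ∷ # 12 ∷ # 13 ∷ # 14 ∷ # 15 ∷ # 16 ∷ []) index ⨾
    embed (4F ∷ # 12 ∷ 0F ∷ []) copy ⨾
    forRows stateRow

  -- On the registers of prepare, followed by (L , Q , Q′ , c , d , mm , K).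
  dfaProgram : ℕ → P 28
  dfaProgram e =
    embed (0F ∷ 1F ∷ 2F ∷ 3F ∷ 4F ∷ 5F ∷ 6F ∷ 7F ∷ 8F ∷ 9F ∷ # 10 ∷ # 11 ∷ # 12 ∷ # 13 ∷ # 14 ∷ # 15 ∷ # 16 ∷ # 17 ∷ #
        18 ∷ # 19 ∷ # 20 ∷ [])
      (Main.prepare k DFASymbol e) ⨾
    embed (1F ∷ 9F ∷ # 21 ∷ []) copy ⨾
    embed (1F ∷ 2F ∷ 3F ∷ 4F ∷ # 21 ∷ 6F ∷ 7F ∷ 8F ∷ 9F ∷ # 10 ∷ # 11 ∷ # 27 ∷ []) (forRows startRow) ⨾
    embed (# 16 ∷ 9F ∷ # 17 ∷ []) copy ⨾
    embed (1F ∷ 2F ∷ 3F ∷ 4F ∷ 5F ∷ 6F ∷ 7F ∷ 8F ∷ 9F ∷ # 10 ∷ # 11 ∷ # 17 ∷ []) refineAll ⨾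
    embed (# 20 ∷ 6F ∷ 3F ∷ 4F ∷ # 22 ∷ # 23 ∷ 7F ∷ 8F ∷ 1F ∷ 2F ∷ # 24 ∷ # 25 ∷ 9F ∷ # 10 ∷ # 11 ∷ # 26 ∷ [])
        (forRows collectRow) ⨾
    embed (5F ∷ 6F ∷ 3F ∷ 4F ∷ # 22 ∷ # 23 ∷ 7F ∷ 8F ∷ 1F ∷ 2F ∷ # 24 ∷ # 25 ∷ 9F ∷ # 10 ∷ # 11 ∷ # 26 ∷ # 18 ∷ # 21 ∷
        # 27 ∷ []) writeDFA ⨾
    embed (# 18 ∷ 0F ∷ []) shift

module Truths (k : ℕ) where

  open Programs k Bool

  -- The first row belongs to the pair of empty words; the two pops remove its separators and expose
  -- its truth value.
  truthProgram : ℕ → P 21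
  truthProgram e =
    Main.prepare k Bool e ⨾ pop 1F ⨾ pop 1F ⨾
    branch (topBit 1F) (push 0F (λ _ → out true)) (push 0F (λ _ → out false))

-- Choice of the bounds and the common run of both machines

module Setup (k : ℕ) (O : Set) (Z : ℕ) (2≤Z : 2 ≤ Z) (φ : FO k 2) where

  open Programs k O
  open Basics k O Z
  open Tests k O Z
  open Preparation k O Z
  open Main k O

  scaleₖ : ℕ
  scaleₖ = 3 * (2 + k)

  -- g is the margin that a quantifier may consume, and `g * g` is the initial level, enough for
  -- `3 + ∣ φ ∣` margins. The summand g in B comes from growing the list of words in two stages.
  g B : ℕ
  g = exp₂ (scaleₖ * ∣ φ ∣)
  B = g + g * g

  ps : Pairs
  ps = pairsOf (words k B)

  g≤B : g ≤ B
  g≤B = m≤m+n g (g * g)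

  size≤g : ∣ φ ∣ ≤ g
  size≤g = ≤-trans (m≤n*m ∣ φ ∣ scaleₖ) (n≤exp₂ (scaleₖ * ∣ φ ∣))

  ps-sound : All (λ (x , y) → length x ≤ B × length y ≤ B) ps
  ps-sound = All.tabulate go
    where
    go : ∀ {p} → p ∈ ps → length (proj₁ p) ≤ B × length (proj₂ p) ≤ B
    go i with p , p∈ , i′ ← find (∈-concatMap⁻ (λ (x , _) → map (λ (y , _) → x , y) (singles (words k B)))
        {xs = singles (words k B)} i)
      with q , q∈ , refl ← ∈-map⁻ (λ (y , _) → proj₁ p , y) i′
      with x , x∈ , refl ← ∈-map⁻ (_, []) p∈
      with y , y∈ , refl ← ∈-map⁻ (_, []) q∈ = ∈-words⁻ B x∈ , ∈-words⁻ B y∈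

  ps-complete : ∀ {x y} → length x ≤ B → length y ≤ B → (x , y) ∈ ps
  ps-complete {x} {y} lx ly = ∈-concatMap⁺ (λ (x , _) → map (λ (y , _) → x , y) (singles (words k B)))
    (lose (∈-map⁺ (_, []) (∈-words⁺ B lx)) (∈-map⁺ (λ (y , _) → x , y) (∈-map⁺ (_, []) (∈-words⁺ B ly))))

  module Sized (B≤Z : B ≤ Z)
           (words≤ : ∀ h → h ≤ B → length (wordTable (words k h)) ≤ Z)
           (tab≤ : ∀ (w : Value) → (∀ x y → length (w x y) ≤ ∣ φ ∣) → length (tab w ps) ≤ Z) where

    g≤Z : g ≤ Z
    g≤Z = ≤-trans g≤B B≤Z

    size≤Z : ∣ φ ∣ ≤ Z
    size≤Z = ≤-trans size≤g g≤Z

    ps-short : Short ps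
    ps-short = All.map (λ (lx , ly) → ≤-trans lx B≤Z , ≤-trans ly B≤Z) ps-sound

    open Evaluation k O Z 2≤Z ps ps-short (∣ φ ∣) size≤Z tab≤ g g≤Z public
    open Semantics k O Z 2≤Z ps ps-short (∣ φ ∣) size≤Z tab≤ g g≤Z B ps-complete (∣ φ ∣)
        (λ ψ l → <⇒≤ (weight<reach ψ l)) public

    level : ℕ
    level = after φ (g * g)

    truth : Word k → Word k → Bool
    truth = value φ (g * g)

    g-large : 3 + ∣ φ ∣ ≤ g
    g-large = ≤-trans (+-monoˡ-≤ ∣ φ ∣ (*-monoʳ-≤ 3 (size>0 φ)))
      (≤-trans (≤-reflexive (+-comm (3 * ∣ φ ∣) ∣ φ ∣))
        (≤-trans (*-monoˡ-≤ ∣ φ ∣ (≤-trans (m≤m+n 4 2) (*-monoʳ-≤ 3 (s≤s (s≤s (z≤n {k})))))) (n≤exp₂ (scaleₖ * ∣ φ ∣))))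

    finalStore : Store Σ′ 21
    finalStore = [] ∷ (tab (truth ◂ none) ps ∷ [] ∷ [] ∷ [] ∷ [] ∷ [] ∷ [] ∷ [] ∷ [] ∷ [] ∷ [] ∷ ones level ∷ [] ∷ []
        ∷ [] ∷ ones g ∷
                 [] ∷ [] ∷ wordTable (words k B) ∷ wordTable (words k g) ∷ [])

    prepare-run : Run Z (prepare scaleₖ) (input-of φ ∷ Vec.replicate 20 []) finalStore
    prepare-run =
      call (0F ∷ # 15 ∷ # 17 ∷ # 16 ∷ 9F ∷ []) (bound-run scaleₖ (encode φ) g≤Z size≤Z) ⨾
      call (# 16 ∷ # 17 ∷ 9F ∷ # 12 ∷ []) (square-run g g≤Z) ⨾
      push ⨾ push ⨾ push ⨾
      call (# 16 ∷ 9F ∷ # 17 ∷ []) (copy₀ g g≤Z) ⨾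
      call (# 19 ∷ 2F ∷ 3F ∷ 4F ∷ # 18 ∷ 9F ∷ # 17 ∷ []) (growAll-run 0 g g≤Z (λ h l → words≤ h (≤-trans l g≤B))) ⨾
      call (# 19 ∷ 9F ∷ # 20 ∷ []) (copy-fresh (wordTable (words k g)) (words≤ g g≤B)) ⨾
      call (# 12 ∷ 9F ∷ # 17 ∷ []) (copy₀ (g * g) (≤-trans (m≤n+m _ g) B≤Z)) ⨾
      call (# 19 ∷ 2F ∷ 3F ∷ 4F ∷ # 18 ∷ 9F ∷ # 17 ∷ []) (growAll-run g (g * g) B≤Z words≤) ⨾
      call (# 19 ∷ 2F ∷ 3F ∷ 4F ∷ 5F ∷ 6F ∷ 7F ∷ 8F ∷ # 18 ∷ 9F ∷ [])
          (pairTable-run (words k B) (words-short B B≤Z) (words≤ B ≤-refl)) ⨾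
      call (5F ∷ []) (clear-run (wordTable (words k B)) (words≤ B ≤-refl)) ⨾
      call (# 18 ∷ 1F ∷ []) (unread none ps (tab≤ none (λ _ _ → z≤n))) ⨾
      call (1F ∷ 2F ∷ 3F ∷ 4F ∷ 5F ∷ 6F ∷ 7F ∷ 8F ∷ 9F ∷ # 10 ∷ # 11 ∷ # 12 ∷ # 13 ∷ # 14 ∷ # 15 ∷ # 16 ∷ [])
        (loop (eval-run φ {none} {g * g} {[]} {0} (λ _ _ → ≤-refl) (stop refl))
            (≤-trans (≤-reflexive (+-identityʳ ∣ φ ∣)) size≤Z))
      where
      copy₀ : ∀ a → a ≤ Z → Run Z copy (ones a ∷ [] ∷ [] ∷ []) (ones a ∷ [] ∷ ones a ∷ [])
      copy₀ a l = subst (λ j → Run Z copy (ones a ∷ [] ∷ [] ∷ []) (ones a ∷ [] ∷ ones j ∷ [])) (+-identityʳ a)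
          (copy-ones a {0} l)

    -- Successor words of length `suc g`, followed by separating words of length g, must still be in
    -- the reliable zone.
    level-large : 3 * g ≤ level
    level-large = +-cancelʳ-≤ (∣ φ ∣ * g) _ _ (begin
      3 * g + ∣ φ ∣ * g       ≡⟨ *-distribʳ-+ g 3 ∣ φ ∣ ⟨
      (3 + ∣ φ ∣) * g         ≤⟨ *-monoˡ-≤ g g-large ⟩
      g * g                   ≤⟨ ≤after φ (g * g) ⟩
      level + ∣ φ ∣ * g       ∎)
      where open ≤-Reasoning

    truth-correct : ∀ {x y} → length x ≤ level → length y ≤ level → truth x y ≡ ⌊ sat? φ (x ∷ y ∷ []) ⌋
    truth-correct = value-correct φ (g * g) ≤-refl (*-monoˡ-≤ g (≤-trans (m≤n+m _ 3) g-large)) (m≤n+m _ g)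

-- The minimal automaton

-- The number of the state of `w`, provided that some representative is not separated from `w`.
rankOf : ∀ {k} → (Word k → Word k → Bool) → List (Word k) → Word k → ℕ
rankOf d []       w = 0
rankOf d (q ∷ qs) w = if d q w then suc (rankOf d qs w) else 0

module Minimisation {k : ℕ} (L : Language k) (accepts : Word k → Bool)
  (accepts⇔ : ∀ w → T (accepts w) ⇔ L w) where

  Nerode : Word k → Word k → Set
  Nerode p q = ∀ w → L (p ++ w) ⇔ L (q ++ w)

  nerode-sym : ∀ {p q} → Nerode p q → Nerode q p
  nerode-sym h w = mk⇔ (from (h w)) (to (h w))

  nerode-trans : ∀ {p q r} → Nerode p q → Nerode q r → Nerode p r
  nerode-trans h h′ w = mk⇔ (to (h′ w) ∘ to (h w)) (from (h w) ∘ from (h′ w))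

  nerode-++ : ∀ {p q} u → Nerode p q → Nerode (p ++ u) (q ++ u)
  nerode-++ {p} {q} u h w = subst₂ (λ a b → L a ⇔ L b) (sym (++-assoc p u w)) (sym (++-assoc q u w)) (h (u ++ w))

  module _ (d : Word k → Word k → Bool) where

    rankOf< : ∀ {qs w} → Any (λ q → d q w ≡ false) qs → rankOf d qs w < length qs
    rankOf< {q ∷ qs} {w} p with d q w in e | p
    ... | false | _       = s≤s z≤n
    ... | true  | here f with () ← trans (sym e) f
    ... | true  | there i = s≤s (rankOf< i)

    rankOf-lookup : ∀ qs w (l : rankOf d qs w < length qs) → d (List.lookup qs (fromℕ< l)) w ≡ false
    rankOf-lookup (q ∷ qs) w l with d q w in e
    rankOf-lookup (q ∷ qs) w l       | false = e
    rankOf-lookup (q ∷ qs) w (s≤s l) | true  = rankOf-lookup qs w l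

    module _ (G : ℕ)
      (d-false : ∀ {p q} → length p ≤ suc G → length q ≤ suc G → d p q ≡ false ⇔ Nerode p q)
      (shorten : ∀ x → ∃ λ y → length y ≤ G × Nerode y x)
      (qs : List (Word k)) (short : All (λ q → length q ≤ G) qs)
      (distinct : AllPairs (λ p q → d q p ≡ true) qs)
      (cover : ∀ {x} → length x ≤ G → Any (λ q → d q x ≡ false) qs) where

      size : ℕ
      size = length qs

      state : Fin size → Word k
      state = List.lookup qs

      state-short : ∀ i → length (state i) ≤ G
      state-short i = All.lookup short (∈-lookup {xs = qs} i)

      -- `cover` stops at length G, one short of what successors need. The word is first replaced by
      -- a Nerode-equivalent one of length at most G, whose representative then serves for both.
      located : ∀ {x} → length x ≤ suc G → Any (λ q → d q x ≡ false) qs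
      located {x} l with y , ly , e ← shorten x with q , q∈ , f ← find (cover ly) =
        Any.map (λ { refl → from (d-false lq l) (nerode-trans (to (d-false lq (m≤n⇒m≤1+n ly)) f) e) }) q∈
        where
        lq : length q ≤ suc G
        lq = m≤n⇒m≤1+n (All.lookup short q∈)

      start : Fin size
      start = fromℕ< (rankOf< (located {[]} z≤n))

      class : Word k → Fin size
      class w with rankOf d qs w <? size
      ... | yes l = fromℕ< l
      -- A default that makes `class` total; it does not occur for words of length up to `suc G`,
      -- hence for no transition.
      ... | no  _ = start

      class-rank : ∀ {w} → length w ≤ suc G → toℕ (class w) ≡ rankOf d qs w
      class-rank {w} lw with rankOf d qs w <? size
      ... | yes l = toℕ-fromℕ< l
      ... | no ¬l = contradiction (rankOf< (located lw)) ¬l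

      class-nerode : ∀ {w} → length w ≤ suc G → Nerode (state (class w)) w
      class-nerode {w} lw with rankOf d qs w <? size
      ... | yes l = to (d-false (m≤n⇒m≤1+n (state-short (fromℕ< l))) lw) (rankOf-lookup qs w l)
      ... | no ¬l = contradiction (rankOf< (located lw)) ¬l

      start-nerode : Nerode (state start) []
      start-nerode = to (d-false (m≤n⇒m≤1+n (state-short start)) z≤n) (rankOf-lookup qs [] (rankOf< (located {[]} z≤n)))

      automaton : DFA k
      automaton = record
        { size  = size
        ; start = start
        ; δ     = λ i a → class (state i ++ [ a ])
        ; final = λ i → accepts (state i)
        }

      open DFA automaton using (δ)

      step-short : ∀ i a → length (state i ++ [ a ]) ≤ suc G
      step-short i a = ≤-trans (≤-reflexive (trans (length-++ (state i)) (+-comm _ 1))) (s≤s (state-short i))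

      run-nerode : ∀ w i → Nerode (state (foldl δ i w)) (state i ++ w)
      run-nerode []      i = subst (Nerode (state i)) (sym (++-identityʳ (state i))) (λ _ → mk⇔ id id)
      run-nerode (a ∷ w) i = nerode-trans (run-nerode w (δ i a))
        (subst (Nerode (state (δ i a) ++ w)) (++-assoc (state i) [ a ] w) (nerode-++ w (class-nerode (step-short i a))))

      recognizes : Recognizes automaton L
      recognizes = (λ {w} Lw → from (accepts⇔ _) (from (eq w) Lw)) , (λ {w} t → to (eq w) (to (accepts⇔ _) t))
        where
        eq : ∀ w → L (state (foldl δ start w)) ⇔ L w
        eq w = subst₂ (λ a b → L a ⇔ L b) (++-identityʳ _) (++-identityʳ _)
                 (nerode-trans (run-nerode w start) (nerode-++ w start-nerode) [])

      separated : ∀ {ps} → AllPairs (λ p q → d q p ≡ true) ps → ∀ i j → i ≢ j →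
                  d (List.lookup ps j) (List.lookup ps i) ≡ true ⊎ d (List.lookup ps i) (List.lookup ps j) ≡ true
      separated (a ∷ as) zero    zero    i≢j = contradiction refl i≢j
      separated {p ∷ ps} (a ∷ as) zero (suc j) _ = inj₁ (All.lookup a (∈-lookup {xs = ps} j))
      separated {p ∷ ps} (a ∷ as) (suc i) zero _ = inj₂ (All.lookup a (∈-lookup {xs = ps} i))
      separated (a ∷ as) (suc i) (suc j) i≢j = separated as i j (i≢j ∘ cong suc)

      -- Words that lead to the same state of an automaton for L are Nerode-equivalent, whereas
      -- different representatives are separated; so representatives inject into the states of `D`.
      minimal : ∀ D → Recognizes D L → size ≤ DFA.size D
      minimal D (L⊆ , ⊆L) = injective⇒≤ {f = reached} injective
        where
        module D = DFA D
        reached : Fin size → Fin D.size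
        reached i = foldl D.δ D.start (state i)
        nerode : ∀ {i j} → reached i ≡ reached j → Nerode (state i) (state j)
        nerode {i} {j} e w = mk⇔ (go e) (go (sym e))
          where
          go : ∀ {i j} → reached i ≡ reached j → L (state i ++ w) → L (state j ++ w)
          go {i} {j} e h = ⊆L (subst (T ∘ D.final)
            (trans (foldl-++ D.δ D.start (state i) w) (trans (cong (λ s → foldl D.δ s w) e)
                (sym (foldl-++ D.δ D.start (state j) w))))
            (L⊆ h))
        apart : ∀ i j → d (state i) (state j) ≡ true → ¬ Nerode (state i) (state j)
        apart i j e h with () ← trans (sym e) (from (d-false (m≤n⇒m≤1+n (state-short i)) (m≤n⇒m≤1+n (state-short j))) h)
        injective : ∀ {i j} → reached i ≡ reached j → i ≡ j
        injective {i} {j} e with i Fin.≟ j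
        ... | yes p = p
        ... | no i≢j with separated distinct i j i≢j
        ...   | inj₁ f = contradiction (nerode-sym (nerode {i} {j} e)) (apart j i f)
        ...   | inj₂ f = contradiction (nerode {i} {j} e) (apart i j f)

      canonical : IsCanonicalDFA automaton L
      canonical = recognizes , minimal

      rankCode : Word k → List DFASymbol
      rankCode w = replicate (rankOf d qs w) tick ++ [ end ]

      stateCode : Word k → List DFASymbol
      stateCode q = status (accepts q) ∷ concatMap (λ a → rankCode (q ++ [ a ])) (allFin k)

      encode-automaton : encodeDFA automaton ≡ rankCode [] ++ concatMap stateCode qs
      encode-automaton = cong₂ _++_
        (cong (λ i → replicate i tick ++ [ end ]) (toℕ-fromℕ< (rankOf< (located {[]} z≤n))))
        (trans (concatMap-cong (λ i → cong (status (accepts (state i)) ∷_)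
                 (concatMap-cong (λ a → cong (λ j → replicate j tick ++ [ end ]) (class-rank (step-short i a)))
                     (allFin k))) (allFin size))
          (cong concat (trans (map-∘ (allFin size)) (cong (map stateCode)
              (trans (map-tabulate id state) (tabulate-lookup qs))))))

-- Correctness of the machine that writes the automaton

module AutomatonRuns (k Z : ℕ) (2≤Z : 2 ≤ Z) (φ : FO k 2)
  (B≤Z : Setup.B k DFASymbol Z 2≤Z φ ≤ Z)
  (words≤ : ∀ h → h ≤ Setup.B k DFASymbol Z 2≤Z φ → length (Preparation.wordTable k DFASymbol Z (words k h)) ≤ Z)
  (tab≤ : ∀ (w : Word k → Word k → List Bool) → (∀ x y → length (w x y) ≤ ∣ φ ∣) →
          length (Basics.tab k DFASymbol Z w (Setup.ps k DFASymbol Z 2≤Z φ)) ≤ Z)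
  (reps≤ : ∀ qs → All (λ q → length q ≤ Setup.g k DFASymbol Z 2≤Z φ) qs →
           length qs ≤ length (words k (Setup.g k DFASymbol Z 2≤Z φ)) → length
               (Preparation.wordTable k DFASymbol Z qs) ≤ Z) where

  open Programs k DFASymbol
  open Basics k DFASymbol Z
  open Tests k DFASymbol Z
  open Preparation k DFASymbol Z
  open Setup k DFASymbol Z 2≤Z φ
  open Sized B≤Z words≤ tab≤
  open Automata k

  1≤Z : 1 ≤ Z
  1≤Z = ≤-trans (s≤s z≤n) 2≤Z

  one-bit : ∀ b → length (tab (b ◂ none) ps) ≤ Z
  one-bit b = tab≤ (b ◂ none) (λ _ _ → size>0 φ)

  -- The answer of a table scan. It is `b p q` for a pair in the table and `false` for a pair
  -- outside.
  entry-at : (Word k → Word k → Bool) → Word k → Word k → Bool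
  entry-at b p q = found b (λ x y → ⌊ x ≟ʷ p ⌋ ∧ ⌊ y ≟ʷ q ⌋) false ps

  spellʳ-snoc : ∀ x a → spellʳ (x ++ [ a ]) ≡ ltr a ∷ spellʳ x
  spellʳ-snoc x a = cong spell (reverse-++ x [ a ])

  LookStore : (Word k → Word k → Bool) → Stack → Stack → Stack → Store Σ′ 9
  LookStore b kx ky F = tab (b ◂ none) ps ∷ [] ∷ [] ∷ [] ∷ kx ∷ ky ∷ [] ∷ [] ∷ F ∷ []

  look-at : ∀ b p q {F} → Run Z look (LookStore b (spellʳ p) (spellʳ q) F)
      (LookStore b (spellʳ p) (spellʳ q) (bit (entry-at b p q) ∷ F))
  look-at b p q = look-run 2≤Z (b ◂ none) ps p q ps-short (one-bit b)

  copy-word : ∀ x → length x ≤ Z → Run Z copy (spellʳ x ∷ [] ∷ [] ∷ []) (spellʳ x ∷ [] ∷ spellʳ x ∷ [])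
  copy-word x l = copy-fresh (spellʳ x) (≤-trans (≤-reflexive (length-spellʳ x)) l)

  clear-word : ∀ x → length x ≤ Z → Run Z clear (spellʳ x ∷ []) ([] ∷ [])
  clear-word x l = clear-run (spellʳ x) (≤-trans (≤-reflexive (length-spellʳ x)) l)

  -- Membership of a word is read off the diagonal, where both variables have that word as value.
  initialDifference : (Word k → Word k → Bool) → Word k → Word k → Bool
  initialDifference b x y = entry-at b x x xor entry-at b y y

  StartStore : (Word k → Word k → Bool) → Stack → Stack → Word k → Word k → Stack → Stack → Store Σ′ 12
  StartStore b R t x y F K = R ∷ t ∷ spellʳ x ∷ spellʳ y ∷ tab (b ◂ none) ps ∷ [] ∷ [] ∷ [] ∷ [] ∷ [] ∷ F ∷ K ∷ []

  startRow-run : ∀ b x y {old rest t} → length x ≤ Z → length y ≤ Z →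
    Run Z startRow (StartStore b (old ∷ rest) t x y [] [])
        (StartStore b (bit (initialDifference b x y) ∷ rest) t x y [] [])
  startRow-run b x y {old} {rest} {t} lx ly =
    call (2F ∷ 8F ∷ # 11 ∷ []) (copy-word x lx) ⨾⟨ StartStore b (old ∷ rest) t x y [] (spellʳ x) ⟩
    call (4F ∷ 5F ∷ 6F ∷ 7F ∷ 2F ∷ # 11 ∷ 8F ∷ 9F ∷ # 10 ∷ []) (look-at b x x)
        ⨾⟨ StartStore b (old ∷ rest) t x y (ex ∷ []) (spellʳ x) ⟩
    call (# 11 ∷ []) (clear-word x lx) ⨾⟨ StartStore b (old ∷ rest) t x y (ex ∷ []) [] ⟩
    call (3F ∷ 8F ∷ # 11 ∷ []) (copy-word y ly) ⨾⟨ StartStore b (old ∷ rest) t x y (ex ∷ []) (spellʳ y) ⟩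
    call (4F ∷ 5F ∷ 6F ∷ 7F ∷ 3F ∷ # 11 ∷ 8F ∷ 9F ∷ # 10 ∷ []) (look-at b y y)
        ⨾⟨ StartStore b (old ∷ rest) t x y (ey ∷ ex ∷ []) (spellʳ y) ⟩
    call (# 11 ∷ []) (clear-word y ly) ⨾⟨ StartStore b (old ∷ rest) t x y (ey ∷ ex ∷ []) [] ⟩
    call (0F ∷ # 10 ∷ []) setTop-run ⨾⟨ StartStore b (ey ∷ rest) t x y (ex ∷ []) [] ⟩
    push ⨾⟨ StartStore b (ey ∷ rest) t x y (bit (initialDifference b x y) ∷ ex ∷ []) [] ⟩
    call (0F ∷ # 10 ∷ []) setTop-run ⨾⟨ StartStore b (bit (initialDifference b x y) ∷ rest) t x y (ex ∷ []) [] ⟩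
    pop
    where
    ex ey : Σ′
    ex = bit (entry-at b x x)
    ey = bit (entry-at b y y)

  startTable-run : ∀ b →
    Run Z (forRows startRow)
      (tab (b ◂ none) ps ∷ [] ∷ [] ∷ [] ∷ tab (b ◂ none) ps ∷ [] ∷ [] ∷ [] ∷ [] ∷ [] ∷ [] ∷ [] ∷ [])
      (tab (initialDifference b ◂ none) ps ∷ [] ∷ [] ∷ [] ∷ tab (b ◂ none) ps ∷ [] ∷ [] ∷ [] ∷ [] ∷ [] ∷ [] ∷ [] ∷ [])
  startTable-run b = forRows⊤ {v = b ◂ none} {v′ = initialDifference b ◂ none}
    (λ {x} {y} lx ly → startRow-run b x y lx ly) (one-bit b) (one-bit (initialDifference b))

  refineBit : (Word k → Word k → Bool) → Word k → Word k → Bool → List (Fin k) → Bool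
  refineBit b x y acc []       = acc
  refineBit b x y acc (a ∷ as) = refineBit b x y (entry-at b (x ++ [ a ]) (y ++ [ a ]) ∨ acc) as

  refined : (Word k → Word k → Bool) → Word k → Word k → Bool
  refined b x y = refineBit b x y (b x y) (allFin k)

  RefineStore : (Word k → Word k → Bool) → Bool → Stack → Stack → Stack → Stack → Stack → Store Σ′ 11
  RefineStore b acc rest t rx ry F =
    (bit acc ∷ eor ∷ rest) ∷ t ∷ rx ∷ ry ∷ tab (b ◂ none) ps ∷ [] ∷ [] ∷ [] ∷ [] ∷ [] ∷ F ∷ []

  refineRow-run : ∀ b a x y acc {rest t} →
    Run Z (refineRow a) (RefineStore b acc rest t (spellʳ x) (spellʳ y) [])
      (RefineStore b (entry-at b (x ++ [ a ]) (y ++ [ a ]) ∨ acc) rest t (spellʳ x) (spellʳ y) [])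
  refineRow-run b a x y acc {rest} {t} =
    push ⨾⟨ RefineStore b acc rest t xa (spellʳ y) [] ⟩
    push ⨾⟨ RefineStore b acc rest t xa ya [] ⟩
    call (4F ∷ 5F ∷ 6F ∷ 7F ∷ 2F ∷ 3F ∷ 8F ∷ 9F ∷ # 10 ∷ [])
      (subst₂ (λ u v → Run Z look (LookStore b u v []) (LookStore b u v (bit e ∷ [])))
        (spellʳ-snoc x a) (spellʳ-snoc y a) (look-at b (x ++ [ a ]) (y ++ [ a ])))
      ⨾⟨ RefineStore b acc rest t xa ya (bit e ∷ []) ⟩
    pop ⨾⟨ RefineStore b acc rest t (spellʳ x) ya (bit e ∷ []) ⟩
    pop ⨾⟨ RefineStore b acc rest t (spellʳ x) (spellʳ y) (bit e ∷ []) ⟩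
    push ⨾⟨ RefineStore b acc rest t (spellʳ x) (spellʳ y) (bit (e ∨ acc) ∷ bit e ∷ []) ⟩
    call (0F ∷ # 10 ∷ []) setTop-run ⨾⟨ RefineStore b (e ∨ acc) rest t (spellʳ x) (spellʳ y) (bit e ∷ []) ⟩
    pop
    where
    e : Bool
    e = entry-at b (x ++ [ a ]) (y ++ [ a ])
    xa ya : Stack
    xa = ltr a ∷ spellʳ x
    ya = ltr a ∷ spellʳ y

  each-refineRow : ∀ b as x y acc {rest t} →
    Run Z (each refineRow as) (RefineStore b acc rest t (spellʳ x) (spellʳ y) [])
      (RefineStore b (refineBit b x y acc as) rest t (spellʳ x) (spellʳ y) [])
  each-refineRow b []       x y acc = skip
  each-refineRow b (a ∷ as) x y acc = refineRow-run b a x y acc ⨾ each-refineRow b as x y _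

  refine-run : ∀ b →
    Run Z refine (tab (b ◂ none) ps ∷ [] ∷ [] ∷ [] ∷ [] ∷ [] ∷ [] ∷ [] ∷ [] ∷ [] ∷ [] ∷ [])
                 (tab (refined b ◂ none) ps ∷ [] ∷ [] ∷ [] ∷ [] ∷ [] ∷ [] ∷ [] ∷ [] ∷ [] ∷ [] ∷ [])
  refine-run b =
    call (0F ∷ 1F ∷ 4F ∷ []) (copy-fresh (tab (b ◂ none) ps) (one-bit b)) ⨾
    forRows⊤ {v = b ◂ none} {v′ = refined b ◂ none} (λ {x} {y} _ _ → each-refineRow b (allFin k) x y (b x y))
        (one-bit b) (one-bit (refined b)) ⨾
    call (4F ∷ []) (clear-run (tab (b ◂ none) ps) (one-bit b))

  rounds : ℕ → (Word k → Word k → Bool) → Word k → Word k → Bool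
  rounds zero    b = b
  rounds (suc i) b = rounds i (refined b)

  refineAll-run : ∀ i b → i ≤ Z →
    Run Z refineAll (tab (b ◂ none) ps ∷ [] ∷ [] ∷ [] ∷ [] ∷ [] ∷ [] ∷ [] ∷ [] ∷ [] ∷ [] ∷ ones i ∷ [])
                    (tab (rounds i b ◂ none) ps ∷ [] ∷ [] ∷ [] ∷ [] ∷ [] ∷ [] ∷ [] ∷ [] ∷ [] ∷ [] ∷ [] ∷ [])
  refineAll-run i b l = loop (go i b) l
    where
    go : ∀ i b → Loop Z (some (# 11)) (embed (0F ∷ 1F ∷ 2F ∷ 3F ∷ 4F ∷ 5F ∷ 6F ∷ 7F ∷ 8F ∷ 9F ∷ # 10 ∷ []) refine ⨾
        pop (# 11)) i
           (tab (b ◂ none) ps ∷ [] ∷ [] ∷ [] ∷ [] ∷ [] ∷ [] ∷ [] ∷ [] ∷ [] ∷ [] ∷ ones i ∷ [])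
           (tab (rounds i b ◂ none) ps ∷ [] ∷ [] ∷ [] ∷ [] ∷ [] ∷ [] ∷ [] ∷ [] ∷ [] ∷ [] ∷ [] ∷ [])
    go zero    b = stop refl
    go (suc i) b = once refl (call (0F ∷ 1F ∷ 2F ∷ 3F ∷ 4F ∷ 5F ∷ 6F ∷ 7F ∷ 8F ∷ 9F ∷ # 10 ∷ []) (refine-run b) ⨾ pop)
        (go i (refined b))

  outputs : List DFASymbol → Stack
  outputs = map (λ o → out o)

  extendUnless : Stack → List (Word k) → Word k → List (Word k)
  extendUnless []      qs x = x ∷ qs
  extendUnless (_ ∷ _) qs x = qs

  module _ (b : Word k → Word k → Bool) where

    d : Word k → Word k → Bool
    d = entry-at b

    table : Stack
    table = tab (b ◂ none) ps

    similarMarks : Word k → List (Word k) → Stack → Stack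
    similarMarks x []       mm = mm
    similarMarks x (q ∷ qs) mm = similarMarks x qs (if d q x then mm else one ∷ mm)

    fold-similar : ∀ x qs mm → foldl (λ mm (q , _) → if d q x then mm else one ∷ mm) mm (singles qs) ≡ similarMarks x
        qs mm
    fold-similar x []       mm = refl
    fold-similar x (q ∷ qs) mm = fold-similar x qs _

    compare-run : ∀ x qs {mm} → Short (singles qs) → length (wordTable qs) ≤ Z →
      Run Z (forRows compareRow)
        (wordTable qs ∷ [] ∷ [] ∷ [] ∷ table ∷ [] ∷ [] ∷ [] ∷ spellʳ x ∷ [] ∷ [] ∷ [] ∷ mm ∷ [])
        (wordTable qs ∷ [] ∷ [] ∷ [] ∷ table ∷ [] ∷ [] ∷ [] ∷ spellʳ x ∷ [] ∷ [] ∷ [] ∷ similarMarks x qs mm ∷ [])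
    compare-run x qs {mm} s l =
      subst (λ u → Run Z (forRows compareRow)
          (wordTable qs ∷ [] ∷ [] ∷ [] ∷ table ∷ [] ∷ [] ∷ [] ∷ spellʳ x ∷ [] ∷ [] ∷ [] ∷ mm ∷ [])
          (wordTable qs ∷ [] ∷ [] ∷ [] ∷ table ∷ [] ∷ [] ∷ [] ∷ spellʳ x ∷ [] ∷ [] ∷ [] ∷ u ∷ []))
        (fold-similar x qs mm)
        (forRows-run (λ mm → table ∷ [] ∷ [] ∷ [] ∷ spellʳ x ∷ [] ∷ [] ∷ [] ∷ mm ∷ [])
          (λ mm (q , _) → if d q x then mm else one ∷ mm) {v = none} {v′ = none} (λ _ _ → ⊤)
          (λ { {q} {a = mm} _ → call (4F ∷ 5F ∷ 6F ∷ 7F ∷ 2F ∷ 8F ∷ 9F ∷ # 10 ∷ # 11 ∷ []) (look-at b q x) ⨾ choose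
              (d q x) ⨾ pop })
          (λ _ → tt) (singles qs) tt l l)
      where
      choose : ∀ e {c₀ c₁ c₂ c₃ c₄ c₅ c₆ c₇ c₈ c₉ c₁₀ F mm} →
        Run Z (branch (topBit (# 11)) skip (mark (# 12)))
          (c₀ ∷ c₁ ∷ c₂ ∷ c₃ ∷ c₄ ∷ c₅ ∷ c₆ ∷ c₇ ∷ c₈ ∷ c₉ ∷ c₁₀ ∷ (bit e ∷ F) ∷ mm ∷ [])
          (c₀ ∷ c₁ ∷ c₂ ∷ c₃ ∷ c₄ ∷ c₅ ∷ c₆ ∷ c₇ ∷ c₈ ∷ c₉ ∷ c₁₀ ∷ (bit e ∷ F) ∷ (if e then mm else one ∷ mm) ∷ [])
      choose true  = on-true refl skip
      choose false = on-false refl push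

    collect : List (Word k) → Word k → List (Word k)
    collect qs x = extendUnless (similarMarks x qs []) qs x

    CollectStore : Stack → Stack → Stack → Stack → Stack → Stack → Stack → Store Σ′ 16
    CollectStore W W′ rx ry Q t mm =
      W ∷ W′ ∷ rx ∷ ry ∷ Q ∷ [] ∷ [] ∷ [] ∷ table ∷ [] ∷ [] ∷ [] ∷ t ∷ [] ∷ [] ∷ mm ∷ []

    collect-push : ∀ x {W W′ ry Q} → length x ≤ Z →
      Run Z (push 4F (λ _ → eor) ⨾ push 4F (λ _ → hash) ⨾ push 4F (λ _ → hash) ⨾
             embed (2F ∷ # 12 ∷ 4F ∷ []) fork ⨾ embed (# 12 ∷ 2F ∷ []) shift)
        (CollectStore W W′ (spellʳ x) ry Q [] []) (CollectStore W W′ (spellʳ x) ry (spell x ++ hash ∷ hash ∷ eor ∷ Q)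
            [] [])
    collect-push x {W} {W′} {ry} {Q} l =
      push ⨾⟨ CollectStore W W′ (spellʳ x) ry (eor ∷ Q) [] [] ⟩
      push ⨾⟨ CollectStore W W′ (spellʳ x) ry (hash ∷ eor ∷ Q) [] [] ⟩
      push ⨾⟨ CollectStore W W′ (spellʳ x) ry (hash ∷ hash ∷ eor ∷ Q) [] [] ⟩
      call (2F ∷ # 12 ∷ 4F ∷ []) (subst₂ (λ u v → Run Z fork (spellʳ x ∷ [] ∷ (hash ∷ hash ∷ eor ∷ Q) ∷ [])
          ([] ∷ u ∷ v ∷ []))
        (trans (spellʳ-ʳ x) (++-identityʳ (spell x))) (spellʳ-ʳ x)
            (fork-run (spellʳ x) (≤-trans (≤-reflexive (length-spellʳ x)) l)))
        ⨾⟨ CollectStore W W′ [] ry (spell x ++ hash ∷ hash ∷ eor ∷ Q) (spell x) [] ⟩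
      call (# 12 ∷ 2F ∷ []) (subst (λ u → Run Z shift (spell x ∷ [] ∷ []) ([] ∷ u ∷ [])) (spell-ʳ x)
          (shift-run (spell x) (≤-trans (≤-reflexive (length-map ltr x)) l)))

    similarMarks-length : ∀ x qs mm → length (similarMarks x qs mm) ≤ length qs + length mm
    similarMarks-length x []       mm = ≤-refl
    similarMarks-length x (q ∷ qs) mm = ≤-trans (similarMarks-length x qs _)
      (≤-trans (+-monoʳ-≤ (length qs) (grown (d q x))) (≤-reflexive (+-suc (length qs) (length mm))))
      where
      grown : ∀ e → length (if e then mm else one ∷ mm) ≤ suc (length mm)
      grown true  = n≤1+n _
      grown false = ≤-refl

    -- Counting the words still to come along with the representatives gives a quantity that never
    -- grows, which keeps the list of representatives within the space bound.
    Good : Pairs → List (Word k) → Set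
    Good rest qs = All (λ (x , _) → length x ≤ g) rest × All (λ q → length q ≤ g) qs × length qs + length rest ≤
        length (words k g)

    collected : List (Word k) → Word k × Word k → List (Word k)
    collected qs (x , _) = collect qs x

    good-step : ∀ {p rest qs} → Good (p ∷ rest) qs → Good rest (collected qs p)
    good-step {x , _} {rest} {qs} (lx ∷ ls , sq , c) = go (similarMarks x qs [])
      where
      go : ∀ ms → Good rest (extendUnless ms qs x)
      go []      = ls , lx ∷ sq , ≤-trans (≤-reflexive (sym (+-suc (length qs) (length rest)))) c
      go (_ ∷ _) = ls , sq , ≤-trans (+-monoʳ-≤ (length qs) (n≤1+n _)) c

    wordTable-length : ∀ qs → length qs ≤ length (wordTable qs)
    wordTable-length []       = z≤n
    wordTable-length (q ∷ qs) = ≤-trans (s≤s (wordTable-length qs))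
      (≤-trans (≤-trans (≤-trans (n≤1+n _) (n≤1+n _)) (m≤n+m _ (length q)))
          (≤-reflexive (sym (length-row q [] [] (wordTable qs)))))

    singles-short : ∀ qs → All (λ q → length q ≤ g) qs → Short (singles qs)
    singles-short qs a = All.map⁺ (All.map (λ l → ≤-trans l g≤Z , z≤n) a)

    collectRow-run : ∀ x qs {W W′ ry} → length x ≤ g → All (λ q → length q ≤ g) qs → length qs ≤ length (words k g) →
      Run Z collectRow (CollectStore W W′ (spellʳ x) ry (wordTable qs) [] [])
          (CollectStore W W′ (spellʳ x) ry (wordTable (collect qs x)) [] [])
    collectRow-run x qs {W} {W′} {ry} lx sq c =
      call (4F ∷ 5F ∷ 6F ∷ 7F ∷ 8F ∷ 9F ∷ # 10 ∷ # 11 ∷ 2F ∷ # 12 ∷ # 13 ∷ # 14 ∷ # 15 ∷ [])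
          (compare-run x qs (singles-short qs sq) lq)
        ⨾⟨ CollectStore W W′ (spellʳ x) ry (wordTable qs) [] (similarMarks x qs []) ⟩
      decide (similarMarks x qs []) (≤-trans (similarMarks-length x qs [])
        (≤-trans (≤-reflexive (+-identityʳ (length qs))) (≤-trans (wordTable-length qs) lq)))
      where
      lq = reps≤ qs sq c
      decide : ∀ ms → length ms ≤ Z →
        Run Z (branch (some (# 15)) skip
                 (push 4F (λ _ → eor) ⨾ push 4F (λ _ → hash) ⨾ push 4F (λ _ → hash) ⨾
                  embed (2F ∷ # 12 ∷ 4F ∷ []) fork ⨾ embed (# 12 ∷ 2F ∷ []) shift) ⨾ embed (# 15 ∷ []) clear)
          (CollectStore W W′ (spellʳ x) ry (wordTable qs) [] ms)
              (CollectStore W W′ (spellʳ x) ry (wordTable (extendUnless ms qs x)) [] [])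
      decide []       l = on-false refl (collect-push x (≤-trans lx g≤Z))
        ⨾⟨ CollectStore W W′ (spellʳ x) ry (wordTable (x ∷ qs)) [] [] ⟩ call (# 15 ∷ []) (clear-run [] z≤n)
      decide (m ∷ ms) l = on-true refl skip ⨾⟨ CollectStore W W′ (spellʳ x) ry (wordTable qs) [] (m ∷ ms) ⟩ call
          (# 15 ∷ []) (clear-run (m ∷ ms) l)

    representatives : List (Word k)
    representatives = foldl collect [] (words k g)

    fold-collect : ∀ ws qs → foldl collected qs (singles ws) ≡ foldl collect qs ws
    fold-collect []       qs = refl
    fold-collect (w ∷ ws) qs = fold-collect ws (collect qs w)

    initially-good : Good (singles (words k g)) []
    initially-good = All.map⁺ (All.tabulate (∈-words⁻ g)) , [] , ≤-reflexive (length-map (_, []) (words k g))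

    collect-run :
      Run Z (forRows collectRow)
        (wordTable (words k g) ∷ [] ∷ [] ∷ [] ∷ [] ∷ [] ∷ [] ∷ [] ∷ table ∷ [] ∷ [] ∷ [] ∷ [] ∷ [] ∷ [] ∷ [] ∷ [])
        (wordTable (words k g) ∷ [] ∷ [] ∷ [] ∷ wordTable representatives ∷ [] ∷ [] ∷ [] ∷ table ∷ [] ∷ [] ∷ [] ∷ [] ∷
            [] ∷ [] ∷ [] ∷ [])
    collect-run =
      subst (λ qs → Run Z (forRows collectRow)
          (wordTable (words k g) ∷ [] ∷ [] ∷ [] ∷ [] ∷ [] ∷ [] ∷ [] ∷ table ∷ [] ∷ [] ∷ [] ∷ [] ∷ [] ∷ [] ∷ [] ∷ [])
          (wordTable (words k g) ∷ [] ∷ [] ∷ [] ∷ wordTable qs ∷ [] ∷ [] ∷ [] ∷ table ∷ [] ∷ [] ∷ [] ∷ [] ∷ [] ∷ [] ∷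
              [] ∷ []))
        (fold-collect (words k g) [])
        (forRows-run (λ qs → wordTable qs ∷ [] ∷ [] ∷ [] ∷ table ∷ [] ∷ [] ∷ [] ∷ [] ∷ [] ∷ [] ∷ [] ∷ []) collected
            {v = none} {v′ = none} Good
          (λ { {x} {a = qs} (lx ∷ _ , sq , c) → collectRow-run x qs lx sq (≤-trans (m≤m+n _ _) c) })
          good-step (singles (words k g)) initially-good (words≤ g g≤B) (words≤ g g≤B))

    good-fold : ∀ rest qs → Good rest qs → Good [] (foldl collected qs rest)
    good-fold []         qs h = h
    good-fold (p ∷ rest) qs h = good-fold rest (collected qs p) (good-step {p} {rest} {qs} h)

    representatives-good : All (λ q → length q ≤ g) representatives × length representatives ≤ length (words k g)
    representatives-good with _ , s , c ← subst (Good []) (fold-collect (words k g) [])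
        (good-fold (singles (words k g)) [] initially-good) =
      s , ≤-trans (m≤m+n _ _) c

    rankSymbols : List (Word k) → Word k → List DFASymbol
    rankSymbols qs w = replicate (rankOf d qs w) tick ++ [ end ]

    advance : Bool → Bool → Stack → Bool × Stack
    advance true  h N = true , N
    advance false h N = if h then (false , out tick ∷ N) else (true , N)

    countStep : Word k → Bool × Stack → Word k × Word k → Bool × Stack
    countStep w (e , N) (q , _) = advance e (d q w) N

    flag : Bool → Stack
    flag b = if b then one ∷ [] else []

    fold-count-true : ∀ w qs N → foldl (countStep w) (true , N) (singles qs) ≡ (true , N)
    fold-count-true w []       N = refl
    fold-count-true w (q ∷ qs) N = fold-count-true w qs N

    fold-count : ∀ w qs N → proj₂ (foldl (countStep w) (false , N) (singles qs)) ≡ outputs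
        (replicate (rankOf d qs w) tick) ʳ++ N
    fold-count w []       N = refl
    fold-count w (q ∷ qs) N with d q w
    ... | true  = fold-count w qs (out tick ∷ N)
    ... | false = cong proj₂ (fold-count-true w qs N)

    index-run : ∀ w qs {N} → length (wordTable qs) ≤ Z →
      Run Z index
        (wordTable qs ∷ [] ∷ [] ∷ [] ∷ table ∷ [] ∷ [] ∷ [] ∷ spellʳ w ∷ [] ∷ [] ∷ [] ∷ [] ∷ N ∷ [])
        (wordTable qs ∷ [] ∷ [] ∷ [] ∷ table ∷ [] ∷ [] ∷ [] ∷ spellʳ w ∷ [] ∷ [] ∷ [] ∷ [] ∷
            (outputs (rankSymbols qs w) ʳ++ N) ∷ [])
    index-run w qs {N} l =
      subst (λ u → Run Z index
          (wordTable qs ∷ [] ∷ [] ∷ [] ∷ table ∷ [] ∷ [] ∷ [] ∷ spellʳ w ∷ [] ∷ [] ∷ [] ∷ [] ∷ N ∷ [])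
          (wordTable qs ∷ [] ∷ [] ∷ [] ∷ table ∷ [] ∷ [] ∷ [] ∷ spellʳ w ∷ [] ∷ [] ∷ [] ∷ [] ∷ u ∷ []))
        written
        (forRows-run (λ (e , N) → table ∷ [] ∷ [] ∷ [] ∷ spellʳ w ∷ [] ∷ [] ∷ [] ∷ flag e ∷ N ∷ []) (countStep w)
            {v = none} {v′ = none} (λ _ _ → ⊤)
          (λ { {q} {a = e , N} _ → call (4F ∷ 5F ∷ 6F ∷ 7F ∷ 2F ∷ 8F ∷ 9F ∷ # 10 ∷ # 11 ∷ []) (look-at b q w) ⨾ choose
              e (d q w) ⨾ pop })
          (λ _ → tt) (singles qs) {false , N} tt l l ⨾
         push ⨾ call (# 12 ∷ []) (clear-run (flag (proj₁ final)) (≤-trans (flag-length (proj₁ final)) 1≤Z)))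
      where
      final = foldl (countStep w) (false , N) (singles qs)
      flag-length : ∀ e → length (flag e) ≤ 1
      flag-length true  = ≤-refl
      flag-length false = z≤n
      written : out end ∷ proj₂ final ≡ outputs (rankSymbols qs w) ʳ++ N
      written = trans (cong (out end ∷_) (fold-count w qs N))
        (sym (trans (cong (_ʳ++ N) (map-++ (λ o → out o) (replicate (rankOf d qs w) tick) [ end ]))
            (++-ʳ++ (outputs (replicate (rankOf d qs w) tick)))))
      choose : ∀ e h {c₀ c₁ c₂ c₃ c₄ c₅ c₆ c₇ c₈ c₉ c₁₀ F N} →
        Run Z (branch (some (# 12)) skip (branch (topBit (# 11)) (push (# 13) (λ _ → out tick)) (mark (# 12))))
          (c₀ ∷ c₁ ∷ c₂ ∷ c₃ ∷ c₄ ∷ c₅ ∷ c₆ ∷ c₇ ∷ c₈ ∷ c₉ ∷ c₁₀ ∷ (bit h ∷ F) ∷ flag e ∷ N ∷ [])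
          (c₀ ∷ c₁ ∷ c₂ ∷ c₃ ∷ c₄ ∷ c₅ ∷ c₆ ∷ c₇ ∷ c₈ ∷ c₉ ∷ c₁₀ ∷ (bit h ∷ F) ∷ flag (proj₁ (advance e h N)) ∷ proj₂
              (advance e h N) ∷ [])
      choose true  h     = on-true refl skip
      choose false true  = on-false refl (on-true refl push)
      choose false false = on-false refl (on-false refl push)

  outputs-++ : ∀ as bs {N} → outputs bs ʳ++ (outputs as ʳ++ N) ≡ outputs (as ++ bs) ʳ++ N
  outputs-++ as bs {N} = trans (sym (++-ʳ++ (outputs as))) (cong (_ʳ++ N) (sym (map-++ (λ o → out o) as bs)))

  module _ (b l : Word k → Word k → Bool) (qs : List (Word k)) (short : All (λ q → length q ≤ g) qs)
      (lq : length (wordTable qs) ≤ Z) where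

    rankSyms : Word k → List DFASymbol
    rankSyms = rankSymbols b qs

    stateSymbols : Word k → List DFASymbol
    stateSymbols q = status (entry-at l q q) ∷ concatMap (λ a → rankSyms (q ++ [ a ])) (allFin k)

    OutStore : Stack → Stack → Stack → Stack → Stack → Store Σ′ 19
    OutStore Q₂ Q₂′ rq ry N =
      Q₂ ∷ Q₂′ ∷ rq ∷ ry ∷ wordTable qs ∷ [] ∷ [] ∷ [] ∷ table b ∷ [] ∷ [] ∷ [] ∷ [] ∷ [] ∷ [] ∷ [] ∷ N ∷ table l ∷ []
          ∷ []

    successors-run : ∀ as q {Q₂ Q₂′ ry N} →
      Run Z (each successor as) (OutStore Q₂ Q₂′ (spellʳ q) ry N)
        (OutStore Q₂ Q₂′ (spellʳ q) ry (outputs (concatMap (λ a → rankSyms (q ++ [ a ])) as) ʳ++ N))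
    successors-run []       q = skip
    successors-run (a ∷ as) q {Q₂} {Q₂′} {ry} {N} =
      subst (λ u → Run Z (each successor (a ∷ as)) (OutStore Q₂ Q₂′ (spellʳ q) ry N) (OutStore Q₂ Q₂′ (spellʳ q) ry u))
        (outputs-++ (rankSyms (q ++ [ a ])) (concatMap (λ a → rankSyms (q ++ [ a ])) as))
        ((push ⨾
          call (4F ∷ 5F ∷ 6F ∷ 7F ∷ 8F ∷ 9F ∷ # 10 ∷ # 11 ∷ 2F ∷ # 12 ∷ # 13 ∷ # 14 ∷ # 15 ∷ # 16 ∷ [])
            (subst (λ u → Run Z index
                (wordTable qs ∷ [] ∷ [] ∷ [] ∷ table b ∷ [] ∷ [] ∷ [] ∷ u ∷ [] ∷ [] ∷ [] ∷ [] ∷ N ∷ [])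
                (wordTable qs ∷ [] ∷ [] ∷ [] ∷ table b ∷ [] ∷ [] ∷ [] ∷ u ∷ [] ∷ [] ∷ [] ∷ [] ∷
                    (outputs (rankSyms (q ++ [ a ])) ʳ++ N) ∷ []))
              (spellʳ-snoc q a) (index-run b (q ++ [ a ]) qs {N} lq)) ⨾
          pop) ⨾ successors-run as q)

    stateRow-run : ∀ q {Q₂ Q₂′ ry N} → length q ≤ g →
      Run Z stateRow (OutStore Q₂ Q₂′ (spellʳ q) ry N) (OutStore Q₂ Q₂′ (spellʳ q) ry (outputs (stateSymbols q) ʳ++ N))
    stateRow-run q lg =
      call (2F ∷ # 12 ∷ # 18 ∷ []) (copy-word q (≤-trans lg g≤Z)) ⨾
      call (# 17 ∷ 9F ∷ # 10 ∷ # 11 ∷ 2F ∷ # 18 ∷ # 12 ∷ # 13 ∷ # 14 ∷ []) (look-at l q q) ⨾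
      call (# 18 ∷ []) (clear-word q (≤-trans lg g≤Z)) ⨾
      push ⨾ pop ⨾ successors-run (allFin k) q

    fold-states : ∀ rs N → foldl (λ N (q , _) → outputs (stateSymbols q) ʳ++ N) N (singles rs) ≡ outputs
        (concatMap stateSymbols rs) ʳ++ N
    fold-states []       N = refl
    fold-states (r ∷ rs) N = trans (fold-states rs _) (outputs-++ (stateSymbols r) (concatMap stateSymbols rs))

    dfaSymbols : List DFASymbol
    dfaSymbols = rankSyms [] ++ concatMap stateSymbols qs

    writeDFA-run : Run Z writeDFA (OutStore [] [] [] [] []) (OutStore (wordTable qs) [] [] [] (outputs dfaSymbols ʳ++ []))
    writeDFA-run =
      subst (λ u → Run Z writeDFA (OutStore [] [] [] [] []) (OutStore (wordTable qs) [] [] [] u))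
        (trans (fold-states qs (outputs (rankSyms []) ʳ++ [])) (outputs-++ (rankSyms []) (concatMap stateSymbols qs)))
        (call (4F ∷ 5F ∷ 6F ∷ 7F ∷ 8F ∷ 9F ∷ # 10 ∷ # 11 ∷ 2F ∷ # 12 ∷ # 13 ∷ # 14 ∷ # 15 ∷ # 16 ∷ [])
            (index-run b [] qs lq) ⨾
         call (4F ∷ # 12 ∷ 0F ∷ []) (copy-fresh (wordTable qs) lq) ⨾
         forRows-run
           (λ N → wordTable qs ∷ [] ∷ [] ∷ [] ∷ table b ∷ [] ∷ [] ∷ [] ∷ [] ∷ [] ∷ [] ∷ [] ∷ N ∷ table l ∷ [] ∷ [])
           (λ N (q , _) → outputs (stateSymbols q) ʳ++ N) {v = none} {v′ = none}
               (λ rs _ → All (λ (q , _) → length q ≤ g) rs)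
           (λ { (lx ∷ _) → stateRow-run _ lx }) (λ { (_ ∷ a) → a }) (singles qs) (All.map⁺ short) lq lq)

  dist : Word k → Word k → Bool
  dist = rounds g (initialDifference truth)

  reps : List (Word k)
  reps = representatives dist

  reps-short : All (λ q → length q ≤ g) reps
  reps-short = proj₁ (representatives-good dist)

  reps-table : length (wordTable reps) ≤ Z
  reps-table = reps≤ reps reps-short (proj₂ (representatives-good dist))

  result-symbols : List DFASymbol
  result-symbols = dfaSymbols dist truth reps reps-short reps-table

  dfaProgram-run : length result-symbols ≤ Z →
    ∃ λ σ → Run Z (dfaProgram scaleₖ) (input-of φ ∷ Vec.replicate 27 []) (map (λ o → out o) result-symbols ∷ σ)
  dfaProgram-run l = _ ,
    (call (0F ∷ 1F ∷ 2F ∷ 3F ∷ 4F ∷ 5F ∷ 6F ∷ 7F ∷ 8F ∷ 9F ∷ # 10 ∷ # 11 ∷ # 12 ∷ # 13 ∷ # 14 ∷ # 15 ∷ # 16 ∷ # 17 ∷ #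
        18 ∷ # 19 ∷ # 20 ∷ []) prepare-run ⨾
     call (1F ∷ 9F ∷ # 21 ∷ []) (copy-fresh (tab (truth ◂ none) ps) (one-bit truth)) ⨾
     call (1F ∷ 2F ∷ 3F ∷ 4F ∷ # 21 ∷ 6F ∷ 7F ∷ 8F ∷ 9F ∷ # 10 ∷ # 11 ∷ # 27 ∷ []) (startTable-run truth) ⨾
     call (# 16 ∷ 9F ∷ # 17 ∷ []) (copy-fresh (ones g) (≤-trans (≤-reflexive (length-ones g)) g≤Z)) ⨾
     call (1F ∷ 2F ∷ 3F ∷ 4F ∷ 5F ∷ 6F ∷ 7F ∷ 8F ∷ 9F ∷ # 10 ∷ # 11 ∷ # 17 ∷ [])
         (refineAll-run g (initialDifference truth) g≤Z) ⨾
     call (# 20 ∷ 6F ∷ 3F ∷ 4F ∷ # 22 ∷ # 23 ∷ 7F ∷ 8F ∷ 1F ∷ 2F ∷ # 24 ∷ # 25 ∷ 9F ∷ # 10 ∷ # 11 ∷ # 26 ∷ [])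
         (collect-run dist) ⨾
     call (5F ∷ 6F ∷ 3F ∷ 4F ∷ # 22 ∷ # 23 ∷ 7F ∷ 8F ∷ 1F ∷ 2F ∷ # 24 ∷ # 25 ∷ 9F ∷ # 10 ∷ # 11 ∷ # 26 ∷ # 18 ∷ # 21 ∷
         # 27 ∷ [])
       (writeDFA-run dist truth reps reps-short reps-table) ⨾
     call (# 18 ∷ 0F ∷ []) finish)
    where
    finish : Run Z shift ((map (λ o → out o) result-symbols ʳ++ []) ∷ [] ∷ [])
        ([] ∷ map (λ o → out o) result-symbols ∷ [])
    finish = subst (λ u → Run Z shift ((map (λ o → out o) result-symbols ʳ++ []) ∷ [] ∷ []) ([] ∷ u ∷ []))
      (trans (ʳ++-ʳ++ (map (λ o → out o) result-symbols)) (++-identityʳ _))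
      (shift-run (map (λ o → out o) result-symbols ʳ++ [])
        (≤-trans (≤-reflexive (trans (length-ʳ (map (λ o → out o) result-symbols))
            (length-map (λ o → out o) result-symbols))) l))

  L : Language k
  L = L⟨ φ ⟩

  accepts : Word k → Bool
  accepts w = ⌊ sat? φ (w ∷ w ∷ []) ⌋

  T-⌊⌋ : ∀ {A : Set} (a? : Dec A) → T ⌊ a? ⌋ ⇔ A
  T-⌊⌋ (yes a) = mk⇔ (λ _ → a) (λ _ → tt)
  T-⌊⌋ (no ¬a) = mk⇔ (λ ()) ¬a

  open Minimisation L accepts (λ w → T-⌊⌋ (sat? φ (w ∷ w ∷ [])))

  L-invariant : Invariant (degree φ) L
  L-invariant = L⟨⟩-invariant φ ≤-refl

  L-resp : ∀ {u v} → u ∼[ degree φ ] v → L u ⇔ L v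
  L-resp e = mk⇔ (L-invariant e) (L-invariant (∼-sym e))

  ∼-++ˡ : ∀ p {u v : Word k} {n} → u ∼[ n ] v → p ++ u ∼[ n ] p ++ v
  ∼-++ˡ []      e = e
  ∼-++ˡ (c ∷ p) e = ∼-cons c (∼-++ˡ p e)

  L-prefix : ∀ p v w → v ∼[ degree φ ] w → L (p ++ v) ⇔ L (p ++ w)
  L-prefix p v w e = L-resp {p ++ v} {p ++ w} (∼-++ˡ p {v} {w} e)

  shorten : ∀ (x : Word k) → ∃ λ y → length y ≤ g × y ∼[ degree φ ] x
  shorten x with y , _ , e , l ← shrink (degree φ) x = y , ≤-trans (<⇒≤ l) (<⇒≤ (weight<reach {k} φ ≤-refl)) , e

  level≤B : level ≤ B
  level≤B = ≤-trans (after≤ φ (g * g)) (m≤n+m (g * g) g)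

  true-ext : ∀ {a b} → (a ≡ true → b ≡ true) → (b ≡ true → a ≡ true) → a ≡ b
  true-ext {false} {false} f h = refl
  true-ext {false} {true}  f h = h refl
  true-ext {true}  {b}     f h = sym (f refl)

  entry-at-correct : ∀ b {p q} → length p ≤ B → length q ≤ B → entry-at b p q ≡ b p q
  entry-at-correct b {p} {q} lp lq = true-ext forth back
    where
    c : Word k → Word k → Bool
    c x y = ⌊ x ≟ʷ p ⌋ ∧ ⌊ y ≟ʷ q ⌋
    forth : entry-at b p q ≡ true → b p q ≡ true
    forth e with found-true⁻ b c false ps e
    ... | inj₂ (x , y , _ , m , e′) with m₁ , m₂ ← ∧-true m
      with refl ← ⌊⌋-elim (x ≟ʷ p) m₁ | refl ← ⌊⌋-elim (y ≟ʷ q) m₂ = e′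
    back : b p q ≡ true → entry-at b p q ≡ true
    back e = found-true⁺ b c false ps (ps-complete lp lq) (cong₂ _∧_ (⌊⌋-true (p ≟ʷ p) refl) (⌊⌋-true (q ≟ʷ q) refl)) e

  truth-accepts : ∀ {x} → length x ≤ level → entry-at truth x x ≡ accepts x
  truth-accepts l = trans (entry-at-correct truth (≤-trans l level≤B) (≤-trans l level≤B)) (truth-correct l l)

  -- The machine performs the first round innermost, while the induction on separating words peels
  -- off the last one.
  rounds-suc : ∀ i b → rounds i (refined b) ≡ refined (rounds i b)
  rounds-suc zero    b = refl
  rounds-suc (suc i) b = rounds-suc i (refined b)

  refineBit⁻ : ∀ b x y acc as → refineBit b x y acc as ≡ true →
               acc ≡ true ⊎ ∃ λ a → entry-at b (x ++ [ a ]) (y ++ [ a ]) ≡ true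
  refineBit⁻ b x y acc []       e = inj₁ e
  refineBit⁻ b x y acc (a ∷ as) e with refineBit⁻ b x y _ as e
  ... | inj₂ p = inj₂ p
  ... | inj₁ h with entry-at b (x ++ [ a ]) (y ++ [ a ]) in f
  ...   | true  = inj₂ (a , f)
  ...   | false = inj₁ h

  refineBit-keep : ∀ b x y as → refineBit b x y true as ≡ true
  refineBit-keep b x y []       = refl
  refineBit-keep b x y (a ∷ as) with entry-at b (x ++ [ a ]) (y ++ [ a ])
  ... | true  = refineBit-keep b x y as
  ... | false = refineBit-keep b x y as

  refineBit⁺ : ∀ b x y acc as {a} → a ∈ as → entry-at b (x ++ [ a ]) (y ++ [ a ]) ≡ true → refineBit b x y acc as ≡ true
  refineBit⁺ b x y acc (a ∷ as) (here refl) e rewrite e = refineBit-keep b x y as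
  refineBit⁺ b x y acc (a ∷ as) (there i)   e = refineBit⁺ b x y _ as i e

  Different : Word k → Word k → Set
  Different x y = ¬ (L x ⇔ L y)

  difference : ∀ {x y} → length x ≤ level → length y ≤ level →
               initialDifference truth x y ≡ true ⇔ Different x y
  difference {x} {y} lx ly =
    subst₂ (λ a b → (a xor b) ≡ true ⇔ Different x y) (sym (truth-accepts lx)) (sym (truth-accepts ly))
      (xor-dec (sat? φ (x ∷ x ∷ [])) (sat? φ (y ∷ y ∷ [])))
    where
    xor-dec : ∀ {A C : Set} (a? : Dec A) (c? : Dec C) → (⌊ a? ⌋ xor ⌊ c? ⌋) ≡ true ⇔ (¬ (A ⇔ C))
    xor-dec (yes a) (yes c) = mk⇔ (λ ()) (λ h → contradiction (mk⇔ (λ _ → c) (λ _ → a)) h)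
    xor-dec (yes a) (no ¬c) = mk⇔ (λ _ e → ¬c (to e a)) (λ _ → refl)
    xor-dec (no ¬a) (yes c) = mk⇔ (λ _ e → ¬a (from e c)) (λ _ → refl)
    xor-dec (no ¬a) (no ¬c) = mk⇔ (λ ()) (λ h → contradiction
        (mk⇔ (λ a → contradiction a ¬a) (λ c → contradiction c ¬c)) h)

  rounded : ℕ → Word k → Word k → Bool
  rounded i = rounds i (initialDifference truth)

  snoc-length : ∀ (x : Word k) a {i} → length x + suc i ≤ level → length (x ++ [ a ]) + i ≤ level
  snoc-length x a {i} l = ≤-trans (≤-reflexive (trans (cong (_+ i) (length-++ x)) (+-assoc (length x) 1 i))) l

  drop-suc : ∀ (x : Word k) {i} → length x + suc i ≤ level → length x + i ≤ level
  drop-suc x l = ≤-trans (+-monoʳ-≤ (length x) (n≤1+n _)) l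

  in-table : ∀ (x : Word k) {i} → length x + i ≤ level → length x ≤ B
  in-table x l = ≤-trans (m≤m+n (length x) _) (≤-trans l level≤B)

  -- i rounds see exactly the separating words of length at most i, as each round reads one more
  -- letter. Requiring `length x + i ≤ level`, and likewise for `y`, keeps every consulted entry
  -- reliable.
  rounded⁻ : ∀ i {x y} → length x + i ≤ level → length y + i ≤ level → rounded i x y ≡ true →
             ∃ λ w → length w ≤ i × Different (x ++ w) (y ++ w)
  rounded⁻ zero {x} {y} lx ly e =
    [] , z≤n , subst₂ Different (sym (++-identityʳ x)) (sym (++-identityʳ y))
      (to (difference (≤-trans (≤-reflexive (sym (+-identityʳ _))) lx)
          (≤-trans (≤-reflexive (sym (+-identityʳ _))) ly)) e)
  rounded⁻ (suc i) {x} {y} lx ly e =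
    [ (λ h → now (rounded⁻ i (drop-suc x lx) (drop-suc y ly) h))
    , (λ (a , h) → later a (rounded⁻ i (snoc-length x a lx) (snoc-length y a ly)
        (trans (sym (entry-at-correct (rounded i) (in-table (x ++ [ a ]) (snoc-length x a lx))
            (in-table (y ++ [ a ]) (snoc-length y a ly)))) h)))
    ]′ (refineBit⁻ (rounded i) x y (rounded i x y) (allFin k)
        (trans (sym (cong (λ r → r x y) (rounds-suc i (initialDifference truth)))) e))
    where
    now : (∃ λ w → length w ≤ i × Different (x ++ w) (y ++ w)) → ∃ λ w → length w ≤ suc i × Different (x ++ w) (y ++ w)
    now (w , l , dif) = w , m≤n⇒m≤1+n l , dif
    later : ∀ a → (∃ λ w → length w ≤ i × Different ((x ++ [ a ]) ++ w) ((y ++ [ a ]) ++ w)) →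
            ∃ λ w → length w ≤ suc i × Different (x ++ w) (y ++ w)
    later a (w , l , dif) = a ∷ w , s≤s l , subst₂ Different (++-assoc x [ a ] w) (++-assoc y [ a ] w) dif

  rounded⁺ : ∀ i {x y} → length x + i ≤ level → length y + i ≤ level → ∀ w → length w ≤ i →
             Different (x ++ w) (y ++ w) → rounded i x y ≡ true
  rounded⁺ zero {x} {y} lx ly [] _ dif =
    from (difference (≤-trans (≤-reflexive (sym (+-identityʳ _))) lx) (≤-trans (≤-reflexive (sym (+-identityʳ _))) ly))
      (subst₂ Different (++-identityʳ x) (++-identityʳ y) dif)
  rounded⁺ (suc i) {x} {y} lx ly [] _ dif =
    trans (cong (λ r → r x y) (rounds-suc i (initialDifference truth)))
      (subst (λ e → refineBit (rounded i) x y e (allFin k) ≡ true)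
          (sym (rounded⁺ i (drop-suc x lx) (drop-suc y ly) [] z≤n dif))
        (refineBit-keep (rounded i) x y (allFin k)))
  rounded⁺ (suc i) {x} {y} lx ly (a ∷ w) (s≤s l) dif =
    trans (cong (λ r → r x y) (rounds-suc i (initialDifference truth)))
      (refineBit⁺ (rounded i) x y _ (allFin k) (∈-allFin a)
        (trans (entry-at-correct (rounded i) (in-table (x ++ [ a ]) (snoc-length x a lx))
            (in-table (y ++ [ a ]) (snoc-length y a ly)))
          (rounded⁺ i (snoc-length x a lx) (snoc-length y a ly) w l
            (subst₂ Different (sym (++-assoc x [ a ] w)) (sym (++-assoc y [ a ] w)) dif))))

  separates : Word k → Word k → Bool
  separates = entry-at dist

  room₂ : ∀ {x : Word k} → length x ≤ suc g → length x + g ≤ level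
  room₂ {x} l = ≤-trans (+-monoˡ-≤ g l) (≤-trans (≤-trans (+-monoˡ-≤ (g + g) 1≤g)
      (≤-reflexive (cong (λ i → g + (g + i)) (sym (+-identityʳ g))))) level-large)
    where
    1≤g : 1 ≤ g
    1≤g = ≤-trans (s≤s z≤n) g-large

  -- g rounds suffice: a suffix may be replaced by an `∼[ degree φ ]`-equivalent one of length at
  -- most g without changing membership after any prefix.
  separates-false : ∀ {p q} → length p ≤ suc g → length q ≤ suc g → separates p q ≡ false ⇔ Nerode p q
  separates-false {p} {q} lp lq = mk⇔ forth back
    where
    correct : separates p q ≡ dist p q
    correct = entry-at-correct dist (in-table p (room₂ {p} lp)) (in-table q (room₂ {q} lq))
    forth : separates p q ≡ false → Nerode p q
    forth e w = transfer (shorten w)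
      where
      transfer : (∃ λ v → length v ≤ g × v ∼[ degree φ ] w) → L (p ++ w) ⇔ L (q ++ w)
      transfer (v , l , s) = mk⇔ (to (L-prefix q v w s) ∘ to h ∘ from (L-prefix p v w s))
                                 (to (L-prefix p v w s) ∘ from h ∘ from (L-prefix q v w s))
        where
        h : L (p ++ v) ⇔ L (q ++ v)
        -- Refinement refutes only a difference, so the equivalence is first obtained doubly
        -- negated; membership is decidable.
        h = decidable-stable (⇔-dec (sat? φ ((p ++ v) ∷ (p ++ v) ∷ [])) (sat? φ ((q ++ v) ∷ (q ++ v) ∷ [])))
              (λ dif → not-¬ e (trans correct (rounded⁺ g (room₂ {p} lp) (room₂ {q} lq) v l dif)))
    back : Nerode p q → separates p q ≡ false
    back h = ¬-not (λ e → refute (rounded⁻ g (room₂ {p} lp) (room₂ {q} lq) (trans (sym correct) e)))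
      where
      refute : ¬ ∃ λ w → length w ≤ g × Different (p ++ w) (q ++ w)
      refute (w , _ , dif) = dif (h w)

  Separates : Word k → Word k → Set
  Separates x q = separates q x ≡ true

  Confuses : Word k → Word k → Set
  Confuses x q = separates q x ≡ false

  marks-grow : ∀ x qs m ms → similarMarks dist x qs (m ∷ ms) ≢ []
  marks-grow x []       m ms ()
  marks-grow x (q ∷ qs) m ms = go (separates q x)
    where
    go : ∀ b → similarMarks dist x qs (if b then m ∷ ms else one ∷ m ∷ ms) ≢ []
    go true  = marks-grow x qs m ms
    go false = marks-grow x qs one (m ∷ ms)

  marks-empty : ∀ x qs → similarMarks dist x qs [] ≡ [] → All (Separates x) qs
  marks-empty x []       e = []
  marks-empty x (q ∷ qs) e = go (separates q x) refl e
    where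
    go : ∀ b → separates q x ≡ b → similarMarks dist x qs (if b then [] else one ∷ []) ≡ [] → All (Separates x) (q ∷ qs)
    go true  f e = f ∷ marks-empty x qs e
    go false f e = contradiction e (marks-grow x qs one [])

  marks-nonempty : ∀ x qs {m ms} → similarMarks dist x qs [] ≡ m ∷ ms → Any (Confuses x) qs
  marks-nonempty x (q ∷ qs) {m} {ms} e = go (separates q x) refl e
    where
    go : ∀ b → separates q x ≡ b → similarMarks dist x qs (if b then [] else one ∷ []) ≡ m ∷ ms → Any (Confuses x)
        (q ∷ qs)
    go true  f e = there (marks-nonempty x qs e)
    go false f e = here f

  self : ∀ {x} → length x ≤ g → separates x x ≡ false
  self {x} l = from (separates-false (m≤n⇒m≤1+n l) (m≤n⇒m≤1+n l)) (λ _ → mk⇔ id id)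

  collect-covers : ∀ x qs → length x ≤ g → Any (Confuses x) (collect dist qs x)
  collect-covers x qs l = go (similarMarks dist x qs []) refl
    where
    go : ∀ ms → similarMarks dist x qs [] ≡ ms → Any (Confuses x) (extendUnless ms qs x)
    go []      e = here (self l)
    go (_ ∷ _) e = marks-nonempty x qs e

  collect-keeps : ∀ {P : Word k → Set} x qs → Any P qs → Any P (collect dist qs x)
  collect-keeps {P} x qs p = go (similarMarks dist x qs [])
    where
    go : ∀ ms → Any P (extendUnless ms qs x)
    go []      = there p
    go (_ ∷ _) = p

  fold-keeps : ∀ {P : Word k → Set} ws qs → Any P qs → Any P (foldl (collect dist) qs ws)
  fold-keeps []       qs p = p
  fold-keeps (w ∷ ws) qs p = fold-keeps ws (collect dist qs w) (collect-keeps w qs p)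

  fold-covers : ∀ ws qs {x} → length x ≤ g → x ∈ ws → Any (λ q → separates q x ≡ false) (foldl (collect dist) qs ws)
  fold-covers (w ∷ ws) qs l (here refl) = fold-keeps ws (collect dist qs w) (collect-covers w qs l)
  fold-covers (w ∷ ws) qs l (there i)   = fold-covers ws (collect dist qs w) l i

  Separated : List (Word k) → Set
  Separated = AllPairs (λ p q → separates q p ≡ true)

  collect-separated : ∀ x qs → Separated qs → Separated (collect dist qs x)
  collect-separated x qs s = go (similarMarks dist x qs []) refl
    where
    go : ∀ ms → similarMarks dist x qs [] ≡ ms → Separated (extendUnless ms qs x)
    go []      e = marks-empty x qs e ∷ s
    go (_ ∷ _) e = s

  fold-separated : ∀ ws qs → Separated qs → Separated (foldl (collect dist) qs ws)
  fold-separated []       qs s = s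
  fold-separated (w ∷ ws) qs s = fold-separated ws (collect dist qs w) (collect-separated w qs s)

  shorten-nerode : ∀ x → ∃ λ y → length y ≤ g × Nerode y x
  shorten-nerode x with y , l , e ← shorten x = y , l , λ w → L-resp {y ++ w} {x ++ w} (∼-++ {a = y} {x} w e)

  reps-distinct : Separated reps
  reps-distinct = fold-separated (words k g) [] []

  reps-cover : ∀ {x} → length x ≤ g → Any (λ q → separates q x ≡ false) reps
  reps-cover l = fold-covers (words k g) [] l (∈-words⁺ g l)

  minimalAutomaton : DFA k
  minimalAutomaton = automaton separates g separates-false shorten-nerode reps reps-short reps-distinct reps-cover

  minimalAutomaton-canonical : IsCanonicalDFA minimalAutomaton L
  minimalAutomaton-canonical = canonical separates g separates-false shorten-nerode reps reps-short reps-distinct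
      reps-cover

  concatMap-cong-All : ∀ {A C : Set} {f h : A → List C} {xs} → All (λ x → f x ≡ h x) xs → concatMap f xs ≡ concatMap h xs
  concatMap-cong-All []       = refl
  concatMap-cong-All (e ∷ es) = cong₂ _++_ e (concatMap-cong-All es)

  result-correct : result-symbols ≡ encodeDFA minimalAutomaton
  result-correct = trans
    (cong (rankSymbols dist reps [] ++_)
      (concatMap-cong-All (All.map (λ {q} l → cong (λ b → status b ∷ concatMap
          (λ a → rankSymbols dist reps (q ++ [ a ])) (allFin k))
        (truth-accepts (≤-trans (m≤m+n (length q) g) (room₂ {q} (m≤n⇒m≤1+n l))))) reps-short)))
    (sym (encode-automaton separates g separates-false shorten-nerode reps reps-short reps-distinct reps-cover))

-- Space and time

length-concatMap-map : ∀ {A C D : Set} (h : A → C → D) (cs : List C) as →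
                       length (concatMap (λ a → map (h a) cs) as) ≡ length as * length cs
length-concatMap-map h cs []       = refl
length-concatMap-map h cs (a ∷ as) =
  trans (length-++ (map (h a) cs)) (cong₂ _+_ (length-map (h a) cs) (length-concatMap-map h cs as))

length-words : ∀ k n → length (words k n) ≤ suc k ^ n
length-words k zero    = ≤-refl
length-words k (suc n) = begin
  suc (length (concatMap (λ w → map (_∷ w) (allFin k)) (words k n)))
    ≡⟨ cong suc (trans (length-concatMap-map (λ w a → a ∷ w) (allFin k) (words k n))
        (cong (length (words k n) *_) (length-tabulate {n = k} id))) ⟩
  suc (length (words k n) * k)                        ≤⟨ +-mono-≤ (nonempty n)
      (≤-reflexive (*-comm (length (words k n)) k)) ⟩
  suc k * length (words k n)                          ≤⟨ *-monoʳ-≤ (suc k) (length-words k n) ⟩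
  suc k ^ suc n                                       ∎
  where
  open ≤-Reasoning
  nonempty : ∀ n → 1 ≤ length (words k n)
  nonempty zero    = s≤s z≤n
  nonempty (suc n) = s≤s z≤n

length-words-mono : ∀ k {m n} → m ≤ n → length (words k m) ≤ length (words k n)
length-words-mono k {n = zero}  z≤n     = ≤-refl
length-words-mono k {n = suc n} z≤n     = s≤s z≤n
length-words-mono k {suc m} {suc n} (s≤s l) = s≤s (≤-trans
    (≤-reflexive (length-concatMap-map (λ w a → a ∷ w) (allFin k) (words k m)))
  (≤-trans (*-monoˡ-≤ (length (allFin k)) (length-words-mono k l))
      (≤-reflexive (sym (length-concatMap-map (λ w a → a ∷ w) (allFin k) (words k n))))))

-- A row of the pair table has two words and at most B truth values, each part of length at most B,
-- and three separators: at most `3 * suc B` symbols. The square of `y` dominates all the rows, and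
-- the factor `2 + k` makes room for the output automaton.
spaceBound : ℕ → ℕ → ℕ
spaceBound k B = (2 + k) * (y * y)
  where
  y = suc (length (words k B)) * (3 * suc B)

2≤spaceBound : ∀ k B → 2 ≤ spaceBound k B
2≤spaceBound k B = ≤-trans (m≤m+n 2 k) (m≤m*n (2 + k) (y * y))
  where
  y = suc (length (words k B)) * (3 * suc B)

module Space (k : ℕ) (B : ℕ) where

  X Y : ℕ
  X = length (words k B)
  Y = suc X * (3 * suc B)

  Y≤YY : ∀ {a} → a ≤ Y → a ≤ spaceBound k B
  Y≤YY l = ≤-trans l (≤-trans (m≤m*n Y Y) (m≤n*m (Y * Y) (2 + k)))

  B≤Space : B ≤ spaceBound k B
  B≤Space = Y≤YY (≤-trans (n≤1+n B) (≤-trans (m≤n*m (suc B) 3) (m≤n*m (3 * suc B) (suc X))))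

  module _ (O : Set) where

    open Basics k O (spaceBound k B)
    open Preparation k O (spaceBound k B)

    tab-length : ∀ (v : Value) qs {M} → All (λ (x , y) → 3 + (length x + length y + length (v x y)) ≤ M) qs →
                 length (tab v qs) ≤ length qs * M
    tab-length v []             []       = z≤n
    tab-length v ((x , y) ∷ qs) {M} (l ∷ ls) = begin
      length (row x y (v x y) (tab v qs))   ≡⟨ length-row x y (v x y) (tab v qs) ⟩
      length x + suc (length y + suc (length (v x y) + suc (length (tab v qs))))
        ≡⟨ solve 4 (λ a b c r → a :+ (con 1 :+ (b :+ (con 1 :+ (c :+ (con 1 :+ r))))) := con 3 :+ (a :+ b :+ c) :+ r) refl
             (length x) (length y) (length (v x y)) (length (tab v qs)) ⟩
      3 + (length x + length y + length (v x y)) + length (tab v qs) ≤⟨ +-mono-≤ l (tab-length v qs ls) ⟩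
      M + length qs * M                     ∎
      where open ≤-Reasoning

    3≤ : ∀ {a b c} → a ≤ B → b ≤ B → c ≤ B → 3 + (a + b + c) ≤ 3 * suc B
    3≤ la lb lc = ≤-trans (+-monoʳ-≤ 3 (+-mono-≤ (+-mono-≤ la lb) lc))
      (≤-reflexive (solve 1 (λ b → con 3 :+ (b :+ b :+ b) := con 3 :* (con 1 :+ b)) refl B))

    wordTable≤ : ∀ qs → All (λ q → length q ≤ B) qs → length qs ≤ X → length (wordTable qs) ≤ spaceBound k B
    wordTable≤ qs sq l = Y≤YY (≤-trans
      (tab-length none (singles qs) (All.map⁺ (All.map (λ lq → 3≤ lq z≤n z≤n) sq)))
      (*-monoˡ-≤ (3 * suc B) (≤-trans (≤-reflexive (length-map (_, []) qs)) (m≤n⇒m≤1+n l))))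

    words≤ : ∀ h → h ≤ B → length (wordTable (words k h)) ≤ spaceBound k B
    words≤ h l = wordTable≤ (words k h) (All.tabulate (λ i → ≤-trans (∈-words⁻ h i) l)) (length-words-mono k l)

    length-pairsOf : ∀ ws → length (pairsOf ws) ≡ length ws * length ws
    length-pairsOf ws = trans (length-concatMap-map (λ (x , _) (y , _) → x , y) (singles ws) (singles ws))
      (cong₂ _*_ (length-map (_, []) ws) (length-map (_, []) ws))

    pairTab≤ : ∀ {c} → c ≤ B → All (λ (x , y) → length x ≤ B × length y ≤ B) (pairsOf (words k B)) →
               ∀ (w : Value) → (∀ x y → length (w x y) ≤ c) → length (tab w (pairsOf (words k B))) ≤ spaceBound k B
    pairTab≤ c≤B sound w l = begin
      length (tab w (pairsOf (words k B)))          ≤⟨ tab-length w (pairsOf (words k B))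
          (All.map (λ { {x , y} (lx , ly) → 3≤ lx ly (≤-trans (l x y) c≤B) }) sound) ⟩
      length (pairsOf (words k B)) * (3 * suc B)    ≡⟨ cong (_* (3 * suc B)) (length-pairsOf (words k B)) ⟩
      X * X * (3 * suc B)                           ≤⟨ *-mono-≤ (*-mono-≤ (n≤1+n X) (n≤1+n X))
          (m≤m*n (3 * suc B) (3 * suc B)) ⟩
      suc X * suc X * (3 * suc B * (3 * suc B))     ≡⟨ solve 2 (λ a b → a :* a :* (b :* b) := a :* b :* (a :* b)) refl
          (suc X) (3 * suc B) ⟩
      Y * Y                                         ≤⟨ m≤n*m (Y * Y) (2 + k) ⟩
      spaceBound k B                                ∎
      where open ≤-Reasoning

length-concatMap≤ : ∀ {A C : Set} (h : A → List C) {M} as → (∀ a → length (h a) ≤ M) → length (concatMap h as) ≤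
    length as * M
length-concatMap≤ h []       l = z≤n
length-concatMap≤ h (a ∷ as) l = ≤-trans (≤-reflexive (length-++ (h a))) (+-mono-≤ (l a) (length-concatMap≤ h as l))

rankOf≤ : ∀ (d : Word k → Word k → Bool) qs w → rankOf d qs w ≤ length qs
rankOf≤ d []       w = z≤n
rankOf≤ d (q ∷ qs) w with d q w
... | true  = s≤s (rankOf≤ d qs w)
... | false = z≤n

finite-Bool : Finite Bool
finite-Bool = finite-↔ (mk↔ₛ′ code decode code-decode decode-code) (2 , ↔-refl)
  where
  code : Bool → Fin 2
  code false = 0F
  code true  = 1F
  decode : Fin 2 → Bool
  decode 0F = false
  decode 1F = true
  code-decode : ∀ x → code (decode x) ≡ x
  code-decode 0F = refl
  code-decode 1F = refl
  decode-code : ∀ x → decode (code x) ≡ x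
  decode-code false = refl
  decode-code true  = refl

finite-Symbol : Finite (Symbol k 2)
finite-Symbol {k} = finite-↔ (mk↔ₛ′ code decode code-decode decode-code)
    (finite-⊎ (2 , ↔-refl) (finite-⊎ (k , ↔-refl) (9 , ↔-refl)))
  where
  code : Symbol k 2 → Fin 2 ⊎ Fin k ⊎ Fin 9
  code (var v)    = inj₁ v
  code (letter a) = inj₂ (inj₁ a)
  code `⟨ = inj₂ (inj₂ 0F)
  code `⟩ = inj₂ (inj₂ 1F)
  code `⊑ = inj₂ (inj₂ 2F)
  code `¬ = inj₂ (inj₂ 3F)
  code `∧ = inj₂ (inj₂ 4F)
  code `∨ = inj₂ (inj₂ 5F)
  code `⇒ = inj₂ (inj₂ 6F)
  code `∃ = inj₂ (inj₂ 7F)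
  code `∀ = inj₂ (inj₂ 8F)
  decode : Fin 2 ⊎ Fin k ⊎ Fin 9 → Symbol k 2
  decode (inj₁ v)         = var v
  decode (inj₂ (inj₁ a))  = letter a
  decode (inj₂ (inj₂ 0F)) = `⟨
  decode (inj₂ (inj₂ 1F)) = `⟩
  decode (inj₂ (inj₂ 2F)) = `⊑
  decode (inj₂ (inj₂ 3F)) = `¬
  decode (inj₂ (inj₂ 4F)) = `∧
  decode (inj₂ (inj₂ 5F)) = `∨
  decode (inj₂ (inj₂ 6F)) = `⇒
  decode (inj₂ (inj₂ 7F)) = `∃
  decode (inj₂ (inj₂ 8F)) = `∀
  code-decode : ∀ x → code (decode x) ≡ x
  code-decode (inj₁ v)         = refl
  code-decode (inj₂ (inj₁ a))  = refl
  code-decode (inj₂ (inj₂ 0F)) = refl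
  code-decode (inj₂ (inj₂ 1F)) = refl
  code-decode (inj₂ (inj₂ 2F)) = refl
  code-decode (inj₂ (inj₂ 3F)) = refl
  code-decode (inj₂ (inj₂ 4F)) = refl
  code-decode (inj₂ (inj₂ 5F)) = refl
  code-decode (inj₂ (inj₂ 6F)) = refl
  code-decode (inj₂ (inj₂ 7F)) = refl
  code-decode (inj₂ (inj₂ 8F)) = refl
  decode-code : ∀ x → decode (code x) ≡ x
  decode-code (var v)    = refl
  decode-code (letter a) = refl
  decode-code `⟨ = refl
  decode-code `⟩ = refl
  decode-code `⊑ = refl
  decode-code `¬ = refl
  decode-code `∧ = refl
  decode-code `∨ = refl
  decode-code `⇒ = refl
  decode-code `∃ = refl
  decode-code `∀ = refl

finite-Work : Finite (Work k)
finite-Work {k} = finite-⊎ (k , ↔-refl) (finite-⊎ finite-Bool (3 , ↔-refl))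

finite-DFASymbol : Finite DFASymbol
finite-DFASymbol = finite-↔ (mk↔ₛ′ code decode code-decode decode-code) (finite-⊎ (2 , ↔-refl) finite-Bool)
  where
  code : DFASymbol → Fin 2 ⊎ Bool
  code tick       = inj₁ 0F
  code end        = inj₁ 1F
  code (status b) = inj₂ b
  decode : Fin 2 ⊎ Bool → DFASymbol
  decode (inj₁ 0F) = tick
  decode (inj₁ 1F) = end
  decode (inj₂ b)  = status b
  code-decode : ∀ x → code (decode x) ≡ x
  code-decode (inj₁ 0F) = refl
  code-decode (inj₁ 1F) = refl
  code-decode (inj₂ b)  = refl
  decode-code : ∀ x → decode (code x) ≡ x
  decode-code tick       = refl
  decode-code end        = refl
  decode-code (status b) = refl

-- Needed for the truth problem: a closed formula can be evaluated at the pair of empty words.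
coincidence : ∀ (φ : FO k m) {ρ ρ′} → (∀ v → Free v φ → lookup ρ v ≡ lookup ρ′ v) → ρ ⊨ φ → ρ′ ⊨ φ
coincidence′ : ∀ (φ : FO k m) {ρ ρ′} → (∀ v → Free v φ → lookup ρ v ≡ lookup ρ′ v) → ρ′ ⊨ φ → ρ ⊨ φ
coincidence′ φ h = coincidence φ (λ v f → sym (h v f))
coincidence (s ⊑′ t) h p = subst₂ _⊑_ (value s inj₁) (value t inj₂) p
  where
  value : ∀ u → (∀ {v} → u ≡ var v → Free v (s ⊑′ t)) → ⟦ u ⟧ _ ≡ ⟦ u ⟧ _
  value (var v)   f = h v (f refl)
  value (const w) f = refl
coincidence (¬′ φ) h p q = p (coincidence′ φ h q)
coincidence (φ ∧′ ψ) h (p , q) = coincidence φ (λ v f → h v (inj₁ f)) p , coincidence ψ (λ v f → h v (inj₂ f)) q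
coincidence (φ ∨′ ψ) h (inj₁ p) = inj₁ (coincidence φ (λ v f → h v (inj₁ f)) p)
coincidence (φ ∨′ ψ) h (inj₂ q) = inj₂ (coincidence ψ (λ v f → h v (inj₂ f)) q)
coincidence (φ ⇒′ ψ) h r p = coincidence ψ (λ v f → h v (inj₂ f)) (r (coincidence′ φ (λ v f → h v (inj₁ f)) p))
coincidence (∃′ w φ) {ρ} {ρ′} h (u , p) = u , coincidence φ (update-agree w u {ρ} {ρ′} h) p
  where
  update-agree : ∀ w u {ρ ρ′ : Env _ _} → (∀ v → Free v (∃′ w φ) → lookup ρ v ≡ lookup ρ′ v) →
                 ∀ v → Free v φ → lookup (ρ [ w ]≔ u) v ≡ lookup (ρ′ [ w ]≔ u) v
  update-agree w u {ρ} {ρ′} h v f with v Fin.≟ w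
  ... | yes refl = trans (lookup∘update v ρ u) (sym (lookup∘update v ρ′ u))
  ... | no v≢w   = trans (lookup∘update′ v≢w ρ u) (trans (h v (v≢w , f)) (sym (lookup∘update′ v≢w ρ′ u)))
coincidence (∀′ w φ) {ρ} {ρ′} h p u = coincidence φ (update-agree w u {ρ} {ρ′} h) (p u)
  where
  update-agree : ∀ w u {ρ ρ′ : Env _ _} → (∀ v → Free v (∀′ w φ) → lookup ρ v ≡ lookup ρ′ v) →
                 ∀ v → Free v φ → lookup (ρ [ w ]≔ u) v ≡ lookup (ρ′ [ w ]≔ u) v
  update-agree w u {ρ} {ρ′} h v f with v Fin.≟ w
  ... | yes refl = trans (lookup∘update v ρ u) (sym (lookup∘update v ρ′ u))
  ... | no v≢w   = trans (lookup∘update′ v≢w ρ u) (trans (h v (v≢w , f)) (sym (lookup∘update′ v≢w ρ′ u)))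

exp₂-* : ∀ a b → exp₂ a * exp₂ b ≤ exp₂ (suc (a + b))
exp₂-* a b = begin
  2 ^ (2 ^ a) * 2 ^ (2 ^ b)            ≡⟨ ^-distribˡ-+-* 2 (2 ^ a) (2 ^ b) ⟨
  2 ^ (2 ^ a + 2 ^ b)                  ≤⟨ ^-monoʳ-≤ 2 (+-mono-≤ (^-monoʳ-≤ 2 (m≤m+n a b)) (^-monoʳ-≤ 2 (m≤n+m b a))) ⟩
  2 ^ (2 ^ (a + b) + 2 ^ (a + b))      ≤⟨ ^-monoʳ-≤ 2 (+-monoʳ-≤ (2 ^ (a + b)) (m≤m+n _ 0)) ⟩
  2 ^ (2 ^ suc (a + b))                ∎
  where open ≤-Reasoning

-- Turns the linear exponent of the bounds into the polynomial form of the complexity class. For n =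
-- 1 the power is useless and the additive constant does the work.
n^c+c : ∀ s d n → 1 ≤ n → s * n + d ≤ n ^ suc (s + d) + suc (s + d)
n^c+c s d 1 _ = ≤-trans (+-monoˡ-≤ d (≤-reflexive (*-identityʳ s)))
    (≤-trans (n≤1+n (s + d)) (m≤n+m (suc (s + d)) (1 ^ suc (s + d))))
n^c+c s d (suc (suc n)) _ = +-mono-≤
  (≤-trans (≤-reflexive (*-comm s (2 + n))) (*-monoʳ-≤ (2 + n)
      (≤-trans (≤-trans (m≤m+n s d) (<⇒≤ (n<2^n (s + d)))) (^-monoˡ-≤ (s + d) (s≤s (s≤s (z≤n {n})))))))
  (≤-trans (m≤n+m d s) (n≤1+n (s + d)))

module Time (k s E : ℕ) where

  -- Collects the constants: the logarithm of the space bound is at most `(2 + k) + (y + y)` with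
  -- `y ≤ (4 + k) * B`, hence E times it is at most `D * B`.
  D : ℕ
  D = E * ((2 + k) + ((4 + k) + (4 + k)))

  exponent : ℕ
  exponent = suc (s + suc (D + 3))

  module _ (n : ℕ) where

    g B : ℕ
    g = exp₂ (s * n)
    B = g + g * g

    1≤g : 1 ≤ g
    1≤g = m^n>0 2 (2 ^ (s * n))

    2≤g : 2 ≤ g
    2≤g = ^-monoʳ-≤ 2 (m^n>0 2 (s * n))

    1≤B : 1 ≤ B
    1≤B = ≤-trans 1≤g (m≤m+n g (g * g))

    B≤ : B ≤ exp₂ (s * n + 3)
    B≤ = begin
      g + g * g               ≤⟨ +-monoˡ-≤ (g * g) (m≤m*n g g {{>-nonZero′ 1≤g}}) ⟩
      g * g + g * g           ≤⟨ +-monoʳ-≤ (g * g) (m≤m+n (g * g) 0) ⟩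
      2 * (g * g)             ≤⟨ *-monoˡ-≤ (g * g) 2≤g ⟩
      g * (g * g)             ≡⟨ cong (λ x → g * (g * x)) (*-identityʳ g) ⟨
      g ^ 3                   ≤⟨ exp₂-^ (s * n) 3 ⟩
      exp₂ (s * n + 3)        ∎
      where
      open ≤-Reasoning
      >-nonZero′ : ∀ {a} → 1 ≤ a → NonZero a
      >-nonZero′ = >-nonZero

    y : ℕ
    y = suc (k * B) + (2 + B)

    Y≤ : suc (length (words k B)) * (3 * suc B) ≤ 2 ^ y
    Y≤ = begin
      suc (length (words k B)) * (3 * suc B)  ≤⟨ *-mono-≤ X≤ (*-mono-≤ {3} {4} (n≤1+n 3) (n<2^n B)) ⟩
      2 ^ suc (k * B) * (4 * 2 ^ B)           ≡⟨ cong (2 ^ suc (k * B) *_) (*-assoc 2 2 (2 ^ B)) ⟩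
      2 ^ suc (k * B) * 2 ^ (2 + B)           ≡⟨ ^-distribˡ-+-* 2 (suc (k * B)) (2 + B) ⟨
      2 ^ y                                   ∎
      where
      open ≤-Reasoning
      X≤ : suc (length (words k B)) ≤ 2 ^ suc (k * B)
      X≤ = begin
        suc (length (words k B))        ≤⟨ s≤s (length-words k B) ⟩
        suc (suc k ^ B)                 ≤⟨ +-mono-≤ (m^n>0 2 (k * B)) (^-monoˡ-≤ B (n<2^n k)) ⟩
        2 ^ (k * B) + (2 ^ k) ^ B       ≡⟨ cong (2 ^ (k * B) +_) (^-*-assoc 2 k B) ⟩
        2 ^ (k * B) + 2 ^ (k * B)       ≤⟨ +-monoʳ-≤ (2 ^ (k * B)) (m≤m+n _ 0) ⟩
        2 ^ suc (k * B)                 ∎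

    space≤ : spaceBound k B ≤ 2 ^ ((2 + k) + (y + y))
    space≤ = ≤-trans (*-mono-≤ (<⇒≤ (n<2^n (2 + k))) (≤-trans (*-mono-≤ Y≤ Y≤)
        (≤-reflexive (sym (^-distribˡ-+-* 2 y y)))))
                     (≤-reflexive (sym (^-distribˡ-+-* 2 (2 + k) (y + y))))

    y≤ : y ≤ (4 + k) * B
    y≤ = ≤-trans (≤-reflexive (solve 2 (λ c b → (con 1 :+ c) :+ (con 2 :+ b) := (con 3 :+ b) :+ c) refl (k * B) B))
      (≤-trans (+-monoˡ-≤ (k * B) (+-monoˡ-≤ B (*-monoʳ-≤ 3 1≤B)))
        (≤-reflexive (solve 2 (λ b c → con 3 :* b :+ b :+ c :* b := (con 4 :+ c) :* b) refl B k)))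

    exponent≤ : E * ((2 + k) + (y + y)) ≤ exp₂ (s * n + suc (D + 3))
    exponent≤ = begin
      E * ((2 + k) + (y + y))
        ≤⟨ *-monoʳ-≤ E (+-mono-≤ (m≤m*n (2 + k) B {{>-nonZero 1≤B}}) (+-mono-≤ y≤ y≤)) ⟩
      E * ((2 + k) * B + ((4 + k) * B + (4 + k) * B))
        ≡⟨ solve 4 (λ e b p q → e :* (p :* b :+ (q :* b :+ q :* b)) := e :* (p :+ (q :+ q)) :* b) refl E B (2 + k)
            (4 + k) ⟩
      D * B                                ≤⟨ *-mono-≤ (n≤exp₂ D) B≤ ⟩
      exp₂ D * exp₂ (s * n + 3)            ≤⟨ exp₂-* D (s * n + 3) ⟩
      exp₂ (suc (D + (s * n + 3)))         ≡⟨ cong exp₂ (solve 2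
          (λ d x → con 1 :+ (d :+ (x :+ con 3)) := x :+ (con 1 :+ (d :+ con 3))) refl D (s * n)) ⟩
      exp₂ (s * n + suc (D + 3))           ∎
      where open ≤-Reasoning

    time≤ : 1 ≤ n → spaceBound k B ^ E ≤ 2 ^ (2 ^ (2 ^ (n ^ exponent + exponent)))
    time≤ 1≤n = begin
      spaceBound k B ^ E                       ≤⟨ ^-monoˡ-≤ E space≤ ⟩
      (2 ^ ((2 + k) + (y + y))) ^ E            ≡⟨ ^-*-assoc 2 ((2 + k) + (y + y)) E ⟩
      2 ^ (((2 + k) + (y + y)) * E)            ≡⟨ cong (2 ^_) (*-comm ((2 + k) + (y + y)) E) ⟩
      2 ^ (E * ((2 + k) + (y + y)))            ≤⟨ ^-monoʳ-≤ 2 exponent≤ ⟩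
      2 ^ exp₂ (s * n + suc (D + 3))           ≤⟨ ^-monoʳ-≤ 2 (exp₂-mono (n^c+c s (suc (D + 3)) n 1≤n)) ⟩
      2 ^ (2 ^ (2 ^ (n ^ exponent + exponent))) ∎
      where open ≤-Reasoning

-- The two machines within their resources

module Instance (k : ℕ) (O : Set) (φ : FO k 2) where

  tableBound : ℕ
  tableBound = exp₂ (3 * (2 + k) * ∣ φ ∣) + exp₂ (3 * (2 + k) * ∣ φ ∣) * exp₂ (3 * (2 + k) * ∣ φ ∣)

  Z : ℕ
  Z = spaceBound k tableBound

  2≤Z : 2 ≤ Z
  2≤Z = 2≤spaceBound k tableBound

  open Space k tableBound
  open Basics k O Z
  open Preparation k O Z
  open Setup k O Z 2≤Z φ

  B≤Z : B ≤ Z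
  B≤Z = B≤Space

  words≤Z : ∀ h → h ≤ B → length (wordTable (words k h)) ≤ Z
  words≤Z = words≤ O

  tab≤Z : ∀ (w : Value) → (∀ x y → length (w x y) ≤ ∣ φ ∣) → length (tab w ps) ≤ Z
  tab≤Z = pairTab≤ O (≤-trans size≤g g≤B) ps-sound

  reps≤Z : ∀ qs → All (λ q → length q ≤ g) qs → length qs ≤ length (words k g) → length (wordTable qs) ≤ Z
  reps≤Z qs s l = wordTable≤ O qs (All.map (λ lq → ≤-trans lq g≤B) s) (≤-trans l (length-words-mono k g≤B))

  within : ∀ {w : List (Symbol k 2)} {O v} {n} (finite : Finite (Cell (Symbol k 2) O (Work k)))
      (p : Prog (Sym {Symbol k 2} {O} {Work k}) (suc n)) {σ} →
    Run Z p (map inj₁ w ∷ Vec.replicate n []) (map (inj₂ ∘ inj₁) v ∷ σ) →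
    let c = Time.exponent k (3 * (2 + k)) (costExponent p) in
    Computes_↦_Within_ (machine finite p) w v (2 ^ (2 ^ (2 ^ (∣ φ ∣ ^ c + c))))
  within finite p x with t , c , l , h , e ← computes finite x =
    t , c , ≤-trans l (≤-trans (cost≤ 2≤Z p) (Time.time≤ k (3 * (2 + k)) (costExponent p) ∣ φ ∣ (size>0 φ))) , h , e

-- The left side counts the code of an automaton with r states: the start state, then for each state
-- its status and k successors, every state number being written in at most `suc r` symbols.
output-bound : ∀ k r y → suc r ≤ y → suc r + r * suc (k * suc r) ≤ (2 + k) * (y * y)
output-bound k r y r<y = begin
  suc r + r * suc (k * suc r)         ≤⟨ +-mono-≤ (≤-reflexive (sym (*-identityʳ (suc r))))
      (*-monoˡ-≤ (suc (k * suc r)) (n≤1+n r)) ⟩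
  suc r * 1 + suc r * suc (k * suc r) ≡⟨ *-distribˡ-+ (suc r) 1 (suc (k * suc r)) ⟨
  suc r * (2 + k * suc r)             ≤⟨ *-monoʳ-≤ (suc r) (+-monoˡ-≤ (k * suc r) (m≤m*n 2 (suc r))) ⟩
  suc r * (2 * suc r + k * suc r)     ≡⟨ cong (suc r *_) (*-distribʳ-+ (suc r) 2 k) ⟨
  suc r * ((2 + k) * suc r)           ≡⟨ *-assoc (suc r) (2 + k) (suc r) ⟨
  suc r * (2 + k) * suc r             ≡⟨ cong (_* suc r) (*-comm (suc r) (2 + k)) ⟩
  (2 + k) * suc r * suc r             ≡⟨ *-assoc (2 + k) (suc r) (suc r) ⟩
  (2 + k) * (suc r * suc r)           ≤⟨ *-monoʳ-≤ (2 + k) (*-mono-≤ r<y r<y) ⟩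
  (2 + k) * (y * y)                   ∎
  where open ≤-Reasoning

module DFAInstance (k : ℕ) (φ : FO k 2) where

  open Instance k DFASymbol φ
  open Space k tableBound using (X; Y)
  open Setup k DFASymbol Z 2≤Z φ
  open Sized B≤Z words≤Z tab≤Z using (truth)
  open AutomatonRuns k Z 2≤Z φ B≤Z words≤Z tab≤Z reps≤Z public

  r : ℕ
  r = length reps

  rank≤ : ∀ w → length (rankSymbols dist reps w) ≤ suc r
  rank≤ w = ≤-trans (≤-reflexive (trans (length-++ (replicate (rankOf separates reps w) tick))
                      (trans (+-comm _ 1) (cong suc (length-replicate (rankOf separates reps w))))))
                    (s≤s (rankOf≤ separates reps w))

  states≤ : ∀ q → length (stateSymbols dist truth reps reps-short reps-table q) ≤ suc (k * suc r)
  states≤ q = s≤s (≤-trans (length-concatMap≤ (λ a → rankSymbols dist reps (q ++ [ a ])) (allFin k)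
      (λ a → rank≤ (q ++ [ a ])))
                           (*-monoˡ-≤ (suc r) (≤-reflexive (length-tabulate {n = k} id))))

  r<Y : suc r ≤ Y
  r<Y = ≤-trans (s≤s (≤-trans (proj₂ (representatives-good dist)) (length-words-mono k g≤B)))
      (m≤m*n (suc X) (3 * suc tableBound))

  result≤ : length result-symbols ≤ Z
  result≤ = ≤-trans (≤-reflexive (length-++ (rankSymbols dist reps [])))
    (≤-trans (+-mono-≤ (rank≤ []) (length-concatMap≤ (stateSymbols dist truth reps reps-short reps-table) reps states≤))
             (output-bound k r Y r<Y))

canonicalDFA-3EXPTIME : ∀ k → CanonicalDFA-3EXPTIME k
canonicalDFA-3EXPTIME k =
  machine finite program , Time.exponent k (3 * (2 + k)) (costExponent program) ,
  λ (φ , _) → let open DFAInstance k φ in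
    result-symbols , (minimalAutomaton , minimalAutomaton-canonical , result-correct) ,
    Instance.within k DFASymbol φ finite program (proj₂ (dfaProgram-run result≤))
  where
  finite : Finite (Cell (Symbol k 2) DFASymbol (Work k))
  finite = finite-Cell finite-Symbol finite-DFASymbol finite-Work
  program = Automata.dfaProgram k (3 * (2 + k))

module TruthInstance (k : ℕ) (φ : FO k 2) where

  open Instance k Bool φ
  open Programs k Bool
  open Basics k Bool Z
  open Preparation k Bool Z
  open Setup k Bool Z 2≤Z φ
  open Sized B≤Z words≤Z tab≤Z
  open Main k Bool
  open Truths k

  holds : Bool
  holds = truth [] []

  first-word : ∀ n → ∃ λ ws → words k n ≡ [] ∷ ws
  first-word zero    = _ , refl
  first-word (suc n) = _ , refl

  first-row : ∀ (v : Value) {us ws} → us ≡ [] ∷ ws → ∃ λ rest → tab v (pairsOf us) ≡ row [] [] (v [] []) rest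
  first-row v refl = _ , refl

  AfterPreparation : Stack → Set
  AfterPreparation u = Run Z (prepare scaleₖ) (input-of φ ∷ Vec.replicate 20 []) (finalStore [ 1F ]≔ u)

  truthProgram-run : ∃ λ σ → Run Z (truthProgram scaleₖ) (input-of φ ∷ Vec.replicate 20 []) ((out holds ∷ []) ∷ σ)
  truthProgram-run = finish (first-row (truth ◂ none) (proj₂ (first-word B)))
    where
    finish : (∃ λ rest → tab (truth ◂ none) ps ≡ hash ∷ hash ∷ bit holds ∷ eor ∷ rest) →
      ∃ λ σ → Run Z (truthProgram scaleₖ) (input-of φ ∷ Vec.replicate 20 []) ((out holds ∷ []) ∷ σ)
    finish (rest , e) = _ , (subst AfterPreparation e prepare-run ⨾ pop ⨾ pop ⨾ answer holds)
      where
      answer : ∀ b {rest} {τ : Vec Stack 19} →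
        Run Z (branch (topBit 1F) (push 0F (λ _ → out true)) (push 0F (λ _ → out false)))
          ([] ∷ (bit b ∷ rest) ∷ τ) ((out b ∷ []) ∷ (bit b ∷ rest) ∷ τ)
      answer true  = on-true refl push
      answer false = on-false refl push

  holds-correct : Closed φ → Reflects (True φ) holds
  holds-correct closed = subst (Reflects (True φ)) (sym (truth-correct {[]} {[]} z≤n z≤n))
      (decided (sat? φ ([] ∷ [] ∷ [])))
    where
    decided : (a? : Dec (([] ∷ [] ∷ []) ⊨ φ)) → Reflects (True φ) ⌊ a? ⌋
    decided (yes p) = ofʸ (λ ρ → coincidence φ (λ v f → contradiction f (closed v)) p)
    decided (no ¬p) = ofⁿ (λ t → ¬p (t _))

truth-3EXPTIME : ∀ k → Truth-3EXPTIME k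
truth-3EXPTIME k =
  machine finite program , Time.exponent k (3 * (2 + k)) (costExponent program) ,
  λ (φ , closed) → let open TruthInstance k φ in
    holds ∷ [] , (holds , holds-correct closed , refl) ,
    Instance.within k Bool φ finite program (proj₂ truthProgram-run)
  where
  finite : Finite (Cell (Symbol k 2) Bool (Work k))
  finite = finite-Cell finite-Symbol finite-Bool finite-Work
  program = Truths.truthProgram k (3 * (2 + k))

theorem28 : (k : ℕ) →
    (∃ λ c → (φ : FO k 2) → AtMostOneFree φ →
    PiecewiseTestable L⟨ φ ⟩ ×
    (∃ λ h → IsHeight L⟨ φ ⟩ h × h ≤ 2 ^ (2 ^ (c * ∣ φ ∣))))
    × CanonicalDFA-3EXPTIME k
    × Truth-3EXPTIME k
theorem28 k =
  -- The slope `2 + k` is what a quantifier adds to the argument of `exp₂` by `rank+2`.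
  (2 + k , λ φ _ → let pt , h , is-height , h≤ = height φ in
    pt , h , is-height , ≤-trans h≤ (≤-trans (m≤n+m (degree φ) 2) (degree≤ φ))) ,
  canonicalDFA-3EXPTIME k , truth-3EXPTIME k
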